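{- There exists an absolute constant $c>0$ such that for all integers $r\geq 2$ and $k\ge 3$, \[ f(k;r)\leq k^{400k^4}R^{40k^2}\leq 2^{c(k^4\log k+k^3r\log r)}, \] where $R=R(k;r)$ is the $r$-color Ramsey number for $K_k$.
   Context: For graphs $G,F$ and an integer $r\ge 2$, write $G\rightarrow (F)_r$ if every coloring of the edges of $G$ with $r$ colors yields a monochromatic copy (subgraph isomorphic to $F$) of $F$. $R(k;r)$ denotes the smallest $n$ such that $K_n\rightarrow (K_k)_r$. A graph $G$ is $(k;r)$-Folkman if $G\rightarrow (K_k)_r$ and $G$ contains no copy of $K_{k+1}$. The $r$-color Folkman number $f(k;r)$ is the minimum number of vertices of a $(k;r)$-Folkman graph. Here $\log$ denotes the binary logarithm. -}

module Defs where

open import Data.Nat using (ℕ; suc; _<_)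
open import Data.Bool using (Bool; true; false; not)
open import Data.Fin using (Fin; _≟_)
open import Data.Product using (Σ; ∃; _×_)
open import Relation.Nullary using (¬_)
open import Relation.Nullary.Decidable using (⌊_⌋)
open import Relation.Binary.PropositionalEquality using (_≡_; _≢_)
open import Function.Definitions using (Injective)

record Graph (n : ℕ) : Set where
  field
    adj    : Fin n → Fin n → Bool
    adj-sym    : ∀ i j → adj i j ≡ adj j i
    adj-irrefl : ∀ i → adj i i ≡ false
open Graph public

K : (n : ℕ) → Graph n
K n = record
  { adj = λ i j → not ⌊ i ≟ j ⌋
  ; adj-sym = symK
  ; adj-irrefl = irrK }
  where
  open import Relation.Binary.PropositionalEquality using (refl) renaming (sym to ≡-sym)
  open import Relation.Nullary using (yes; no)
  symK : ∀ (i j : Fin n) → not ⌊ i ≟ j ⌋ ≡ not ⌊ j ≟ i ⌋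
  symK i j with i ≟ j | j ≟ i
  ... | yes _ | yes _ = refl
  ... | no _  | no _  = refl
  ... | yes p | no q  = Data.Empty.⊥-elim (q (≡-sym p)) where import Data.Empty
  ... | no p  | yes q = Data.Empty.⊥-elim (p (≡-sym q)) where import Data.Empty
  irrK : ∀ (i : Fin n) → not ⌊ i ≟ i ⌋ ≡ false
  irrK i with i ≟ i
  ... | yes _ = refl
  ... | no p  = Data.Empty.⊥-elim (p refl) where import Data.Empty

-- An r-colouring of the edges of G: a symmetric colour assignment to pairs;
-- only its values on edges of G are ever used.
IsEdgeColouring : {n : ℕ} (r : ℕ) → (Fin n → Fin n → Fin r) → Set
IsEdgeColouring {n} r col = ∀ (i j : Fin n) → col i j ≡ col j i

ContainsClique : {n : ℕ} → Graph n → ℕ → Set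
ContainsClique {n} G m =
  Σ (Fin m → Fin n) λ φ → Injective _≡_ _≡_ φ ×
    (∀ i j → i ≢ j → adj G (φ i) (φ j) ≡ true)

HasMonoClique : {n : ℕ} (G : Graph n) (k r : ℕ) → (Fin n → Fin n → Fin r) → Set
HasMonoClique {n} G k r col =
  Σ (Fin r) λ c → Σ (Fin k → Fin n) λ φ → Injective _≡_ _≡_ φ ×
    (∀ i j → i ≢ j → adj G (φ i) (φ j) ≡ true × col (φ i) (φ j) ≡ c)

Arrows : {n : ℕ} → Graph n → ℕ → ℕ → Set
Arrows {n} G k r =
  ∀ (col : Fin n → Fin n → Fin r) → IsEdgeColouring r col → HasMonoClique G k r col

IsFolkman : {n : ℕ} → Graph n → ℕ → ℕ → Set
IsFolkman G k r = Arrows G k r × ¬ ContainsClique G (suc k)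

IsRamseyNumber : ℕ → ℕ → ℕ → Set
IsRamseyNumber k r R = Arrows (K R) k r × (∀ m → m < R → ¬ Arrows (K m) k r)

-- f(k;r) ≤ N : some (k;r)-Folkman graph has at most N vertices.
FolkmanAtMost : ℕ → ℕ → ℕ → Set
FolkmanAtMost k r N = Σ ℕ λ n → Σ (Graph n) λ G → IsFolkman G k r × n Data.Nat.≤ N
  where import Data.Nat

{-# OPTIONS --safe #-}
-- A random graph of density 1 / q, with one edge of every K_{k+1} deleted, is Folkman. Both requirements meet in
-- the window n^(2/(k+2)) ≪ q ≪ n^(2/(k+1)), where each edge is in few K_{k+1} but in many K_k.
--
-- If G has a colouring without monochromatic K_k, every colour class is independent in the hypergraph of the copies
-- of K_k on the pairs of [n], hence lies in one of few containers, each inducing few copies of K_k. By averaging over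
-- the maps [R] → [n], r such containers miss at least n² / 2R² pairs. All edges of G among these pairs were deleted;
-- but by Chernoff's bound and the union bound over all r-tuples of containers, G has more edges there than there
-- are copies of K_{k+1}.
--
-- Containers come from a fingerprint. Given L, a list of tails of hyperedges whose earlier coordinates lie in the
-- independent set I, one picks v ∈ I with many tails in L none of whose codegrees in the next list F is saturated,
-- and adds these tails to F. If this produces enough tails, F replaces L; since no hyperedge lies in I, at
-- some stage no suitable v ∈ I is left. The suitable v then all lie outside I and carry a constant fraction of the
-- hyperedges. Restarting with the hyperedges that avoid them shrinks the hypergraph geometrically.
module Submission where

open import Defs
open import Data.Nat
open import Data.Nat.Properties
open import Data.Nat.Tactic.RingSolver using (solve-∀)
open import Data.Bool using (Bool; T; true; false; not; _∧_; _∨_; if_then_else_)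
open import Data.Bool.ListAction using (any)
open import Data.Bool.Properties using (∧-comm)
open import Data.Empty using (⊥-elim)
open import Data.Fin using (Fin; zero; suc; toℕ; combine; remQuot; _↑ˡ_; _↑ʳ_)
import Data.Fin as Fin
import Data.Fin.Properties as FinP
open import Data.Fin.Patterns using (0F; 1F; 2F)
open import Data.List using (List; []; _∷_; _++_; map; length; filterᵇ)
import Data.List as List
open import Data.List.Membership.Propositional using (_∈_)
open import Data.List.Membership.Propositional.Properties using (∈-map⁺; ∈-map⁻; ∈-++⁺ˡ; ∈-++⁺ʳ; ∈-++⁻; ∈-lookup)
open import Data.List.Properties using (length-map; length-++)
import Data.List.Relation.Unary.All as LAll
import Data.List.Relation.Unary.All.Properties as LAllP
import Data.List.Relation.Unary.AllPairs as LAllPairs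
import Data.List.Relation.Unary.AllPairs.Properties as LAllPairsP
open import Data.List.Relation.Unary.Any using (here; there)
open import Data.Product using (Σ; ∃; _×_; _,_; proj₁; proj₂)
open import Data.Sum using (_⊎_; inj₁; inj₂; [_,_]′)
open import Data.Vec using (Vec; []; _∷_; lookup; tabulate; _[_]≔_)
import Data.Vec as Vec
open import Data.Vec.Properties using (lookup∘update′; lookup∘tabulate; tabulate∘lookup)
import Data.Vec.Relation.Unary.All as VAll
import Data.Vec.Relation.Unary.All.Properties as VAllP
import Data.Vec.Relation.Unary.AllPairs as VAllPairs
import Data.Vec.Relation.Unary.AllPairs.Properties as VAllPairsP
import Data.Vec.Relation.Unary.Any as VAny
open import Data.Vec.Relation.Unary.Unique.Propositional using (Unique)
import Data.Vec.Relation.Unary.Unique.Propositional.Properties as UniqueP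
open import Function using (_∘_; id)
open import Function.Definitions using (Injective)
open import Relation.Binary.Definitions using (tri<; tri≈; tri>)
open import Relation.Binary.PropositionalEquality
  using (_≡_; _≢_; refl; sym; trans; cong; cong₂; subst; subst₂; module ≡-Reasoning)
open import Relation.Nullary using (¬_; Dec; yes; no; does)

open LAll using ([]; _∷_)
open LAllPairs using ([]; _∷_)
open VAll using ([]; _∷_) renaming (All to VAll)
open VAllPairs using ([]; _∷_) renaming (AllPairs to VAllPairs)
open VAny using () renaming (Any to VAny)

-- Probabilities appear as counts over `vecs`, cleared of denominators. All sizes are powers of one
-- number Z: with n = Z^(4(k+1)(k+2)) the window for q reaches from Z^(8k+8) to Z^(8k+16). The graph
-- takes q = Z^(8k+10), the containers a separate, larger q₀ = Z^(8k+13). The reason: a fingerprint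
-- has about n^2 / q₀ vertices per level, and this number, times the levels, the restarts, the
-- colours and log n, has to stay below the roughly n^2 / q edges that Chernoff's bound can use. The
-- gap between q and q₀ must therefore absorb the number of restarts, the dominant factor. It is of
-- order K^tri(k), since each of the tri(k) levels relaxes the codegree bounds by a factor K. So Z
-- is at least K^tri(k), and n is Z to a power of order k^2. A plain union bound over the subsets of
-- the coordinates would ask for K exponential in tri(k) and lead to n of order 2^(c k^6). Weighting
-- the subsets by their size makes K = k^4 sufficient, and then Z = k^(40 k^2) R^4 suffices.

private variable
  A B : Set
  k m n N r R : ℕ

-- Finite sums

true≢false : true ≢ false
true≢false ()

∑ : List A → (A → ℕ) → ℕ
∑ [] f = 0
∑ (x ∷ xs) f = f x + ∑ xs f

𝟙 : Bool → ℕ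
𝟙 true = 1
𝟙 false = 0

𝟙≤1 : ∀ b → 𝟙 b ≤ 1
𝟙≤1 true = ≤-refl
𝟙≤1 false = z≤n

∑-mono-∈ : (xs : List A) {f g : A → ℕ} → (∀ {x} → x ∈ xs → f x ≤ g x) → ∑ xs f ≤ ∑ xs g
∑-mono-∈ [] h = z≤n
∑-mono-∈ (x ∷ xs) h = +-mono-≤ (h (here refl)) (∑-mono-∈ xs (h ∘ there))

∑-mono : (xs : List A) {f g : A → ℕ} → (∀ x → f x ≤ g x) → ∑ xs f ≤ ∑ xs g
∑-mono xs h = ∑-mono-∈ xs λ {x} _ → h x

∑-cong : (xs : List A) {f g : A → ℕ} → (∀ x → f x ≡ g x) → ∑ xs f ≡ ∑ xs g
∑-cong [] h = refl
∑-cong (x ∷ xs) h = cong₂ _+_ (h x) (∑-cong xs h)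

+-interchange : ∀ a b c d → (a + b) + (c + d) ≡ (a + c) + (b + d)
+-interchange = solve-∀

∑-+ : (xs : List A) (f g : A → ℕ) → ∑ xs (λ x → f x + g x) ≡ ∑ xs f + ∑ xs g
∑-+ [] f g = refl
∑-+ (x ∷ xs) f g rewrite ∑-+ xs f g = +-interchange (f x) (g x) (∑ xs f) (∑ xs g)

∑-*ˡ : (xs : List A) (c : ℕ) (f : A → ℕ) → ∑ xs (λ x → c * f x) ≡ c * ∑ xs f
∑-*ˡ [] c f = sym (*-zeroʳ c)
∑-*ˡ (x ∷ xs) c f rewrite ∑-*ˡ xs c f = sym (*-distribˡ-+ c (f x) (∑ xs f))

∑-*ʳ : (xs : List A) (c : ℕ) (f : A → ℕ) → ∑ xs (λ x → f x * c) ≡ ∑ xs f * c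
∑-*ʳ [] c f = refl
∑-*ʳ (x ∷ xs) c f rewrite ∑-*ʳ xs c f = sym (*-distribʳ-+ c (f x) (∑ xs f))

∑-const : (xs : List A) (c : ℕ) → ∑ xs (λ _ → c) ≡ length xs * c
∑-const [] c = refl
∑-const (x ∷ xs) c = cong (c +_) (∑-const xs c)

∑-zero : (xs : List A) → ∑ xs (λ _ → 0) ≡ 0
∑-zero xs = trans (∑-const xs 0) (*-zeroʳ (length xs))

∑-≤const : (xs : List A) (c : ℕ) {f : A → ℕ} → (∀ {x} → x ∈ xs → f x ≤ c) → ∑ xs f ≤ length xs * c
∑-≤const xs c h = ≤-trans (∑-mono-∈ xs h) (≤-reflexive (∑-const xs c))

∑-++ : (xs ys : List A) (f : A → ℕ) → ∑ (xs ++ ys) f ≡ ∑ xs f + ∑ ys f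
∑-++ [] ys f = refl
∑-++ (x ∷ xs) ys f rewrite ∑-++ xs ys f = sym (+-assoc (f x) _ _)

∑-map : (h : A → B) (xs : List A) (f : B → ℕ) → ∑ (map h xs) f ≡ ∑ xs (f ∘ h)
∑-map h [] f = refl
∑-map h (x ∷ xs) f = cong (f (h x) +_) (∑-map h xs f)

∑-swap : (xs : List A) (ys : List B) (f : A → B → ℕ) →
  ∑ xs (λ x → ∑ ys (f x)) ≡ ∑ ys (λ y → ∑ xs (λ x → f x y))
∑-swap [] ys f = sym (∑-zero ys)
∑-swap (x ∷ xs) ys f rewrite ∑-swap xs ys f = sym (∑-+ ys (f x) _)

∑-filter : (p : A → Bool) (xs : List A) (f : A → ℕ) → ∑ (filterᵇ p xs) f ≡ ∑ xs (λ x → 𝟙 (p x) * f x)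
∑-filter p [] f = refl
∑-filter p (x ∷ xs) f with p x
... | true  = cong₂ _+_ (sym (*-identityˡ (f x))) (∑-filter p xs f)
... | false = ∑-filter p xs f

∑-filter-≤ : (p : A → Bool) (xs : List A) (f : A → ℕ) → ∑ (filterᵇ p xs) f ≤ ∑ xs f
∑-filter-≤ p xs f = ≤-trans (≤-reflexive (∑-filter p xs f))
  (∑-mono xs λ x → ≤-trans (*-monoˡ-≤ (f x) (𝟙≤1 (p x))) (≤-reflexive (*-identityˡ (f x))))

length-∑ : (xs : List A) → length xs ≡ ∑ xs (λ _ → 1)
length-∑ xs = sym (trans (∑-const xs 1) (*-identityʳ (length xs)))

length-filter-∑ : (p : A → Bool) (xs : List A) → length (filterᵇ p xs) ≡ ∑ xs (𝟙 ∘ p)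
length-filter-∑ p xs = trans (length-∑ (filterᵇ p xs))
  (trans (∑-filter p xs (λ _ → 1)) (∑-cong xs λ x → *-identityʳ (𝟙 (p x))))

length-filter-≤ : (p : A → Bool) (xs : List A) → length (filterᵇ p xs) ≤ length xs
length-filter-≤ p xs = subst₂′ (∑-filter-≤ p xs (λ _ → 1))
  where
  subst₂′ : ∑ (filterᵇ p xs) (λ _ → 1) ≤ ∑ xs (λ _ → 1) → length (filterᵇ p xs) ≤ length xs
  subst₂′ h rewrite length-∑ (filterᵇ p xs) | length-∑ xs = h

∈-filterᵇ⁻ : (p : A → Bool) (xs : List A) {x : A} → x ∈ filterᵇ p xs → x ∈ xs × p x ≡ true
∈-filterᵇ⁻ p (y ∷ xs) x∈ with p y in eq
... | false = let (a , b) = ∈-filterᵇ⁻ p xs x∈ in there a , b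
∈-filterᵇ⁻ p (y ∷ xs) (here refl) | true = here refl , eq
∈-filterᵇ⁻ p (y ∷ xs) (there x∈)  | true = let (a , b) = ∈-filterᵇ⁻ p xs x∈ in there a , b

term≤∑ : {xs : List A} (f : A → ℕ) {x : A} → x ∈ xs → f x ≤ ∑ xs f
term≤∑ f (here refl) = m≤m+n _ _
term≤∑ f (there x∈) = ≤-trans (term≤∑ f x∈) (m≤n+m _ _)

∑𝟙-zero-or-∃ : (xs : List A) (p : A → Bool) →
  ∑ xs (𝟙 ∘ p) ≡ 0 ⊎ ∃ λ x → x ∈ xs × p x ≡ true
∑𝟙-zero-or-∃ [] p = inj₁ refl
∑𝟙-zero-or-∃ (x ∷ xs) p with p x in eq | ∑𝟙-zero-or-∃ xs p
... | true  | _ = inj₂ (x , here refl , eq)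
... | false | inj₁ e = inj₁ e
... | false | inj₂ (y , y∈ , e) = inj₂ (y , there y∈ , e)

any-or-none : (xs : List A) (p : A → Bool) →
  (∃ λ x → x ∈ xs × p x ≡ true) ⊎ (∀ {x} → x ∈ xs → p x ≡ false)
any-or-none [] p = inj₂ λ ()
any-or-none (x ∷ xs) p with p x in eq | any-or-none xs p
... | true  | _ = inj₁ (x , here refl , eq)
... | false | inj₁ (y , y∈ , e) = inj₁ (y , there y∈ , e)
... | false | inj₂ h = inj₂ λ { (here refl) → eq ; (there y∈) → h y∈ }

∃-below-average : (xs : List A) (f : A → ℕ) (c : ℕ) → ∑ xs f < length xs * c →
  ∃ λ x → x ∈ xs × f x < c
∃-below-average [] f c ()
∃-below-average (x ∷ xs) f c h with f x <? c
... | yes p = x , here refl , p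
... | no ¬p with ∃-below-average xs f c (+-cancelˡ-< c _ _ (≤-<-trans (+-monoˡ-≤ _ (≮⇒≥ ¬p)) h))
...   | y , y∈ , e = y , there y∈ , e

fins : ∀ n → List (Fin n)
fins zero = []
fins (suc n) = zero ∷ map suc (fins n)

length-fins : ∀ n → length (fins n) ≡ n
length-fins zero = refl
length-fins (suc n) = cong suc (trans (length-map suc (fins n)) (length-fins n))

∈-fins : (i : Fin n) → i ∈ fins n
∈-fins zero = here refl
∈-fins (suc i) = there (∈-map⁺ suc (∈-fins i))

infix 4 _==_
_==_ : Fin n → Fin n → Bool
x == y = does (x Fin.≟ y)

==⇒≡ : (x y : Fin n) → (x == y) ≡ true → x ≡ y
==⇒≡ x y h with x Fin.≟ y
... | yes p = p

==-refl : (x : Fin n) → (x == x) ≡ true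
==-refl x with x Fin.≟ x
... | yes _ = refl
... | no ¬p = ⊥-elim (¬p refl)

∑-δ : (x : Fin n) (f : Fin n → ℕ) → ∑ (fins n) (λ y → 𝟙 (x == y) * f y) ≡ f x
∑-δ {suc n} zero f = trans (cong₂ _+_ (*-identityˡ (f zero))
    (trans (∑-map suc (fins n) _) (∑-zero (fins n)))) (+-identityʳ (f zero))
∑-δ {suc n} (suc x) f = trans (∑-map suc (fins n) _) (∑-δ x (f ∘ suc))

∑-δ1 : (x : Fin n) → ∑ (fins n) (λ y → 𝟙 (x == y)) ≡ 1
∑-δ1 x = trans (∑-cong (fins _) λ y → sym (*-identityʳ (𝟙 (x == y)))) (∑-δ x (λ _ → 1))

vecs : List A → ∀ m → List (Vec A m)
vecs xs zero = [] ∷ []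
vecs xs (suc m) = List.concatMap (λ x → map (x ∷_) (vecs xs m)) xs

∑-concatMap : (h : A → List B) (xs : List A) (f : B → ℕ) →
  ∑ (List.concatMap h xs) f ≡ ∑ xs (λ x → ∑ (h x) f)
∑-concatMap h [] f = refl
∑-concatMap h (x ∷ xs) f = trans (∑-++ (h x) _ f) (cong (∑ (h x) f +_) (∑-concatMap h xs f))

∑-vecs : (xs : List A) (m : ℕ) (f : Vec A (suc m) → ℕ) →
  ∑ (vecs xs (suc m)) f ≡ ∑ xs (λ x → ∑ (vecs xs m) (λ v → f (x ∷ v)))
∑-vecs xs m f = trans (∑-concatMap _ xs f) (∑-cong xs λ x → ∑-map (x ∷_) (vecs xs m) f)

length-vecs : (xs : List A) (m : ℕ) → length (vecs xs m) ≡ length xs ^ m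
length-vecs xs zero = refl
length-vecs xs (suc m) = begin
  length (vecs xs (suc m))                    ≡⟨ length-∑ (vecs xs (suc m)) ⟩
  ∑ (vecs xs (suc m)) (λ _ → 1)               ≡⟨ ∑-vecs xs m _ ⟩
  ∑ xs (λ _ → ∑ (vecs xs m) (λ _ → 1))        ≡⟨ ∑-const xs _ ⟩
  length xs * ∑ (vecs xs m) (λ _ → 1)
    ≡⟨ cong (length xs *_) (trans (sym (length-∑ (vecs xs m))) (length-vecs xs m)) ⟩
  length xs * length xs ^ m                   ∎
  where open ≡-Reasoning

∈-concatMap : {h : A → List B} {xs : List A} {x : A} {y : B} → x ∈ xs → y ∈ h x → y ∈ List.concatMap h xs
∈-concatMap {h = h} (here refl) y∈ = ∈-++⁺ˡ y∈
∈-concatMap {h = h} {xs = z ∷ _} (there x∈) y∈ = ∈-++⁺ʳ (h z) (∈-concatMap {h = h} x∈ y∈)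

∈-vecs : {xs : List A} (v : Vec A m) → (∀ i → Vec.lookup v i ∈ xs) → v ∈ vecs xs m
∈-vecs [] h = here refl
∈-vecs {xs = xs} (x ∷ v) h = ∈-concatMap {h = λ x → map (x ∷_) (vecs xs _)} (h zero) (∈-map⁺ (x ∷_) (∈-vecs v (h ∘ suc)))

∈-vecs-fins : (v : Vec (Fin n) m) → v ∈ vecs (fins n) m
∈-vecs-fins v = ∈-vecs v λ i → ∈-fins (Vec.lookup v i)

^-distribʳ-* : ∀ o m n → (m * n) ^ o ≡ m ^ o * n ^ o
^-distribʳ-* zero m n = refl
^-distribʳ-* (suc o) m n rewrite ^-distribʳ-* o m n = lem m n (m ^ o) (n ^ o)
  where
  lem : ∀ a b c d → a * b * (c * d) ≡ (a * c) * (b * d)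
  lem = solve-∀

≤ᵇ-true⁻ : ∀ m n → (m ≤ᵇ n) ≡ true → m ≤ n
≤ᵇ-true⁻ m n h = ≤ᵇ⇒≤ m n (subst T (sym h) _)

≤ᵇ-true⁺ : ∀ {m n} → m ≤ n → (m ≤ᵇ n) ≡ true
≤ᵇ-true⁺ {m} {n} h with m ≤ᵇ n | ≤⇒≤ᵇ h
... | true | _ = refl

≤ᵇ-false⁻ : ∀ m n → (m ≤ᵇ n) ≡ false → n < m
≤ᵇ-false⁻ m n h = ≰⇒> λ le → subst T h (≤⇒≤ᵇ le)

∧-true⁻ : ∀ {a b} → a ∧ b ≡ true → a ≡ true × b ≡ true
∧-true⁻ {true} {true} _ = refl , refl

not-true⁻ : ∀ {b} → not b ≡ true → b ≡ false
not-true⁻ {false} _ = refl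

==-sym : (x y : Fin n) → (x == y) ≡ (y == x)
==-sym x y with x Fin.≟ y
... | yes refl = sym (==-refl x)
... | no ne with y Fin.≟ x
...   | yes e = ⊥-elim (ne (sym e))
...   | no _ = refl

-- Link hypergraphs and codegrees

tails : List (Vec A (suc m)) → List (Vec A m)
tails = map Vec.tail

link : List (Vec (Fin N) (suc m)) → Fin N → List (Vec (Fin N) m)
link [] v = []
link ((x ∷ t) ∷ L) v = if x == v then t ∷ link L v else link L v

agree : Vec Bool m → Vec (Fin N) m → Vec (Fin N) m → Bool
agree [] [] [] = true
agree (true ∷ J) (x ∷ t) (y ∷ u) = (x == y) ∧ agree J t u
agree (false ∷ J) (x ∷ t) (y ∷ u) = agree J t u

size : Vec Bool m → ℕ
size [] = 0
size (true ∷ J) = suc (size J)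
size (false ∷ J) = size J

cosize : Vec Bool m → ℕ
cosize [] = 0
cosize (true ∷ J) = cosize J
cosize (false ∷ J) = suc (cosize J)

-- The codegree of the partial hyperedge that `t` has on the coordinates marked by `J`. Hyperedges
-- are ordered tuples, counted with multiplicity.
deg : List (Vec (Fin N) m) → Vec Bool m → Vec (Fin N) m → ℕ
deg L J t = ∑ L (λ u → 𝟙 (agree J u t))

none : Vec Bool m
none = Vec.replicate _ false

size-none : ∀ m → size (none {m}) ≡ 0
size-none zero = refl
size-none (suc m) = size-none m

agree-size0 : (J : Vec Bool m) (u t : Vec (Fin N) m) → size J ≡ 0 → agree J u t ≡ true
agree-size0 [] [] [] e = refl
agree-size0 (false ∷ J) (_ ∷ u) (_ ∷ t) e = agree-size0 J u t e

agree-trans : (J : Vec Bool m) (w u t : Vec (Fin N) m) → agree J u t ≡ true → agree J w u ≡ agree J w t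
agree-trans [] [] [] [] h = refl
agree-trans (true ∷ J) (z ∷ w) (x ∷ u) (y ∷ t) h with x Fin.≟ y
... | yes refl = cong ((z == x) ∧_) (agree-trans J w u t h)
agree-trans (false ∷ J) (z ∷ w) (x ∷ u) (y ∷ t) h = agree-trans J w u t h

deg-agree : (L : List (Vec (Fin N) m)) (J : Vec Bool m) {u t : Vec (Fin N) m} →
  agree J u t ≡ true → deg L J u ≡ deg L J t
deg-agree L J {u} {t} h = ∑-cong L λ w → cong 𝟙 (agree-trans J w u t h)

deg-size0 : (L : List (Vec (Fin N) m)) (J : Vec Bool m) (t : Vec (Fin N) m) → size J ≡ 0 → deg L J t ≡ length L
deg-size0 L J t e = trans (∑-cong L λ u → cong 𝟙 (agree-size0 J u t e)) (sym (length-∑ L))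

deg-link : (L : List (Vec (Fin N) (suc m))) (J : Vec Bool m) (v : Fin N) (t : Vec (Fin N) m) →
  deg L (true ∷ J) (v ∷ t) ≡ deg (link L v) J t
deg-link [] J v t = refl
deg-link ((x ∷ u) ∷ L) J v t with x == v
... | true  = cong (𝟙 (agree J u t) +_) (deg-link L J v t)
... | false = deg-link L J v t

deg-tails : (L : List (Vec (Fin N) (suc m))) (J : Vec Bool m) (v : Fin N) (t : Vec (Fin N) m) →
  deg L (false ∷ J) (v ∷ t) ≡ deg (tails L) J t
deg-tails [] J v t = refl
deg-tails ((x ∷ u) ∷ L) J v t = cong (𝟙 (agree J u t) +_) (deg-tails L J v t)

∈-link⁻ : (L : List (Vec (Fin N) (suc m))) {v : Fin N} {t : Vec (Fin N) m} → t ∈ link L v → (v ∷ t) ∈ L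
∈-link⁻ ((x ∷ u) ∷ L) {v} t∈ with x Fin.≟ v
∈-link⁻ ((x ∷ u) ∷ L) (here refl) | yes refl = here refl
∈-link⁻ ((x ∷ u) ∷ L) (there t∈)  | yes refl = there (∈-link⁻ L t∈)
∈-link⁻ ((x ∷ u) ∷ L) t∈          | no _     = there (∈-link⁻ L t∈)

∈-tails⁻ : (L : List (Vec A (suc m))) {t : Vec A m} → t ∈ tails L → ∃ λ v → (v ∷ t) ∈ L
∈-tails⁻ ((x ∷ u) ∷ L) (here refl) = x , here refl
∈-tails⁻ ((x ∷ u) ∷ L) (there t∈) = let (v , h) = ∈-tails⁻ L t∈ in v , there h

∑-link1 : (L : List (Vec (Fin N) (suc m))) (v : Fin N) (f : Vec (Fin N) m → ℕ) →
  ∑ (link L v) f ≡ ∑ L (λ e → 𝟙 (Vec.head e == v) * f (Vec.tail e))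
∑-link1 [] v f = refl
∑-link1 ((x ∷ t) ∷ L) v f with x == v
... | true  = cong₂ _+_ (sym (*-identityˡ (f t))) (∑-link1 L v f)
... | false = ∑-link1 L v f

∑-link : (L : List (Vec (Fin N) (suc m))) (f : Fin N → Vec (Fin N) m → ℕ) →
  ∑ (fins N) (λ v → ∑ (link L v) (f v)) ≡ ∑ L (λ e → f (Vec.head e) (Vec.tail e))
∑-link {N} L f = begin
  ∑ (fins N) (λ v → ∑ (link L v) (f v))
    ≡⟨ ∑-cong (fins N) (λ v → ∑-link1 L v (f v)) ⟩
  ∑ (fins N) (λ v → ∑ L (λ e → 𝟙 (Vec.head e == v) * f v (Vec.tail e)))
    ≡⟨ ∑-swap (fins N) L _ ⟩
  ∑ L (λ e → ∑ (fins N) (λ v → 𝟙 (Vec.head e == v) * f v (Vec.tail e)))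
    ≡⟨ ∑-cong L (λ e → ∑-δ (Vec.head e) (λ v → f v (Vec.tail e))) ⟩
  ∑ L (λ e → f (Vec.head e) (Vec.tail e)) ∎
  where open ≡-Reasoning

∑-length-link : (L : List (Vec (Fin N) (suc m))) → ∑ (fins N) (λ v → length (link L v)) ≡ length L
∑-length-link {N} L = trans (∑-cong (fins N) λ v → length-∑ (link L v))
  (trans (∑-link L (λ _ _ → 1)) (sym (length-∑ L)))

-- Agreement on `J` is an equivalence relation, and `deg L J t`, `deg F J t` are the sizes of the
-- class of `t` in both lists; the inequality is summed over the classes that meet `L`. The
-- induction splits the lists along a coordinate in `J` and forgets a coordinate outside it.
length≤-by-classes : (a b : ℕ) (J : Vec Bool m) (L F : List (Vec (Fin N) m)) →
  (∀ {t} → t ∈ L → a * deg L J t ≤ b * deg F J t) → a * length L ≤ b * length F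
length≤-by-classes a b [] [] F h = ≤-trans (≤-reflexive (*-zeroʳ a)) z≤n
length≤-by-classes a b [] L@([] ∷ _) F h = begin
  a * length L      ≡⟨ cong (a *_) (deg-size0 L [] [] refl) ⟨
  a * deg L [] []   ≤⟨ h (here refl) ⟩
  b * deg F [] []   ≡⟨ cong (b *_) (deg-size0 F [] [] refl) ⟩
  b * length F      ∎
  where open ≤-Reasoning
length≤-by-classes {N = N} a b (true ∷ J) L F h = begin
  a * length L                               ≡⟨ cong (a *_) (∑-length-link L) ⟨
  a * ∑ (fins N) (λ v → length (link L v))   ≡⟨ ∑-*ˡ (fins N) a _ ⟨
  ∑ (fins N) (λ v → a * length (link L v))
    ≤⟨ ∑-mono (fins N) (λ v → length≤-by-classes a b J (link L v) (link F v) (λ {t} t∈ → ≤-trans (≤-reflexive (cong (a *_) (sym (deg-link L J v t)))) (≤-trans (h (∈-link⁻ L t∈)) (≤-reflexive (cong (b *_) (deg-link F J v t)))))) ⟩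
  ∑ (fins N) (λ v → b * length (link F v))   ≡⟨ ∑-*ˡ (fins N) b _ ⟩
  b * ∑ (fins N) (λ v → length (link F v))   ≡⟨ cong (b *_) (∑-length-link F) ⟩
  b * length F                               ∎
  where open ≤-Reasoning
length≤-by-classes a b (false ∷ J) L F h = begin
  a * length L         ≡⟨ cong (a *_) (length-map _ L) ⟨
  a * length (tails L)
    ≤⟨ length≤-by-classes a b J (tails L) (tails F) (λ {t} t∈ → let (v , v∷t∈) = ∈-tails⁻ L t∈ in ≤-trans (≤-reflexive (cong (a *_) (sym (deg-tails L J v t)))) (≤-trans (h v∷t∈) (≤-reflexive (cong (b *_) (deg-tails F J v t))))) ⟩
  b * length (tails F) ≡⟨ cong (b *_) (length-map _ F) ⟩
  b * length F         ∎
  where open ≤-Reasoning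

subsets : ∀ m → List (Vec Bool m)
subsets zero = [] ∷ []
subsets (suc m) = map (true ∷_) (subsets m) ++ map (false ∷_) (subsets m)

∈-subsets : (J : Vec Bool m) → J ∈ subsets m
∈-subsets [] = here refl
∈-subsets (true ∷ J) = ∈-++⁺ˡ (∈-map⁺ _ (∈-subsets J))
∈-subsets (false ∷ J) = ∈-++⁺ʳ (map (true ∷_) (subsets _)) (∈-map⁺ _ (∈-subsets J))

-- K^(m - |J|) for nonempty `J` and 0 for the empty one, free of subtraction. These are the terms in
-- the expansion of (K + 1)^m - K^m.
weight : ℕ → Vec Bool m → ℕ
weight K [] = 0
weight K (true ∷ J) = K ^ cosize J
weight K (false ∷ J) = K * weight K J

size+cosize : (K : ℕ) (J : Vec Bool m) → K ^ cosize J * K ^ size J ≡ K ^ m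
size+cosize K [] = refl
size+cosize {m = suc m} K (true ∷ J) = trans (lem (K ^ cosize J) K (K ^ size J)) (cong (K *_) (size+cosize K J))
  where
  lem : ∀ a b c → a * (b * c) ≡ b * (a * c)
  lem = solve-∀
size+cosize {m = suc m} K (false ∷ J) = trans (*-assoc K _ _) (cong (K *_) (size+cosize K J))

weight-size : (K : ℕ) (J : Vec Bool m) → 1 ≤ size J → weight K J * K ^ size J ≡ K ^ m
weight-size {m = suc m} K (true ∷ J) h = size+cosize K (true ∷ J)
weight-size {m = suc m} K (false ∷ J) h = trans (*-assoc K _ _) (cong (K *_) (weight-size K J h))

∑-cosize : ∀ K m → ∑ (subsets m) (λ J → K ^ cosize J) ≡ suc K ^ m
∑-cosize K zero = refl
∑-cosize K (suc m) = begin
  ∑ (subsets (suc m)) (λ J → K ^ cosize J)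
    ≡⟨ ∑-++ (map (true ∷_) (subsets m)) _ _ ⟩
  ∑ (map (true ∷_) (subsets m)) (λ J → K ^ cosize J) + ∑ (map (false ∷_) (subsets m)) (λ J → K ^ cosize J)
    ≡⟨ cong₂ _+_ (∑-map _ (subsets m) _) (trans (∑-map _ (subsets m) _) (∑-*ˡ (subsets m) K _)) ⟩
  ∑ (subsets m) (λ J → K ^ cosize J) + K * ∑ (subsets m) (λ J → K ^ cosize J)
    ≡⟨ cong (λ s → s + K * s) (∑-cosize K m) ⟩
  suc K ^ m + K * suc K ^ m ∎
  where open ≡-Reasoning

∑-weight : ∀ K m → ∑ (subsets m) (weight K) + K ^ m ≡ suc K ^ m
∑-weight K zero = refl
∑-weight K (suc m) = begin
  ∑ (subsets (suc m)) (weight K) + K * K ^ m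
    ≡⟨ cong (_+ K * K ^ m) (trans (∑-++ (map (true ∷_) (subsets m)) _ _)
         (cong₂ _+_ (trans (∑-map _ (subsets m) _) (∑-cosize K m)) (trans (∑-map _ (subsets m) _) (∑-*ˡ (subsets m) K _)))) ⟩
  (suc K ^ m + K * ∑ (subsets m) (weight K)) + K * K ^ m
    ≡⟨ lem (suc K ^ m) K _ (K ^ m) ⟩
  suc K ^ m + K * (∑ (subsets m) (weight K) + K ^ m)
    ≡⟨ cong (λ s → suc K ^ m + K * s) (∑-weight K m) ⟩
  suc K ^ m + K * suc K ^ m ∎
  where
  open ≡-Reasoning
  lem : ∀ a b c d → (a + b * c) + b * d ≡ a + b * (c + d)
  lem = solve-∀

suc-power-bound : ∀ K m → suc K ^ m * K ≤ K ^ suc m + m * suc K ^ m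
suc-power-bound K zero = ≤-reflexive (lem K)
  where
  lem : ∀ K → 1 * K ≡ K * 1 + 0
  lem = solve-∀
suc-power-bound K (suc m) = begin
  suc K ^ suc m * K                                     ≡⟨ *-assoc (suc K) (suc K ^ m) K ⟩
  suc K * (suc K ^ m * K)                               ≤⟨ *-monoʳ-≤ (suc K) (suc-power-bound K m) ⟩
  suc K * (K ^ suc m + m * suc K ^ m)                   ≡⟨ lem K (K ^ suc m) m (suc K ^ m) ⟩
  K ^ suc m + (K ^ suc (suc m) + m * suc K ^ suc m)     ≤⟨ +-monoˡ-≤ _ (^-monoˡ-≤ (suc m) (n≤1+n K)) ⟩
  suc K ^ suc m + (K ^ suc (suc m) + m * suc K ^ suc m) ≡⟨ lem2 (suc K ^ suc m) (K ^ suc (suc m)) _ ⟩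
  K ^ suc (suc m) + suc m * suc K ^ suc m               ∎
  where
  open ≤-Reasoning
  lem : ∀ K a m s → suc K * (a + m * s) ≡ a + (K * a + m * (suc K * s))
  lem = solve-∀
  lem2 : ∀ a b c → a + (b + c) ≡ b + (a + c)
  lem2 = solve-∀

-- By `suc-power-bound`, (1 + 1/K)^m ≤ 1 / (1 - m/K) ≤ 16/15. So the sum of K^(-|J|) over all
-- nonempty `J` is at most 1/15, although there are 2^m - 1 of them.
∑-weight-≤ : ∀ K m → 1 ≤ K → 16 * m ≤ K → 15 * ∑ (subsets m) (weight K) ≤ K ^ m
∑-weight-≤ K m 1≤K 16m≤K = +-cancelʳ-≤ (15 * K ^ m) (15 * ∑ (subsets m) (weight K)) (K ^ m) (begin
  15 * ∑ (subsets m) (weight K) + 15 * K ^ m   ≡⟨ *-distribˡ-+ 15 (∑ (subsets m) (weight K)) (K ^ m) ⟨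
  15 * (∑ (subsets m) (weight K) + K ^ m)      ≡⟨ cong (15 *_) (∑-weight K m) ⟩
  15 * suc K ^ m
    ≤⟨ *-cancelˡ-≤ K {{>-nonZero 1≤K}} (+-cancelʳ-≤ (K * suc K ^ m) (K * (15 * suc K ^ m)) (K * (16 * K ^ m)) step) ⟩
  16 * K ^ m                                   ≡⟨ lem2 (K ^ m) ⟩
  K ^ m + 15 * K ^ m                           ∎)
  where
  open ≤-Reasoning
  lem2 : ∀ a → 16 * a ≡ a + 15 * a
  lem2 = solve-∀
  lem1 : ∀ K s → K * (15 * s) + K * s ≡ 16 * (s * K)
  lem1 = solve-∀
  lem3 : ∀ a m s K → 16 * (K * a + m * s) ≡ K * (16 * a) + (16 * m) * s
  lem3 = solve-∀
  step : K * (15 * suc K ^ m) + K * suc K ^ m ≤ K * (16 * K ^ m) + K * suc K ^ m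
  step = begin
    K * (15 * suc K ^ m) + K * suc K ^ m    ≡⟨ lem1 K (suc K ^ m) ⟩
    16 * (suc K ^ m * K)                    ≤⟨ *-monoʳ-≤ 16 (suc-power-bound K m) ⟩
    16 * (K * K ^ m + m * suc K ^ m)        ≡⟨ lem3 (K ^ m) m (suc K ^ m) K ⟩
    K * (16 * K ^ m) + (16 * m) * suc K ^ m ≤⟨ +-monoʳ-≤ (K * (16 * K ^ m)) (*-monoˡ-≤ (suc K ^ m) 16m≤K) ⟩
    K * (16 * K ^ m) + K * suc K ^ m        ∎

allV : (A → Bool) → Vec A m → Bool
allV p [] = true
allV p (x ∷ t) = p x ∧ allV p t

Independent : (Fin N → Bool) → List (Vec (Fin N) m) → Set
Independent I L = ∀ {t} → t ∈ L → allV I t ≡ false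

-- Containers

any≡false⁻ : (p : A → Bool) (xs : List A) → any p xs ≡ false → ∀ {x} → x ∈ xs → p x ≡ false
any≡false⁻ p (y ∷ xs) h x∈ with p y in eq
any≡false⁻ p (y ∷ xs) h (here refl) | false = eq
any≡false⁻ p (y ∷ xs) h (there x∈)  | false = any≡false⁻ p xs h x∈

𝟙-any≤∑ : (p : A → Bool) (xs : List A) → 𝟙 (any p xs) ≤ ∑ xs (𝟙 ∘ p)
𝟙-any≤∑ p [] = z≤n
𝟙-any≤∑ p (x ∷ xs) with p x
... | true  = s≤s z≤n
... | false = 𝟙-any≤∑ p xs

-- One run of the fingerprint algorithm, started with e₀ hyperedges on N vertices. `q` is the factor
-- by which a list may shrink from one level to the next, `b` = 4N / q the number of picks this
-- takes, `p` the factor by which codegrees drop with each further fixed coordinate, `θ` their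
-- scale, and `P` an upper bound for every κ. The vertex `v₀` shows N ≥ 1 and fills coordinates that
-- are ignored.
module Container {N : ℕ} (v₀ : Fin N) (q K p P b θ e₀ : ℕ)
  (1≤q : 1 ≤ q) (1≤K : 1 ≤ K) (1≤p : 1 ≤ p) (2qP≤p : 2 * (q * P) ≤ p)
  (bq≡4N : b * q ≡ 4 * N) (4NPθ≤e₀ : 4 * (N * (P * θ)) ≤ e₀) (1≤e₀ : 1 ≤ e₀) where

  -- Single coordinates are capped relative to their initial degree d, so that the loss caused by a heavy set
  -- is a constant fraction of all edges and only logarithmically many restarts are needed.
  cap : Vec Bool m → Vec (Fin N → ℕ) m → Vec (Fin N) m → ℕ
  cap [] [] [] = θ
  cap (true ∷ J) (d ∷ ds) (v ∷ t) = if size J ≡ᵇ 0 then θ + d v else θ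
  cap (false ∷ J) (d ∷ ds) (v ∷ t) = cap J ds t

  θ≤cap : (J : Vec Bool m) (ds : Vec (Fin N → ℕ) m) (t : Vec (Fin N) m) → θ ≤ cap J ds t
  θ≤cap [] [] [] = ≤-refl
  θ≤cap (true ∷ J) (d ∷ ds) (v ∷ t) with size J ≡ᵇ 0
  ... | true  = m≤m+n θ (d v)
  ... | false = ≤-refl
  θ≤cap (false ∷ J) (d ∷ ds) (v ∷ t) = θ≤cap J ds t

  cap-big : (J : Vec Bool m) (d : Fin N → ℕ) (ds : Vec (Fin N → ℕ) m) (v : Fin N) (t : Vec (Fin N) m) →
    1 ≤ size J → cap (true ∷ J) (d ∷ ds) (v ∷ t) ≡ θ
  cap-big J d ds v t h with size J | h
  ... | suc _ | _ = refl

  cap-agree : (J : Vec Bool m) (ds : Vec (Fin N → ℕ) m) (u t : Vec (Fin N) m) →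
    agree J u t ≡ true → cap J ds u ≡ cap J ds t
  cap-agree [] [] [] [] h = refl
  cap-agree (true ∷ J) (d ∷ ds) (x ∷ u) (y ∷ t) h with x Fin.≟ y
  ... | yes refl = refl
  cap-agree (false ∷ J) (d ∷ ds) (x ∷ u) (y ∷ t) h = cap-agree J ds u t h

  -- At depth i of the recursion Q = q ^ i and κ = K ^ i. The factor κ ^ size J, rather than κ, makes the union
  -- bound over all J cost only (1 + 1/K) ^ m, so that K may be linear in the uniformity.
  Bounded : List (Vec (Fin N) m) → Vec (Fin N → ℕ) m → ℕ → ℕ → Set
  Bounded {m} L ds Q κ = ∀ (J : Vec Bool m) t → 1 ≤ size J →
    p ^ pred (size J) * (Q * deg L J t) ≤ κ ^ size J * cap J ds t

  -- Saturation is declared at half of the bound in `Bounded`, because the tails that one further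
  -- vertex contributes use up at most the other half.
  satAt : ℕ → ℕ → List (Vec (Fin N) m) → Vec (Fin N → ℕ) m → Vec (Fin N) m → Vec Bool m → Bool
  satAt Q κ F ds t J = (1 ≤ᵇ size J) ∧
    not (2 * (p ^ pred (size J) * (Q * deg F J t)) ≤ᵇ κ ^ size J * cap J ds t)

  satAt-size0 : ∀ Q κ F ds (t : Vec (Fin N) m) J → size J ≡ 0 → satAt Q κ F ds t J ≡ false
  satAt-size0 Q κ F ds t J e rewrite e = refl

  satAt-true : ∀ Q κ F ds (t : Vec (Fin N) m) J → satAt Q κ F ds t J ≡ true →
    κ ^ size J * cap J ds t ≤ 2 * (p ^ pred (size J) * (Q * deg F J t))
  satAt-true Q κ F ds t J h = <⇒≤ (≤ᵇ-false⁻ _ (κ ^ size J * cap J ds t) (not-true⁻ (proj₂ (∧-true⁻ {1 ≤ᵇ size J} h))))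

  satAt-false : ∀ Q κ F ds (t : Vec (Fin N) m) J → 1 ≤ size J → satAt Q κ F ds t J ≡ false →
    2 * (p ^ pred (size J) * (Q * deg F J t)) ≤ κ ^ size J * cap J ds t
  satAt-false Q κ F ds t J 1≤J h = ≤ᵇ-true⁻ _ _ (not-false (≤ᵇ-true⁺ 1≤J) h)
    where
    not-false : ∀ {a b} → a ≡ true → a ∧ not b ≡ false → b ≡ true
    not-false {true} {true} _ _ = refl

  sat : ℕ → ℕ → List (Vec (Fin N) m) → Vec (Fin N → ℕ) m → Vec (Fin N) m → Bool
  sat {m} Q κ F ds t = any (satAt Q κ F ds t) (subsets m)

  new : ℕ → ℕ → List (Vec (Fin N) m) → Vec (Fin N → ℕ) m → List (Vec (Fin N) (suc m)) → Fin N → List (Vec (Fin N) m)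
  new Q κ F ds L v = filterᵇ (not ∘ sat Q κ F ds) (link L v)

  -- With `v` fixed as well, a codegree in `L` carries one more factor 1/p. Since p ≥ 2qP ≥ 2qκ,
  -- this pays for passing from Q to qQ, for the surplus factor κ, and for the 2 that leaves room
  -- for the old tails.
  increment-arith : ∀ a κ Q D c → κ ≤ P → θ ≤ c →
    p ^ suc a * (Q * D) ≤ κ ^ suc (suc a) * θ →
    2 * (p ^ a * ((q * Q) * D)) ≤ (K * κ) ^ suc a * c
  increment-arith a κ Q D c κ≤P θ≤c h = *-cancelˡ-≤ p {{>-nonZero 1≤p}} (begin
    p * (2 * (p ^ a * ((q * Q) * D)))  ≡⟨ l1 p (p ^ a) q Q D ⟩
    (2 * q) * (p ^ suc a * (Q * D))    ≤⟨ *-monoʳ-≤ (2 * q) h ⟩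
    (2 * q) * (κ ^ suc (suc a) * θ)    ≡⟨ l2 q κ (κ ^ suc a) θ ⟩
    (2 * (q * κ)) * (κ ^ suc a * θ)    ≤⟨ *-mono-≤ (≤-trans (*-monoʳ-≤ 2 (*-monoʳ-≤ q κ≤P)) 2qP≤p)
                                            (*-mono-≤ (^-monoˡ-≤ (suc a) (≤-trans (≤-reflexive (sym (*-identityˡ κ))) (*-monoˡ-≤ κ 1≤K))) θ≤c) ⟩
    p * ((K * κ) ^ suc a * c)          ∎)
    where
    open ≤-Reasoning
    l1 : ∀ p x q Q D → p * (2 * (x * ((q * Q) * D))) ≡ (2 * q) * ((p * x) * (Q * D))
    l1 = solve-∀
    l2 : ∀ q κ x θ → (2 * q) * ((κ * x) * θ) ≡ (2 * (q * κ)) * (x * θ)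
    l2 = solve-∀

  -- The codegree at `J` grows only if some new tail `u` agrees with `t` there. Being new, `u` is
  -- not saturated, so `F` takes up at most half of the bound; the new tails all extend `v` and take
  -- up at most the other half.
  Bounded-add : ∀ {Q κ d} {ds : Vec (Fin N → ℕ) m} {L F} v → κ ≤ P → Bounded L (d ∷ ds) Q κ →
    Bounded F ds (q * Q) (K * κ) → Bounded (new (q * Q) (K * κ) F ds L v ++ F) ds (q * Q) (K * κ)
  Bounded-add {m} {Q} {κ} {d} {ds} {L} {F} v κ≤P BL BF J t 1≤J
    with ∑𝟙-zero-or-∃ (new (q * Q) (K * κ) F ds L v) (λ u → agree J u t)
  ... | inj₁ e = begin
    p ^ pred (size J) * (q * Q * deg (nw ++ F) J t)
      ≡⟨ cong (λ z → p ^ pred (size J) * (q * Q * z)) (trans (∑-++ nw F _) (cong (_+ deg F J t) e)) ⟩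
    p ^ pred (size J) * (q * Q * deg F J t)                  ≤⟨ BF J t 1≤J ⟩
    (K * κ) ^ size J * cap J ds t                            ∎
    where
    open ≤-Reasoning
    nw = new (q * Q) (K * κ) F ds L v
  ... | inj₂ (u , u∈ , u~t) = *-cancelˡ-≤ 2 (begin
    2 * (X * (q * Q * deg (nw ++ F) J t))                          ≡⟨ cong (λ z → 2 * (X * (q * Q * z))) (∑-++ nw F _) ⟩
    2 * (X * (q * Q * (deg nw J t + deg F J t)))                   ≡⟨ l1 X (q * Q) (deg nw J t) (deg F J t) ⟩
    2 * (X * (q * Q * deg nw J t)) + 2 * (X * (q * Q * deg F J t)) ≤⟨ +-mono-≤ inc old ⟩
    rhs + rhs                                                      ≡⟨ cong (rhs +_) (+-identityʳ rhs) ⟨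
    2 * rhs                                                        ∎)
    where
    open ≤-Reasoning
    nw = new (q * Q) (K * κ) F ds L v
    X = p ^ pred (size J)
    rhs = (K * κ) ^ size J * cap J ds t
    l1 : ∀ X Q a b → 2 * (X * (Q * (a + b))) ≡ 2 * (X * (Q * a)) + 2 * (X * (Q * b))
    l1 = solve-∀
    unsat-u : satAt (q * Q) (K * κ) F ds u J ≡ false
    unsat-u = any≡false⁻ _ _ (not-true⁻ (proj₂ (∈-filterᵇ⁻ _ (link L v) u∈))) (∈-subsets J)
    old : 2 * (X * (q * Q * deg F J t)) ≤ rhs
    old = begin
      2 * (X * (q * Q * deg F J t))   ≡⟨ cong (λ z → 2 * (X * (q * Q * z))) (deg-agree F J {u} {t} u~t) ⟨
      2 * (X * (q * Q * deg F J u))   ≤⟨ satAt-false (q * Q) (K * κ) F ds u J 1≤J unsat-u ⟩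
      (K * κ) ^ size J * cap J ds u   ≡⟨ cong ((K * κ) ^ size J *_) (cap-agree J ds u t u~t) ⟩
      rhs                             ∎
    nw≤ : deg nw J t ≤ deg L (true ∷ J) (v ∷ t)
    nw≤ = ≤-trans (∑-filter-≤ _ (link L v) _) (≤-reflexive (sym (deg-link L J v t)))
    size-suc : suc (pred (size J)) ≡ size J
    size-suc = suc-pred (size J) {{>-nonZero 1≤J}}
    h0 : p ^ size J * (Q * deg nw J t) ≤ κ ^ suc (size J) * θ
    h0 = begin
      p ^ size J * (Q * deg nw J t)                                ≤⟨ *-monoʳ-≤ (p ^ size J) (*-monoʳ-≤ Q nw≤) ⟩
      p ^ size J * (Q * deg L (true ∷ J) (v ∷ t))                  ≤⟨ BL (true ∷ J) (v ∷ t) (s≤s z≤n) ⟩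
      κ ^ suc (size J) * cap (true ∷ J) (d ∷ ds) (v ∷ t)           ≡⟨ cong (κ ^ suc (size J) *_) (cap-big J d ds v t 1≤J) ⟩
      κ ^ suc (size J) * θ                                         ∎
    inc : 2 * (X * (q * Q * deg nw J t)) ≤ rhs
    inc = subst (λ s → 2 * (X * (q * Q * deg nw J t)) ≤ (K * κ) ^ s * cap J ds t) size-suc
      (increment-arith (pred (size J)) κ Q (deg nw J t) (cap J ds t) κ≤P (θ≤cap J ds t)
        (subst (λ s → p ^ s * (Q * deg nw J t) ≤ κ ^ suc s * θ) (sym size-suc) h0))

  -- In a saturated class the codegree in `F` is at least K^|J| / 2q times the one in the tails of
  -- `L`: both are compared with the same cap, but the bound for `F` has Kκ in place of κ and qQ in
  -- place of Q. The classes are then added up.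
  satAt-count : ∀ {Q κ d} {ds : Vec (Fin N → ℕ) m} {L} F → 1 ≤ Q → Bounded L (d ∷ ds) Q κ → ∀ J → 1 ≤ size J →
    K ^ size J * ∑ (tails L) (λ t → 𝟙 (satAt (q * Q) (K * κ) F ds t J)) ≤ (2 * q) * length F
  satAt-count {m} {Q} {κ} {d} {ds} {L} F 1≤Q BL J 1≤J = begin
    K ^ size J * ∑ (tails L) (λ t → 𝟙 (satAt (q * Q) (K * κ) F ds t J))
      ≡⟨ cong (K ^ size J *_) (length-filter-∑ sJ (tails L)) ⟨
    K ^ size J * length L'
      ≤⟨ length≤-by-classes (K ^ size J) (2 * q) J L' F step ⟩
    (2 * q) * length F ∎
    where
    open ≤-Reasoning
    sJ : Vec (Fin N) m → Bool
    sJ t = satAt (q * Q) (K * κ) F ds t J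
    L' = filterᵇ sJ (tails L)
    X = p ^ pred (size J)
    1≤XQ : 1 ≤ X * Q
    1≤XQ = *-mono-≤ (m^n>0 p {{>-nonZero 1≤p}} (pred (size J))) 1≤Q
    l1 : ∀ X Q k D → (X * Q) * (k * D) ≡ k * (X * (Q * D))
    l1 = solve-∀
    l2 : ∀ X q Q G → 2 * (X * ((q * Q) * G)) ≡ (X * Q) * ((2 * q) * G)
    l2 = solve-∀
    step : ∀ {t} → t ∈ L' → K ^ size J * deg L' J t ≤ (2 * q) * deg F J t
    step {t} t∈ = *-cancelˡ-≤ (X * Q) {{>-nonZero 1≤XQ}} (begin
      (X * Q) * (K ^ size J * deg L' J t)          ≡⟨ l1 X Q (K ^ size J) (deg L' J t) ⟩
      K ^ size J * (X * (Q * deg L' J t))          ≤⟨ *-monoʳ-≤ (K ^ size J) (*-monoʳ-≤ X (*-monoʳ-≤ Q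
                                                       (≤-trans (∑-filter-≤ _ (tails L) _) (≤-reflexive (sym (deg-tails L J v₀ t)))))) ⟩
      K ^ size J * (X * (Q * deg L (false ∷ J) (v₀ ∷ t))) ≤⟨ *-monoʳ-≤ (K ^ size J) (BL (false ∷ J) (v₀ ∷ t) 1≤J) ⟩
      K ^ size J * (κ ^ size J * cap J ds t)       ≡⟨ *-assoc (K ^ size J) (κ ^ size J) (cap J ds t) ⟨
      K ^ size J * κ ^ size J * cap J ds t         ≡⟨ cong (_* cap J ds t) (^-distribʳ-* (size J) K κ) ⟨
      (K * κ) ^ size J * cap J ds t
        ≤⟨ satAt-true (q * Q) (K * κ) F ds t J (proj₂ (∈-filterᵇ⁻ sJ (tails L) t∈)) ⟩
      2 * (X * (q * Q * deg F J t))                ≡⟨ l2 X q Q (deg F J t) ⟩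
      (X * Q) * ((2 * q) * deg F J t)              ∎)

  -- Summing `satAt-count` over nonempty `J` costs only the factor 1/15 of `∑-weight-≤`. So at most
  -- 2q|F| / 15 ≤ 2|L| / 15 ≤ |L| / 4 tails are saturated as long as `F` is too short to replace
  -- `L`.
  sat-count : ∀ {Q κ d} {ds : Vec (Fin N → ℕ) m} {L} F → 16 * m ≤ K → 1 ≤ Q → Bounded L (d ∷ ds) Q κ →
    q * length F ≤ length L → 4 * ∑ (tails L) (𝟙 ∘ sat (q * Q) (K * κ) F ds) ≤ length L
  sat-count {m} {Q} {κ} {d} {ds} {L} F 16m≤K 1≤Q BL F≤L = *-cancelˡ-≤ 2 (begin
    2 * (4 * S)        ≡⟨ l1 S ⟩
    8 * S              ≤⟨ *-monoˡ-≤ S (m≤m+n 8 7) ⟩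
    15 * S             ≤⟨ 15S≤ ⟩
    (2 * q) * length F ≡⟨ *-assoc 2 q (length F) ⟩
    2 * (q * length F) ≤⟨ *-monoʳ-≤ 2 F≤L ⟩
    2 * length L       ∎)
    where
    open ≤-Reasoning
    S = ∑ (tails L) (𝟙 ∘ sat (q * Q) (K * κ) F ds)
    sJ : Vec Bool m → ℕ
    sJ J = ∑ (tails L) (λ t → 𝟙 (satAt (q * Q) (K * κ) F ds t J))
    l1 : ∀ S → 2 * (4 * S) ≡ 8 * S
    l1 = solve-∀
    l2 : ∀ a b → a * (15 * b) ≡ 15 * (a * b)
    l2 = solve-∀
    l3 : ∀ w k s → (w * k) * s ≡ w * (k * s)
    l3 = solve-∀
    union : S ≤ ∑ (subsets m) sJ
    union = ≤-trans (∑-mono (tails L) λ t → 𝟙-any≤∑ (satAt (q * Q) (K * κ) F ds t) (subsets m))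
                    (≤-reflexive (∑-swap (tails L) (subsets m) _))
    one : ∀ J → K ^ m * sJ J ≤ weight K J * ((2 * q) * length F)
    one J with 1 ≤? size J
    ... | yes 1≤J = begin
      K ^ m * sJ J                          ≡⟨ cong (_* sJ J) (weight-size K J 1≤J) ⟨
      weight K J * K ^ size J * sJ J        ≡⟨ l3 (weight K J) (K ^ size J) (sJ J) ⟩
      weight K J * (K ^ size J * sJ J)      ≤⟨ *-monoʳ-≤ (weight K J) (satAt-count {L = L} F 1≤Q BL J 1≤J) ⟩
      weight K J * ((2 * q) * length F)     ∎
    ... | no ¬1≤J = ≤-trans (≤-reflexive (trans (cong (K ^ m *_)
                      (trans (∑-cong (tails L) λ t → cong 𝟙 (satAt-size0 (q * Q) (K * κ) F ds t J (n<1⇒n≡0 (≰⇒> ¬1≤J)))) (∑-zero (tails L)))) (*-zeroʳ (K ^ m)))) z≤n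
    15S≤ : 15 * S ≤ (2 * q) * length F
    15S≤ = *-cancelˡ-≤ (K ^ m) {{>-nonZero (m^n>0 K {{>-nonZero 1≤K}} m)}} (begin
      K ^ m * (15 * S)                                         ≡⟨ l2 (K ^ m) S ⟩
      15 * (K ^ m * S)                                         ≤⟨ *-monoʳ-≤ 15 (*-monoʳ-≤ (K ^ m) union) ⟩
      15 * (K ^ m * ∑ (subsets m) sJ)                          ≡⟨ cong (15 *_) (∑-*ˡ (subsets m) (K ^ m) sJ) ⟨
      15 * ∑ (subsets m) (λ J → K ^ m * sJ J)                  ≤⟨ *-monoʳ-≤ 15 (∑-mono (subsets m) one) ⟩
      15 * ∑ (subsets m) (λ J → weight K J * ((2 * q) * length F))
        ≡⟨ cong (15 *_) (∑-*ʳ (subsets m) ((2 * q) * length F) (weight K)) ⟩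
      15 * (∑ (subsets m) (weight K) * ((2 * q) * length F))   ≡⟨ *-assoc 15 (∑ (subsets m) (weight K)) _ ⟨
      15 * ∑ (subsets m) (weight K) * ((2 * q) * length F)     ≤⟨ *-monoˡ-≤ ((2 * q) * length F) (∑-weight-≤ K m 1≤K 16m≤K) ⟩
      K ^ m * ((2 * q) * length F)                             ∎)

  good : ℕ → ℕ → List (Vec (Fin N) m) → Vec (Fin N → ℕ) m → List (Vec (Fin N) (suc m)) → Fin N → Bool
  good Q κ F ds L v = length L ≤ᵇ (4 * N) * length (new Q κ F ds L v)

  -- Here `d` stands for degrees at the start of the run, not in the current list. Hence a heavy `W`
  -- meets a fraction 1/4P of the original hyperedges, whatever the level at which it was found.
  Heavy : (Fin N → Bool) → (Fin N → ℕ) → Set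
  Heavy W d = e₀ ≤ 4 * P * ∑ (fins N) (λ v → 𝟙 (W v) * d v)

  1≤N : 1 ≤ N
  1≤N = ≤-trans (s≤s z≤n) (FinP.toℕ<n v₀)

  ∑-const-fins : ∀ c → ∑ (fins N) (λ _ → c) ≡ N * c
  ∑-const-fins c = trans (∑-const (fins N) c) (cong (_* c) (length-fins N))

  length-filter-split : (s : A → Bool) (xs : List A) → length xs ≡ length (filterᵇ (not ∘ s) xs) + ∑ xs (𝟙 ∘ s)
  length-filter-split s [] = refl
  length-filter-split s (x ∷ xs) with s x
  ... | true  = trans (cong suc (length-filter-split s xs)) (sym (+-suc _ _))
  ... | false = cong suc (length-filter-split s xs)

  -- Vertices that are not good lose at most a quarter of L to smallness and a quarter to saturation.
  good-links : ∀ {Q κ d} {ds : Vec (Fin N → ℕ) m} {L F} → 16 * m ≤ K → 1 ≤ Q →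
    Bounded L (d ∷ ds) Q κ → q * length F ≤ length L →
    length L ≤ 2 * ∑ (fins N) (λ v → 𝟙 (good (q * Q) (K * κ) F ds L v) * length (link L v))
  good-links {m} {Q} {κ} {d} {ds} {L} {F} 16m≤K 1≤Q BL F≤L =
    *-cancelˡ-≤ (2 * N) {{>-nonZero (*-mono-≤ (s≤s {n = 1} z≤n) 1≤N)}} (+-cancelʳ-≤ (N * length L + N * length L) (2 * N * length L) (2 * N * (2 * ΣW)) (begin
      2 * N * length L + (N * length L + N * length L) ≡⟨ l1 N (length L) ⟩
      4 * N * length L                                 ≡⟨ cong (4 * N *_) (∑-length-link L) ⟨
      4 * N * ∑ (fins N) (λ v → length (link L v))     ≡⟨ ∑-*ˡ (fins N) (4 * N) _ ⟨
      ∑ (fins N) (λ v → 4 * N * length (link L v))     ≤⟨ ∑-mono (fins N) one ⟩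
      ∑ (fins N) (λ v → 4 * N * (𝟙 (W v) * length (link L v)) + (length L + 4 * N * ∑ (link L v) (𝟙 ∘ s)))
        ≡⟨ ∑-+ (fins N) _ _ ⟩
      ∑ (fins N) (λ v → 4 * N * (𝟙 (W v) * length (link L v))) + ∑ (fins N) (λ v → length L + 4 * N * ∑ (link L v) (𝟙 ∘ s))
        ≡⟨ cong₂ _+_ (∑-*ˡ (fins N) (4 * N) _) (∑-+ (fins N) _ _) ⟩
      4 * N * ΣW + (∑ (fins N) (λ _ → length L) + ∑ (fins N) (λ v → 4 * N * ∑ (link L v) (𝟙 ∘ s)))
        ≡⟨ cong (λ z → 4 * N * ΣW + z) (cong₂ _+_ (∑-const-fins (length L)) (trans (∑-*ˡ (fins N) (4 * N) _) (cong (4 * N *_) (trans (∑-link L (λ _ → 𝟙 ∘ s)) (sym (∑-map Vec.tail L (𝟙 ∘ s))))))) ⟩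
      4 * N * ΣW + (N * length L + 4 * N * S)          ≡⟨ cong (λ z → 4 * N * ΣW + (N * length L + z)) (l2 N S) ⟩
      4 * N * ΣW + (N * length L + N * (4 * S))
        ≤⟨ +-monoʳ-≤ (4 * N * ΣW) (+-monoʳ-≤ (N * length L) (*-monoʳ-≤ N (sat-count {L = L} F 16m≤K 1≤Q BL F≤L))) ⟩
      4 * N * ΣW + (N * length L + N * length L)       ≡⟨ cong (_+ (N * length L + N * length L)) (l3 N ΣW) ⟩
      2 * N * (2 * ΣW) + (N * length L + N * length L) ∎))
    where
    open ≤-Reasoning
    W : Fin N → Bool
    W = good (q * Q) (K * κ) F ds L
    s : Vec (Fin N) m → Bool
    s = sat (q * Q) (K * κ) F ds
    S = ∑ (tails L) (𝟙 ∘ s)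
    ΣW = ∑ (fins N) (λ v → 𝟙 (W v) * length (link L v))
    l1 : ∀ N a → 2 * N * a + (N * a + N * a) ≡ 4 * N * a
    l1 = solve-∀
    l2 : ∀ N a → 4 * N * a ≡ N * (4 * a)
    l2 = solve-∀
    l3 : ∀ N a → 4 * N * a ≡ 2 * N * (2 * a)
    l3 = solve-∀
    one : ∀ v → 4 * N * length (link L v) ≤ 4 * N * (𝟙 (W v) * length (link L v)) + (length L + 4 * N * ∑ (link L v) (𝟙 ∘ s))
    one v with W v in eq
    ... | true  = ≤-trans (≤-reflexive (cong (4 * N *_) (sym (*-identityˡ _)))) (m≤m+n _ _)
    ... | false = begin
      4 * N * length (link L v)
        ≡⟨ cong (4 * N *_) (length-filter-split s (link L v)) ⟩
      4 * N * (length (new (q * Q) (K * κ) F ds L v) + ∑ (link L v) (𝟙 ∘ s)) ≡⟨ *-distribˡ-+ (4 * N) _ _ ⟩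
      4 * N * length (new (q * Q) (K * κ) F ds L v) + 4 * N * ∑ (link L v) (𝟙 ∘ s)
        ≤⟨ +-monoˡ-≤ _ (<⇒≤ (≤ᵇ-false⁻ (length L) _ eq)) ⟩
      length L + 4 * N * ∑ (link L v) (𝟙 ∘ s)                                ≤⟨ m≤n+m _ (4 * N * (0 * length (link L v))) ⟩
      4 * N * (0 * length (link L v)) + (length L + 4 * N * ∑ (link L v) (𝟙 ∘ s)) ∎

  -- The bound on single coordinates turns links in `L` back into initial degrees: Q |link L v| ≤ P
  -- (θ + d v). The good vertices carry half of `L`; of the resulting 2e₀, all terms with θ together
  -- take up at most e₀, and the degrees `d` account for the rest.
  good-heavy : ∀ {Q κ d} {ds : Vec (Fin N → ℕ) m} {L F} → 16 * m ≤ K → 1 ≤ Q → κ ≤ P →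
    Bounded L (d ∷ ds) Q κ → e₀ ≤ Q * length L → q * length F ≤ length L →
    Heavy (good (q * Q) (K * κ) F ds L) d
  good-heavy {m} {Q} {κ} {d} {ds} {L} {F} 16m≤K 1≤Q κ≤P BL e₀≤ F≤L = +-cancelˡ-≤ e₀ _ _ (begin
    e₀ + e₀                                             ≡⟨ cong (e₀ +_) (+-identityʳ e₀) ⟨
    2 * e₀                                              ≤⟨ *-monoʳ-≤ 2 e₀≤ ⟩
    2 * (Q * length L)
      ≤⟨ *-monoʳ-≤ 2 (*-monoʳ-≤ Q (good-links {L = L} {F} 16m≤K 1≤Q BL F≤L)) ⟩
    2 * (Q * (2 * ∑ (fins N) (λ v → 𝟙 (W v) * length (link L v)))) ≡⟨ l1 Q _ ⟩
    4 * (Q * ∑ (fins N) (λ v → 𝟙 (W v) * length (link L v))) ≡⟨ cong (4 *_) (∑-*ˡ (fins N) Q _) ⟨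
    4 * ∑ (fins N) (λ v → Q * (𝟙 (W v) * length (link L v))) ≤⟨ *-monoʳ-≤ 4 (∑-mono (fins N) one) ⟩
    4 * ∑ (fins N) (λ v → P * θ + P * (𝟙 (W v) * d v))  ≡⟨ cong (4 *_) (∑-+ (fins N) _ _) ⟩
    4 * (∑ (fins N) (λ _ → P * θ) + ∑ (fins N) (λ v → P * (𝟙 (W v) * d v)))
      ≡⟨ cong (4 *_) (cong₂ _+_ (∑-const-fins (P * θ)) (∑-*ˡ (fins N) P _)) ⟩
    4 * (N * (P * θ) + P * ∑ (fins N) (λ v → 𝟙 (W v) * d v)) ≡⟨ l2 (N * (P * θ)) P _ ⟩
    4 * (N * (P * θ)) + 4 * P * ∑ (fins N) (λ v → 𝟙 (W v) * d v) ≤⟨ +-monoˡ-≤ _ 4NPθ≤e₀ ⟩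
    e₀ + 4 * P * ∑ (fins N) (λ v → 𝟙 (W v) * d v)       ∎)
    where
    open ≤-Reasoning
    W : Fin N → Bool
    W = good (q * Q) (K * κ) F ds L
    l1 : ∀ Q a → 2 * (Q * (2 * a)) ≡ 4 * (Q * a)
    l1 = solve-∀
    l2 : ∀ a P b → 4 * (a + P * b) ≡ 4 * a + 4 * P * b
    l2 = solve-∀
    single : ∀ v → Q * length (link L v) ≤ P * (θ + d v)
    single v = begin
      Q * length (link L v)      ≡⟨ cong (Q *_) (trans (deg-link L none v t₀) (deg-size0 (link L v) none t₀ (size-none m))) ⟨
      Q * deg L (true ∷ none) (v ∷ t₀) ≡⟨ *-identityˡ _ ⟨
      1 * (Q * deg L (true ∷ none) (v ∷ t₀)) ≤⟨ bound ⟩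
      κ * (θ + d v)              ≤⟨ *-monoˡ-≤ (θ + d v) κ≤P ⟩
      P * (θ + d v)              ∎
      where
      t₀ : Vec (Fin N) m
      t₀ = Vec.replicate m v₀
      bound : 1 * (Q * deg L (true ∷ none) (v ∷ t₀)) ≤ κ * (θ + d v)
      bound = subst (λ s → p ^ s * (Q * deg L (true ∷ none) (v ∷ t₀)) ≤ κ * (θ + d v)) (size-none m)
        (≤-trans (BL (true ∷ none) (v ∷ t₀) (s≤s z≤n)) (≤-reflexive rhs))
        where
        rhs : κ ^ suc (size (none {m})) * cap (true ∷ none) (d ∷ ds) (v ∷ t₀) ≡ κ * (θ + d v)
        rhs rewrite size-none m = cong (_* (θ + d v)) (*-identityʳ κ)
    one : ∀ v → Q * (𝟙 (W v) * length (link L v)) ≤ P * θ + P * (𝟙 (W v) * d v)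
    one v with W v
    ... | false = ≤-trans (≤-reflexive (*-zeroʳ Q)) z≤n
    ... | true  = begin
      Q * (length (link L v) + 0) ≡⟨ cong (Q *_) (+-identityʳ _) ⟩
      Q * length (link L v)     ≤⟨ single v ⟩
      P * (θ + d v)             ≡⟨ *-distribˡ-+ P θ (d v) ⟩
      P * θ + P * d v           ≡⟨ cong (λ z → P * θ + P * z) (+-identityʳ (d v)) ⟨
      P * θ + P * (d v + 0)     ∎

  Disjoint : (Fin N → Bool) → (Fin N → Bool) → Set
  Disjoint I W = ∀ v → I v ≡ true → W v ≡ false

  -- The members are the complements of containers. The base N + 1 allows, at each of `D` picks, for
  -- the N vertices and for the option to stop.
  record Family (Good : (Fin N → Bool) → Set) (Fits : (Fin N → Bool) → Set) (D : ℕ) : Set where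
    field
      sets   : List (Fin N → Bool)
      few    : length sets ≤ suc N ^ D
      heavy  : ∀ {W} → W ∈ sets → Good W
      covers : ∀ I → Fits I → ∃ λ W → W ∈ sets × Disjoint I W
  open Family

  HeavyIn : Vec (Fin N → ℕ) m → (Fin N → Bool) → Set
  HeavyIn ds W = VAny (Heavy W) ds

  Independent-new : ∀ {Q κ ds} {L : List (Vec (Fin N) (suc m))} {F} v I → I v ≡ true →
    Independent I L → Independent I F → Independent I (new Q κ F ds L v ++ F)
  Independent-new {Q = Q} {κ} {ds} {L} {F} v I Iv iL iF {t} t∈ with ∈-++⁻ (new Q κ F ds L v) t∈
  ... | inj₂ t∈F = iF t∈F
  ... | inj₁ t∈new = subst (λ c → c ∧ allV I t ≡ false) Iv (iL (∈-link⁻ L (proj₁ (∈-filterᵇ⁻ _ (link L v) t∈new))))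

  1≤b : 1 ≤ b
  1≤b = n≢0⇒n>0 λ b≡0 → <⇒≱ 1≤N (≤-trans (m≤n*m N 4) (≤-reflexive (trans (sym bq≡4N) (cong (_* q) b≡0))))

  -- c is the number of picks still allowed; every pick adds at least |L| / 4N tails to F.
  pick : ∀ {Q κ d D} {ds : Vec (Fin N → ℕ) m} {L} → 16 * m ≤ K → 1 ≤ Q → κ ≤ P →
    Bounded L (d ∷ ds) Q κ → e₀ ≤ Q * length L →
    (∀ F → Bounded F ds (q * Q) (K * κ) → length L ≤ q * length F → Family (HeavyIn ds) (λ I → Independent I F) D) →
    ∀ c F → Bounded F ds (q * Q) (K * κ) → b * length L ≤ 4 * N * length F + c * length L →
    Family (HeavyIn (d ∷ ds)) (λ I → Independent I L × Independent I F) (c + D)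
  pick {m} {Q} {κ} {d} {D} {ds} {L} 16m≤K 1≤Q κ≤P BL e₀≤ next = go
    where
    Goal : List (Vec (Fin N) m) → ℕ → Set
    Goal F c = Family (HeavyIn (d ∷ ds)) (λ I → Independent I L × Independent I F) (c + D)

    stop : ∀ c F → Bounded F ds (q * Q) (K * κ) → length L ≤ q * length F → Goal F c
    stop c F BF L≤F = record
      { sets = sets fam
      ; few = ≤-trans (few fam) (^-monoʳ-≤ (suc N) (m≤n+m D c))
      ; heavy = λ W∈ → VAny.there (heavy fam W∈)
      ; covers = λ I → covers fam I ∘ proj₂ }
      where fam = next F BF L≤F

    -- Each of the b picks adds at least |L| / 4N tails, and b = 4N / q makes this |L| / q in total.
    enough : ∀ F → b * length L ≤ 4 * N * length F + 0 * length L → length L ≤ q * length F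
    enough F h = *-cancelˡ-≤ b {{>-nonZero 1≤b}} (begin
      b * length L                  ≤⟨ h ⟩
      4 * N * length F + 0          ≡⟨ +-identityʳ _ ⟩
      4 * N * length F              ≡⟨ cong (_* length F) bq≡4N ⟨
      b * q * length F              ≡⟨ *-assoc b q (length F) ⟩
      b * (q * length F)            ∎)
      where open ≤-Reasoning

    go : ∀ c F → Bounded F ds (q * Q) (K * κ) → b * length L ≤ 4 * N * length F + c * length L → Goal F c
    go zero F BF h = stop zero F BF (enough F h)
    go (suc c) F BF h with length L ≤? q * length F
    ... | yes L≤F = stop (suc c) F BF L≤F
    ... | no L≰F = record
      -- An `I` that avoids all good vertices is served by `W` itself; any other `I` contains a good
      -- `v` and is served by the branch in which `v` is picked.
      { sets = W ∷ List.concatMap branch-sets (fins N)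
      ; few = few′
      ; heavy = λ { (here refl) → VAny.here (good-heavy {L = L} {F} 16m≤K 1≤Q κ≤P BL e₀≤ (<⇒≤ (≰⇒> L≰F)))
                  ; (there W∈) → heavy-branch (fins N) W∈ }
      ; covers = covers′ }
      where
      W : Fin N → Bool
      W = good (q * Q) (K * κ) F ds L
      F⁺ : Fin N → List (Vec (Fin N) m)
      F⁺ v = new (q * Q) (K * κ) F ds L v ++ F
      progress : ∀ v → W v ≡ true → b * length L ≤ 4 * N * length (F⁺ v) + c * length L
      progress v Wv = begin
        b * length L                                     ≤⟨ h ⟩
        4 * N * length F + (length L + c * length L)
          ≤⟨ +-monoʳ-≤ (4 * N * length F) (+-monoˡ-≤ (c * length L) (≤ᵇ-true⁻ (length L) _ Wv)) ⟩
        4 * N * length F + (4 * N * length nw + c * length L) ≡⟨ l1 (4 * N) (length F) (length nw) (c * length L) ⟩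
        4 * N * (length nw + length F) + c * length L    ≡⟨ cong (λ z → 4 * N * z + c * length L) (length-++ nw) ⟨
        4 * N * length (F⁺ v) + c * length L             ∎
        where
        open ≤-Reasoning
        nw = new (q * Q) (K * κ) F ds L v
        l1 : ∀ a x y z → a * x + (a * y + z) ≡ a * (y + x) + z
        l1 = solve-∀
      sub : ∀ v → W v ≡ true → Goal (F⁺ v) c
      sub v Wv = go c (F⁺ v) (Bounded-add {L = L} {F} v κ≤P BL BF) (progress v Wv)
      -- The recursive call needs a proof that `v` is good, so the value of `W v` is passed with its
      -- equation; other vertices open no branch.
      branch : ∀ v w → W v ≡ w → List (Fin N → Bool)
      branch v true e = sets (sub v e)
      branch v false e = []
      branch-sets : Fin N → List (Fin N → Bool)
      branch-sets v = branch v (W v) refl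
      branch-few : ∀ v w e → length (branch v w e) ≤ suc N ^ (c + D)
      branch-few v true e = few (sub v e)
      branch-few v false e = z≤n
      branch-heavy : ∀ v w e {U} → U ∈ branch v w e → HeavyIn (d ∷ ds) U
      branch-heavy v true e U∈ = heavy (sub v e) U∈
      few-concat : ∀ vs → length (List.concatMap branch-sets vs) ≤ length vs * suc N ^ (c + D)
      few-concat [] = z≤n
      few-concat (v ∷ vs) = ≤-trans (≤-reflexive (length-++ (branch-sets v)))
        (+-mono-≤ (branch-few v (W v) refl) (few-concat vs))
      few′ : suc (length (List.concatMap branch-sets (fins N))) ≤ suc N ^ suc (c + D)
      few′ = +-mono-≤ (m^n>0 (suc N) (c + D))
        (≤-trans (few-concat (fins N)) (≤-reflexive (cong (_* suc N ^ (c + D)) (length-fins N))))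
      heavy-branch : ∀ vs {U} → U ∈ List.concatMap branch-sets vs → HeavyIn (d ∷ ds) U
      heavy-branch (v ∷ vs) U∈ with ∈-++⁻ (branch-sets v) U∈
      ... | inj₁ U∈v = branch-heavy v (W v) refl U∈v
      ... | inj₂ U∈r = heavy-branch vs U∈r
      branch-∈ : ∀ v w e → w ≡ true → ∃ λ e′ → sets (sub v e′) ≡ branch v w e
      branch-∈ v true e _ = e , refl
      covers′ : ∀ I → Independent I L × Independent I F →
        ∃ λ U → U ∈ W ∷ List.concatMap branch-sets (fins N) × Disjoint I U
      covers′ I (iL , iF) with any-or-none (fins N) (λ v → I v ∧ W v)
      ... | inj₂ no-v = W , here refl , λ v Iv → subst (λ c → c ∧ W v ≡ false) Iv (no-v (∈-fins v))
      ... | inj₁ (v , _ , IWv) =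
        let (Iv , Wv) = ∧-true⁻ {I v} IWv
            (e′ , same) = branch-∈ v (W v) refl Wv
            (U , U∈ , I#U) = covers (sub v e′) I (iL , Independent-new {Q = q * Q} {K * κ} {ds} {L} {F} v I Iv iL iF)
        in U , there (∈-concatMap {h = branch-sets} (∈-fins v) (subst (U ∈_) same U∈)) , I#U

  -- Every level keeps e₀ ≤ Q |L|, so the list is nonempty even at uniformity 0. The empty hyperedge
  -- it then contains lies inside every `I`: no independent set gets this far, and the empty family
  -- suffices.
  containers : ∀ m {Q κ} {ds : Vec (Fin N → ℕ) m} {L} → 16 * m ≤ K → 1 ≤ Q → κ * K ^ m ≤ P →
    Bounded L ds Q κ → e₀ ≤ Q * length L → Family (HeavyIn ds) (λ I → Independent I L) (m * b)
  containers zero {Q} {L = []} _ _ _ _ e₀≤ = ⊥-elim (<⇒≱ 1≤e₀ (≤-trans e₀≤ (≤-reflexive (*-zeroʳ Q))))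
  containers zero {L = [] ∷ _} _ _ _ _ _ = record
    { sets = [] ; few = z≤n ; heavy = λ () ; covers = λ I iL → ⊥-elim (true≢false (iL (here refl))) }
  containers (suc m) {Q} {κ} {d ∷ ds} {L} 16m≤K 1≤Q κK≤P BL e₀≤ = record
    { sets = sets fam ; few = few fam ; heavy = heavy fam ; covers = λ I iL → covers fam I (iL , λ ()) }
    where
    16m≤K′ : 16 * m ≤ K
    16m≤K′ = ≤-trans (*-monoʳ-≤ 16 (n≤1+n m)) 16m≤K
    κ≤P : κ ≤ P
    κ≤P = ≤-trans (≤-trans (≤-reflexive (sym (*-identityʳ κ))) (*-monoʳ-≤ κ (m^n>0 K {{>-nonZero 1≤K}} (suc m)))) κK≤P
    l1 : ∀ K κ x → K * κ * x ≡ κ * (K * x)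
    l1 = solve-∀
    l2 : ∀ q Q x → Q * (q * x) ≡ q * Q * x
    l2 = solve-∀
    next : ∀ F → Bounded F ds (q * Q) (K * κ) → length L ≤ q * length F →
      Family (HeavyIn ds) (λ I → Independent I F) (m * b)
    next F BF L≤F = containers m {q * Q} {K * κ} 16m≤K′ (*-mono-≤ 1≤q 1≤Q) (≤-trans (≤-reflexive (l1 K κ (K ^ m))) κK≤P) BF
      (≤-trans e₀≤ (≤-trans (*-monoʳ-≤ Q L≤F) (≤-reflexive (l2 q Q (length F)))))
    fam = pick {Q = Q} {κ} {L = L} 16m≤K′ 1≤Q κ≤P BL e₀≤ next b []
      (λ J t _ → ≤-trans (≤-reflexive (trans (cong (p ^ pred (size J) *_) (*-zeroʳ (q * Q))) (*-zeroʳ (p ^ pred (size J))))) z≤n)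
      (m≤n+m (b * length L) (4 * N * 0))

-- Iterating the containers until they induce few hyperedges

degrees : List (Vec (Fin N) m) → Vec (Fin N → ℕ) m
degrees {m = zero} L = []
degrees {m = suc m} L = (λ v → length (link L v)) ∷ degrees (tails L)

allV-∧ : (p q : A → Bool) (t : Vec A m) → allV (λ v → p v ∧ q v) t ≡ allV p t ∧ allV q t
allV-∧ p q [] = refl
allV-∧ p q (x ∷ t) rewrite allV-∧ p q t with p x | q x | allV p t
... | true  | true  | _ = refl
... | true  | false | true = refl
... | true  | false | false = refl
... | false | _     | _ = refl

-- Heaviness in a single coordinate is enough: the degree sum over `W` counts hyperedges with this
-- coordinate in `W`, and all of these disappear when `W` is removed.
hit-count : (W : Fin N → Bool) (L : List (Vec (Fin N) m)) (c X : ℕ) →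
  VAny (λ d → X ≤ c * ∑ (fins N) (λ v → 𝟙 (W v) * d v)) (degrees L) →
  X ≤ c * ∑ L (λ e → 𝟙 (not (allV (not ∘ W) e)))
hit-count {N} {suc m} W L c X (VAny.here h) = ≤-trans h (*-monoʳ-≤ c (begin
  ∑ (fins N) (λ v → 𝟙 (W v) * length (link L v))
    ≡⟨ ∑-cong (fins N) (λ v → trans (*-comm (𝟙 (W v)) _) (sym (∑-const (link L v) (𝟙 (W v))))) ⟩
  ∑ (fins N) (λ v → ∑ (link L v) (λ _ → 𝟙 (W v)))
    ≡⟨ ∑-link L (λ v _ → 𝟙 (W v)) ⟩
  ∑ L (λ e → 𝟙 (W (Vec.head e)))
    ≤⟨ ∑-mono L hit ⟩
  ∑ L (λ e → 𝟙 (not (allV (not ∘ W) e))) ∎))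
  where
  open ≤-Reasoning
  hit : ∀ e → 𝟙 (W (Vec.head e)) ≤ 𝟙 (not (allV (not ∘ W) e))
  hit (x ∷ t) with W x
  ... | true  = ≤-refl
  ... | false = z≤n
hit-count {N} {suc m} W L c X (VAny.there h) = ≤-trans (hit-count W (tails L) c X h)
  (*-monoʳ-≤ c (≤-trans (≤-reflexive (∑-map Vec.tail L _)) (∑-mono L hit)))
  where
  hit : ∀ (e : Vec (Fin N) (suc m)) → 𝟙 (not (allV (not ∘ W) (Vec.tail e))) ≤ 𝟙 (not (allV (not ∘ W) e))
  hit (x ∷ t) with W x
  ... | true  = 𝟙≤1 _
  ... | false = ≤-refl

suc-power-lower : ∀ x m → x ^ suc m + suc m * x ^ m ≤ suc x ^ suc m
suc-power-lower x zero = ≤-reflexive (lem x)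
  where
  lem : ∀ x → x * 1 + 1 * 1 ≡ suc x * 1
  lem = solve-∀
suc-power-lower x (suc m) = begin
  x ^ suc (suc m) + suc (suc m) * x ^ suc m        ≤⟨ m≤m+n _ (suc m * x ^ m) ⟩
  x ^ suc (suc m) + suc (suc m) * x ^ suc m + suc m * x ^ m ≡⟨ lem x (x ^ m) m ⟩
  suc x * (x ^ suc m + suc m * x ^ m)              ≤⟨ *-monoʳ-≤ (suc x) (suc-power-lower x m) ⟩
  suc x * suc x ^ suc m                            ∎
  where
  open ≤-Reasoning
  lem : ∀ x y m → x * (x * y) + suc (suc m) * (x * y) + suc m * y ≡ suc x * (x * y + suc m * y)
  lem = solve-∀

twice-power≤ : ∀ x → 2 * x ^ suc x ≤ suc x ^ suc x
twice-power≤ x = begin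
  2 * x ^ suc x                   ≤⟨ m≤m+n _ (x ^ x) ⟩
  2 * x ^ suc x + x ^ x           ≡⟨ lem x (x ^ x) ⟩
  x ^ suc x + suc x * x ^ x       ≤⟨ suc-power-lower x x ⟩
  suc x ^ suc x                   ∎
  where
  open ≤-Reasoning
  lem : ∀ x y → 2 * (x * y) + y ≡ x * y + suc x * y
  lem = solve-∀

-- (1 - 1/(x+1)) ^ ((x+1) y) ≤ 2 ^ - y, cleared of denominators.
decay : ∀ x y → 2 ^ y * x ^ (suc x * y) ≤ suc x ^ (suc x * y)
decay x y = begin
  2 ^ y * x ^ (suc x * y)       ≡⟨ cong (2 ^ y *_) (^-*-assoc x (suc x) y) ⟨
  2 ^ y * (x ^ suc x) ^ y       ≡⟨ ^-distribʳ-* y 2 (x ^ suc x) ⟨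
  (2 * x ^ suc x) ^ y           ≤⟨ ^-monoˡ-≤ y (twice-power≤ x) ⟩
  (suc x ^ suc x) ^ y           ≡⟨ ^-*-assoc (suc x) (suc x) y ⟩
  suc x ^ (suc x * y)           ∎
  where open ≤-Reasoning

-- `E` is the desired gain: a container may induce at most |H| / E hyperedges. The codegree
-- hypothesis concerns |J| ≥ 2 and passes to sublists, so one θ serves all restarts; `θ-small` keeps
-- θ small enough for a run on any container that is still too large.
module Restart {N ℓ : ℕ} (v₀ : Fin N) (q K p P b θ E y : ℕ) (H : List (Vec (Fin N) ℓ))
  (1≤q : 1 ≤ q) (1≤K : 1 ≤ K) (1≤p : 1 ≤ p) (1≤P : 1 ≤ P) (2qP≤p : 2 * (q * P) ≤ p)
  (bq≡4N : b * q ≡ 4 * N) (16ℓ≤K : 16 * ℓ ≤ K) (Kℓ≤P : K ^ ℓ ≤ P)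
  (θ-small : 4 * (N * (P * θ)) * E ≤ length H)
  (codegree : ∀ J t → 2 ≤ size J → p ^ pred (size J) * deg H J t ≤ θ)
  (E≤2^y : E ≤ 2 ^ y) where

  restrict : (Fin N → Bool) → List (Vec (Fin N) ℓ)
  restrict C = filterᵇ (allV C) H

  Small : (Fin N → Bool) → Set
  Small C = length (restrict C) * E ≤ length H

  infix 4 _⊑_
  _⊑_ : (Fin N → Bool) → (Fin N → Bool) → Set
  I ⊑ C = ∀ v → I v ≡ true → C v ≡ true

  record Shrunk (C : Fin N → Bool) : Set where
    field
      sets   : List (Fin N → Bool)
      few    : length sets ≤ suc N ^ (ℓ * b)
      shrink : ∀ {C′} → C′ ∈ sets → length (restrict C) + 4 * P * length (restrict C′) ≤ 4 * P * length (restrict C)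
      covers : ∀ I → I ⊑ C → Independent I H → ∃ λ C′ → C′ ∈ sets × I ⊑ C′

  shrink-step : ∀ C → ¬ Small C → Shrunk C
  shrink-step C big = record
    { sets = map cut (sets fam)
    ; few = ≤-trans (≤-reflexive (length-map cut (sets fam))) (few fam)
    ; shrink = λ C′∈ → let (W , W∈ , e) = ∈-map⁻ cut C′∈ in
        subst (λ C′ → e₀ + 4 * P * length (restrict C′) ≤ 4 * P * e₀) (sym e) (shrink-cut W (heavy fam W∈))
    ; covers = λ I I⊑C iH →
        let (W , W∈ , I#W) = covers fam I (λ t∈ → iH (proj₁ (∈-filterᵇ⁻ (allV C) H t∈)))
        in cut W , ∈-map⁺ cut W∈ , λ v Iv → subst₂∧ (I⊑C v Iv) (I#W v Iv) }
    where
    L = restrict C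
    e₀ = length L
    cut : (Fin N → Bool) → Fin N → Bool
    cut W v = C v ∧ not (W v)
    subst₂∧ : ∀ {a b} → a ≡ true → b ≡ false → a ∧ not b ≡ true
    subst₂∧ refl refl = refl
    4NPθ≤e₀ : 4 * (N * (P * θ)) ≤ e₀
    4NPθ≤e₀ = ≮⇒≥ λ e₀< → big (≤-trans (*-monoˡ-≤ E (<⇒≤ e₀<)) θ-small)
    1≤e₀ : 1 ≤ e₀
    1≤e₀ = n≢0⇒n>0 λ e → big (≤-trans (≤-reflexive (cong (_* E) e)) z≤n)
    open Container v₀ q K p P b θ e₀ 1≤q 1≤K 1≤p 2qP≤p bq≡4N 4NPθ≤e₀ 1≤e₀
    open Family
    single-cap : ∀ {m} (L : List (Vec (Fin N) m)) J t → size J ≡ 1 → deg L J t ≤ cap J (degrees L) t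
    single-cap L (true ∷ J) (v ∷ t) e rewrite suc-injective e =
      ≤-trans (≤-reflexive (trans (deg-link L J v t) (deg-size0 (link L v) J t (suc-injective e)))) (m≤n+m _ θ)
    single-cap L (false ∷ J) (v ∷ t) e = ≤-trans (≤-reflexive (deg-tails L J v t)) (single-cap (tails L) J t e)
    -- Single coordinates are bounded by the degrees in the restriction itself, which `cap`
    -- includes; larger sets inherit the codegree bound of `H`.
    bounded : Bounded L (degrees L) 1 1
    bounded J t 1≤J with size J ≟ 1
    ... | yes e = begin
      p ^ pred (size J) * (1 * deg L J t)   ≡⟨ cong (λ s → p ^ pred s * (1 * deg L J t)) e ⟩
      1 * (1 * deg L J t)                   ≡⟨ trans (*-identityˡ _) (*-identityˡ _) ⟩
      deg L J t                             ≤⟨ single-cap L J t e ⟩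
      cap J (degrees L) t                   ≡⟨ *-identityˡ _ ⟨
      1 * cap J (degrees L) t               ≡⟨ cong (_* cap J (degrees L) t) (^-zeroˡ (size J)) ⟨
      1 ^ size J * cap J (degrees L) t      ∎
      where open ≤-Reasoning
    ... | no ne = begin
      p ^ pred (size J) * (1 * deg L J t)   ≡⟨ cong (p ^ pred (size J) *_) (*-identityˡ _) ⟩
      p ^ pred (size J) * deg L J t         ≤⟨ *-monoʳ-≤ (p ^ pred (size J)) (∑-filter-≤ (allV C) H _) ⟩
      p ^ pred (size J) * deg H J t         ≤⟨ codegree J t (≤∧≢⇒< 1≤J (ne ∘ sym)) ⟩
      θ                                     ≤⟨ θ≤cap J (degrees L) t ⟩
      cap J (degrees L) t                   ≡⟨ *-identityˡ _ ⟨
      1 * cap J (degrees L) t               ≡⟨ cong (_* cap J (degrees L) t) (^-zeroˡ (size J)) ⟨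
      1 ^ size J * cap J (degrees L) t      ∎
      where open ≤-Reasoning
    fam = containers ℓ {1} {1} {degrees L} {L} 16ℓ≤K ≤-refl (≤-trans (≤-reflexive (*-identityˡ _)) Kℓ≤P) bounded
            (≤-reflexive (sym (*-identityˡ e₀)))
    shrink-cut : ∀ W → HeavyIn (degrees L) W → e₀ + 4 * P * length (restrict (cut W)) ≤ 4 * P * e₀
    shrink-cut W h = begin
      e₀ + 4 * P * length (restrict (cut W))  ≤⟨ +-monoˡ-≤ _ (hit-count W L (4 * P) e₀ h) ⟩
      4 * P * hits + 4 * P * length (restrict (cut W)) ≡⟨ *-distribˡ-+ (4 * P) hits _ ⟨
      4 * P * (hits + length (restrict (cut W))) ≤⟨ *-monoʳ-≤ (4 * P) split ⟩
      4 * P * e₀                              ∎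
      where
      open ≤-Reasoning
      hits = ∑ L (λ e → 𝟙 (not (allV (not ∘ W) e)))
      pointwise : ∀ e → 𝟙 (allV C e) * 𝟙 (not (allV (not ∘ W) e)) + 𝟙 (allV (cut W) e) ≤ 𝟙 (allV C e)
      pointwise e rewrite allV-∧ C (not ∘ W) e with allV C e | allV (not ∘ W) e
      ... | true  | true  = ≤-refl
      ... | true  | false = ≤-refl
      ... | false | _     = ≤-refl
      split : hits + length (restrict (cut W)) ≤ e₀
      split = begin
        hits + length (restrict (cut W))
          ≡⟨ cong₂ _+_ (∑-filter (allV C) H _) (length-filter-∑ (allV (cut W)) H) ⟩
        ∑ H (λ e → 𝟙 (allV C e) * 𝟙 (not (allV (not ∘ W) e))) + ∑ H (λ e → 𝟙 (allV (cut W) e))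
          ≡⟨ ∑-+ H _ _ ⟨
        ∑ H (λ e → 𝟙 (allV C e) * 𝟙 (not (allV (not ∘ W) e)) + 𝟙 (allV (cut W) e))
          ≤⟨ ∑-mono H pointwise ⟩
        ∑ H (λ e → 𝟙 (allV C e))
          ≡⟨ length-filter-∑ (allV C) H ⟨
        e₀ ∎

  record SmallContainers (C : Fin N → Bool) (T : ℕ) : Set where
    field
      sets   : List (Fin N → Bool)
      few    : length sets ≤ (suc N ^ (ℓ * b)) ^ T
      small  : ∀ {C′} → C′ ∈ sets → Small C′
      covers : ∀ I → I ⊑ C → Independent I H → ∃ λ C′ → C′ ∈ sets × I ⊑ C′
  open SmallContainers

  -- One round leaves at most the fraction 1 - 1/4P = x / (x + 1) of the hyperedges.
  x : ℕ
  x = pred (4 * P)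

  suc-x : suc x ≡ 4 * P
  suc-x = suc-pred (4 * P) {{>-nonZero (*-mono-≤ {1} {4} (s≤s z≤n) 1≤P)}}

  1≤x : 1 ≤ x
  1≤x = s≤s⁻¹ (≤-trans (≤-trans (m≤m+n 2 2) (*-monoʳ-≤ 4 1≤P)) (≤-reflexive (sym suc-x)))

  -- `t` rounds are over and `T` are left. The invariant says |restrict C| ≤ (1 - 1/4P)^t |H|, so
  -- after all 4P y rounds `decay` leaves a fraction of at most 2^(-y) ≤ 1/E. Branches whose
  -- container is small earlier stop there.
  iterate : ∀ T t C → t + T ≡ suc x * y → suc x ^ t * length (restrict C) ≤ x ^ t * length H →
    SmallContainers C T
  iterate T t C t+T h with length (restrict C) * E ≤? length H
  ... | yes sm = record
    { sets = C ∷ []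
    ; few = m^n>0 (suc N ^ (ℓ * b)) {{m^n≢0 (suc N) (ℓ * b)}} T
    ; small = λ { (here refl) → sm }
    ; covers = λ I I⊑C _ → C , here refl , I⊑C }
  iterate zero t C t+T h | no big = ⊥-elim (big (begin
    length (restrict C) * E       ≤⟨ *-monoʳ-≤ (length (restrict C)) E≤2^y ⟩
    length (restrict C) * 2 ^ y   ≤⟨ *-cancelˡ-≤ (x ^ t) {{>-nonZero (m^n>0 x {{>-nonZero 1≤x}} t)}} (begin
      x ^ t * (length (restrict C) * 2 ^ y)  ≡⟨ l1 (x ^ t) _ (2 ^ y) ⟩
      2 ^ y * x ^ t * length (restrict C)    ≡⟨ cong (λ s → 2 ^ y * x ^ s * length (restrict C)) t≡ ⟩
      2 ^ y * x ^ (suc x * y) * length (restrict C) ≤⟨ *-monoˡ-≤ _ (decay x y) ⟩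
      suc x ^ (suc x * y) * length (restrict C) ≡⟨ cong (λ s → suc x ^ s * length (restrict C)) t≡ ⟨
      suc x ^ t * length (restrict C)        ≤⟨ h ⟩
      x ^ t * length H                       ∎) ⟩
    length H                      ∎))
    where
    open ≤-Reasoning
    t≡ : t ≡ suc x * y
    t≡ = trans (sym (+-identityʳ t)) t+T
    l1 : ∀ a b c → a * (b * c) ≡ c * a * b
    l1 = solve-∀
  iterate (suc T) t C t+T h | no big = record
    { sets = sets′ (Shrunk.sets sh) id
    ; few = ≤-trans (few′ (Shrunk.sets sh) id) (*-monoˡ-≤ _ (Shrunk.few sh))
    ; small = small′ (Shrunk.sets sh) id
    ; covers = λ I I⊑C iH →
        let (C′ , C′∈ , I⊑C′) = Shrunk.covers sh I I⊑C iH
        in covers′ (Shrunk.sets sh) id C′∈ I I⊑C′ iH }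
    where
    open ≤-Reasoning
    sh = shrink-step C big
    l2 : ∀ x a b → suc x * a * b ≡ a * (suc x * b)
    l2 = solve-∀
    l3 : ∀ x a b → x * a * b ≡ x * (a * b)
    l3 = solve-∀
    l4 : ∀ x a b → a * (x * b) ≡ x * (a * b)
    l4 = solve-∀
    next : ∀ {C′} → C′ ∈ Shrunk.sets sh → suc x ^ suc t * length (restrict C′) ≤ x ^ suc t * length H
    next {C′} C′∈ = begin
      suc x ^ suc t * length (restrict C′)     ≡⟨ l2 x (suc x ^ t) _ ⟩
      suc x ^ t * (suc x * length (restrict C′)) ≤⟨ *-monoʳ-≤ (suc x ^ t) drop ⟩
      suc x ^ t * (x * length (restrict C))    ≡⟨ l4 x (suc x ^ t) _ ⟩
      x * (suc x ^ t * length (restrict C))    ≤⟨ *-monoʳ-≤ x h ⟩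
      x * (x ^ t * length H)                   ≡⟨ l3 x (x ^ t) _ ⟨
      x ^ suc t * length H                     ∎
      where
      drop : suc x * length (restrict C′) ≤ x * length (restrict C)
      drop = +-cancelˡ-≤ (length (restrict C)) _ _
        (subst (λ s → length (restrict C) + s * length (restrict C′) ≤ s * length (restrict C)) (sym suc-x) (Shrunk.shrink sh C′∈))
    sub : ∀ {C′} → C′ ∈ Shrunk.sets sh → SmallContainers C′ T
    sub {C′} C′∈ = iterate T (suc t) C′ (trans (sym (+-suc t T)) t+T) (next C′∈)
    -- Membership is carried through the list recursion, since each recursive call needs the
    -- shrinking property of its own container.
    Sub : List (Fin N → Bool) → Set
    Sub Cs = ∀ {C′} → C′ ∈ Cs → C′ ∈ Shrunk.sets sh
    sets′ : ∀ Cs → Sub Cs → List (Fin N → Bool)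
    sets′ [] _ = []
    sets′ (C′ ∷ Cs) s = sets (sub (s (here refl))) ++ sets′ Cs (s ∘ there)
    few′ : ∀ Cs (s : Sub Cs) → length (sets′ Cs s) ≤ length Cs * (suc N ^ (ℓ * b)) ^ T
    few′ [] s = z≤n
    few′ (C′ ∷ Cs) s = ≤-trans (≤-reflexive (length-++ (sets (sub (s (here refl))))))
      (+-mono-≤ (few (sub (s (here refl)))) (few′ Cs (s ∘ there)))
    small′ : ∀ Cs (s : Sub Cs) {U} → U ∈ sets′ Cs s → Small U
    small′ (C′ ∷ Cs) s U∈ = [ small (sub (s (here refl))) , small′ Cs (s ∘ there) ]′
      (∈-++⁻ (sets (sub (s (here refl)))) U∈)
    covers′ : ∀ Cs (s : Sub Cs) {C′} → C′ ∈ Cs → ∀ I → I ⊑ C′ → Independent I H →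
      ∃ λ U → U ∈ sets′ Cs s × I ⊑ U
    covers′ (C′ ∷ Cs) s (here refl) I I⊑ iH =
      let (U , U∈ , r) = covers (sub (s (here refl))) I I⊑ iH in U , ∈-++⁺ˡ U∈ , r
    covers′ (C′ ∷ Cs) s (there C∈) I I⊑ iH =
      let (U , U∈ , r) = covers′ Cs (s ∘ there) C∈ I I⊑ iH in U , ∈-++⁺ʳ (sets (sub (s (here refl)))) U∈ , r

  small-containers : SmallContainers (λ _ → true) (4 * P * y)
  small-containers = subst (SmallContainers (λ _ → true)) (cong (_* y) suc-x)
    (iterate (suc x * y) 0 (λ _ → true) refl
      (*-monoʳ-≤ 1 (length-filter-≤ (allV (λ _ → true)) H)))

-- The hypergraph of cliques

-- The binomial coefficient k choose 2.
tri : ℕ → ℕ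
tri zero = 0
tri (suc k) = k + tri k

tri-mono : m ≤ n → tri m ≤ tri n
tri-mono z≤n = z≤n
tri-mono (s≤s h) = +-mono-≤ h (tri-mono h)

2*tri : ∀ k → 2 * tri (suc k) ≡ suc k * k
2*tri zero = refl
2*tri (suc k) = trans (lem k (tri (suc k))) (trans (cong (2 * suc k +_) (2*tri k)) (lem2 k))
  where
  lem : ∀ k t → 2 * (suc k + t) ≡ 2 * suc k + 2 * t
  lem = solve-∀
  lem2 : ∀ k → 2 * suc k + suc k * k ≡ suc (suc k) * suc k
  lem2 = solve-∀

pairs : (A → A → B) → Vec A k → Vec B (tri k)
pairs f [] = []
pairs f (x ∷ xs) = Vec.map (f x) xs Vec.++ pairs f xs

-- The vertices covered by a set J of pairs, the pairs being listed in the order of pairs.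
cover : ∀ k → Vec Bool (tri k) → Vec Bool k
cover zero J = []
cover (suc k) J = (1 ≤ᵇ size (Vec.take k J)) ∷ Vec.zipWith _∨_ (Vec.take k J) (cover k (Vec.drop k J))

size-take-drop : ∀ m (J : Vec Bool (m + n)) → size J ≡ size (Vec.take m J) + size (Vec.drop m J)
size-take-drop zero J = refl
size-take-drop (suc m) (true ∷ J) = cong suc (size-take-drop m J)
size-take-drop (suc m) (false ∷ J) = size-take-drop m J

size-∨ˡ : (I J : Vec Bool m) → size I ≤ size (Vec.zipWith _∨_ I J)
size-∨ˡ [] [] = z≤n
size-∨ˡ (true ∷ I) (_ ∷ J) = s≤s (size-∨ˡ I J)
size-∨ˡ (false ∷ I) (true ∷ J) = m≤n⇒m≤1+n (size-∨ˡ I J)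
size-∨ˡ (false ∷ I) (false ∷ J) = size-∨ˡ I J

size-∨ʳ : (I J : Vec Bool m) → size J ≤ size (Vec.zipWith _∨_ I J)
size-∨ʳ [] [] = z≤n
size-∨ʳ (true ∷ I) (true ∷ J) = s≤s (size-∨ʳ I J)
size-∨ʳ (true ∷ I) (false ∷ J) = m≤n⇒m≤1+n (size-∨ʳ I J)
size-∨ʳ (false ∷ I) (true ∷ J) = s≤s (size-∨ʳ I J)
size-∨ʳ (false ∷ I) (false ∷ J) = size-∨ʳ I J

-- The first vertex lies in at most as many pairs of `J` as there are other covered vertices. It is
-- applied in the other direction: many pairs cover many vertices and so have small codegree.
size-cover : ∀ k (J : Vec Bool (tri k)) → size J ≤ tri (size (cover k J))
size-cover zero [] = z≤n
size-cover (suc k) J = ≤-trans (≤-reflexive (size-take-drop k J)) (step (size J₁) refl)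
  where
  J₁ = Vec.take k J
  J₂ = Vec.drop k J
  w′ = size (Vec.zipWith _∨_ J₁ (cover k J₂))
  J₂≤ : size J₂ ≤ tri w′
  J₂≤ = ≤-trans (size-cover k J₂) (tri-mono (size-∨ʳ J₁ (cover k J₂)))
  step : ∀ s → s ≡ size J₁ → s + size J₂ ≤ tri (size ((1 ≤ᵇ s) ∷ Vec.zipWith _∨_ J₁ (cover k J₂)))
  step zero e = J₂≤
  step (suc s) e = +-mono-≤ (≤-trans (≤-reflexive e) (size-∨ˡ J₁ (cover k J₂))) J₂≤

agree-take-drop : ∀ m (J : Vec Bool (m + n)) (a c : Vec (Fin N) m) (b d : Vec (Fin N) n) →
  agree J (a Vec.++ b) (c Vec.++ d) ≡ true → agree (Vec.take m J) a c ≡ true × agree (Vec.drop m J) b d ≡ true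
agree-take-drop zero J [] [] b d h = refl , h
agree-take-drop (suc m) (true ∷ J) (x ∷ a) (y ∷ c) b d h with x == y
... | true = agree-take-drop m J a c b d h
agree-take-drop (suc m) (false ∷ J) (x ∷ a) (y ∷ c) b d h = agree-take-drop m J a c b d h

agree-map-combine : (J : Vec Bool m) (x y : Fin n) (xs ys : Vec (Fin n) m) →
  agree J (Vec.map (combine x) xs) (Vec.map (combine y) ys) ≡ true →
  agree J xs ys ≡ true × (1 ≤ size J → x ≡ y)
agree-map-combine [] x y [] [] h = refl , λ ()
agree-map-combine (true ∷ J) x y (a ∷ xs) (b ∷ ys) h
  with FinP.combine-injective x a y b (==⇒≡ _ _ (proj₁ (∧-true⁻ {combine x a == combine y b} h)))
... | refl , refl rewrite ==-refl a =
  proj₁ (agree-map-combine J x x xs ys (proj₂ (∧-true⁻ {combine x a == combine x a} h))) , λ _ → refl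
agree-map-combine (false ∷ J) x y (a ∷ xs) (b ∷ ys) h = agree-map-combine J x y xs ys h

agree-∨ : (I J : Vec Bool m) (a b : Vec (Fin n) m) → agree I a b ≡ true → agree J a b ≡ true →
  agree (Vec.zipWith _∨_ I J) a b ≡ true
agree-∨ [] [] [] [] h h′ = refl
agree-∨ (true ∷ I) (true ∷ J) (x ∷ a) (y ∷ b) h h′ with x == y
... | true = agree-∨ I J a b h h′
agree-∨ (true ∷ I) (false ∷ J) (x ∷ a) (y ∷ b) h h′ with x == y
... | true = agree-∨ I J a b h h′
agree-∨ (false ∷ I) (true ∷ J) (x ∷ a) (y ∷ b) h h′ with x == y
... | true = agree-∨ I J a b h h′
agree-∨ (false ∷ I) (false ∷ J) (x ∷ a) (y ∷ b) h h′ = agree-∨ I J a b h h′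

-- The code of a pair determines both of its ends, so agreement on the pairs in `J` fixes every
-- covered vertex and leaves only the others free.
agree-cover : ∀ k (J : Vec Bool (tri k)) (φ ψ : Vec (Fin n) k) →
  agree J (pairs combine φ) (pairs combine ψ) ≡ true → agree (cover k J) φ ψ ≡ true
agree-cover zero J [] [] h = refl
agree-cover (suc k) J (x ∷ φ) (y ∷ ψ) h =
  let (h₁ , h₂) = agree-take-drop k J (Vec.map (combine x) φ) (Vec.map (combine y) ψ) (pairs combine φ) (pairs combine ψ) h
      (e , x≡y) = agree-map-combine (Vec.take k J) x y φ ψ h₁
  in head-agrees (size (Vec.take k J)) x≡y (agree-∨ (Vec.take k J) (cover k (Vec.drop k J)) φ ψ e (agree-cover k (Vec.drop k J) φ ψ h₂))
  where
  head-agrees : ∀ s {J′} → (1 ≤ s → x ≡ y) → agree J′ φ ψ ≡ true → agree ((1 ≤ᵇ s) ∷ J′) (x ∷ φ) (y ∷ ψ) ≡ true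
  head-agrees zero _ e = e
  head-agrees (suc s) x≡y e with x≡y (s≤s z≤n)
  ... | refl rewrite ==-refl x = e

count-agree : ∀ k (W : Vec Bool k) (ψ : Vec (Fin n) k) →
  ∑ (vecs (fins n) k) (λ φ → 𝟙 (agree W φ ψ)) * n ^ size W ≡ n ^ k
count-agree zero [] [] = refl
count-agree {n} (suc k) (true ∷ W) (y ∷ ψ) = begin
  ∑ (vecs (fins n) (suc k)) (λ φ → 𝟙 (agree (true ∷ W) φ (y ∷ ψ))) * n ^ suc (size W)
    ≡⟨ cong (_* n ^ suc (size W)) (trans (∑-vecs (fins n) k _) (∑-cong (fins n) inner)) ⟩
  ∑ (fins n) (λ x → 𝟙 (x == y) * S) * n ^ suc (size W)
    ≡⟨ cong (_* n ^ suc (size W)) (trans (∑-*ʳ (fins n) S _) (trans (cong (_* S) (trans (∑-cong (fins n) (λ x → cong 𝟙 (==-sym x y))) (∑-δ1 y))) (*-identityˡ S))) ⟩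
  S * (n * n ^ size W) ≡⟨ lem S n (n ^ size W) ⟩
  n * (S * n ^ size W) ≡⟨ cong (n *_) (count-agree k W ψ) ⟩
  n * n ^ k ∎
  where
  open ≡-Reasoning
  S = ∑ (vecs (fins n) k) (λ φ → 𝟙 (agree W φ ψ))
  lem : ∀ a b c → a * (b * c) ≡ b * (a * c)
  lem = solve-∀
  inner : ∀ x → ∑ (vecs (fins n) k) (λ φ → 𝟙 ((x == y) ∧ agree W φ ψ)) ≡ 𝟙 (x == y) * S
  inner x with x == y
  ... | true  = sym (*-identityˡ S)
  ... | false = ∑-zero (vecs (fins n) k)
count-agree {n} (suc k) (false ∷ W) (y ∷ ψ) = begin
  ∑ (vecs (fins n) (suc k)) (λ φ → 𝟙 (agree (false ∷ W) φ (y ∷ ψ))) * n ^ size W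
    ≡⟨ cong (_* n ^ size W) (trans (∑-vecs (fins n) k _) (∑-const (fins n) S)) ⟩
  length (fins n) * S * n ^ size W ≡⟨ cong (λ z → z * S * n ^ size W) (length-fins n) ⟩
  n * S * n ^ size W ≡⟨ *-assoc n S _ ⟩
  n * (S * n ^ size W) ≡⟨ cong (n *_) (count-agree k W ψ) ⟩
  n * n ^ k ∎
  where
  open ≡-Reasoning
  S = ∑ (vecs (fins n) k) (λ φ → 𝟙 (agree W φ ψ))

-- All n^k maps are taken, over ordered pairs including the diagonal, so that codegrees are bounded
-- by plain powers of n. A map that is not injective produces a diagonal pair, which no colour class
-- contains, so it does not affect independence.
cliques : ∀ n k → List (Vec (Fin (n * n)) (tri k))
cliques n k = map (pairs combine) (vecs (fins n) k)

length-cliques : ∀ n k → length (cliques n k) ≡ n ^ k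
length-cliques n k = trans (length-map _ (vecs (fins n) k))
  (trans (length-vecs (fins n) k) (cong (_^ k) (length-fins n)))

-- `t` need not come from a map; if some ψ matches it on `J`, then ψ can stand in for `t`, and
-- `count-agree` applies to the vertices that `J` covers.
codegree-cliques : ∀ k (J : Vec Bool (tri k)) (t : Vec (Fin (n * n)) (tri k)) →
  deg (cliques n k) J t * n ^ size (cover k J) ≤ n ^ k
codegree-cliques {n} k J t with ∑𝟙-zero-or-∃ (vecs (fins n) k) (λ φ → agree J (pairs combine φ) t)
... | inj₁ e = ≤-trans (≤-reflexive (cong (_* n ^ size (cover k J)) (trans (∑-map _ (vecs (fins n) k) _) e))) z≤n
... | inj₂ (ψ , _ , ψ~t) = begin
  deg (cliques n k) J t * n ^ size (cover k J)
    ≡⟨ cong (_* n ^ size (cover k J)) (∑-map _ (vecs (fins n) k) _) ⟩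
  ∑ (vecs (fins n) k) (λ φ → 𝟙 (agree J (pairs combine φ) t)) * n ^ size (cover k J)
    ≤⟨ *-monoˡ-≤ (n ^ size (cover k J)) (∑-mono (vecs (fins n) k) one) ⟩
  ∑ (vecs (fins n) k) (λ φ → 𝟙 (agree (cover k J) φ ψ)) * n ^ size (cover k J)
    ≡⟨ count-agree k (cover k J) ψ ⟩
  n ^ k ∎
  where
  open ≤-Reasoning
  one : ∀ φ → 𝟙 (agree J (pairs combine φ) t) ≤ 𝟙 (agree (cover k J) φ ψ)
  one φ with agree J (pairs combine φ) t in e
  ... | false = z≤n
  ... | true rewrite agree-cover k J φ ψ (trans (agree-trans J (pairs combine φ) (pairs combine ψ) t ψ~t) e) = ≤-refl

size≤ : (J : Vec Bool m) → size J ≤ m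
size≤ [] = z≤n
size≤ (true ∷ J) = s≤s (size≤ J)
size≤ (false ∷ J) = m≤n⇒m≤1+n (size≤ J)

allV-++⁻ : (p : A → Bool) (s : Vec A m) (t : Vec A n) → allV p (s Vec.++ t) ≡ true → allV p s ≡ true × allV p t ≡ true
allV-++⁻ p [] t h = refl , h
allV-++⁻ p (x ∷ s) t h with p x
... | true = allV-++⁻ p s t h

allV-++⁺ : (p : A → Bool) (s : Vec A m) (t : Vec A n) → allV p s ≡ true → allV p t ≡ true → allV p (s Vec.++ t) ≡ true
allV-++⁺ p [] t h h′ = h′
allV-++⁺ p (x ∷ s) t h h′ with p x
... | true = allV-++⁺ p s t h h′

allV-lookup : (p : A → Bool) (s : Vec A m) → allV p s ≡ true → ∀ i → p (lookup s i) ≡ true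
allV-lookup p (x ∷ s) h zero = proj₁ (∧-true⁻ {p x} h)
allV-lookup p (x ∷ s) h (suc i) = allV-lookup p s (proj₂ (∧-true⁻ {p x} h)) i

allV-lookup⁺ : (p : A → Bool) (s : Vec A m) → (∀ i → p (lookup s i) ≡ true) → allV p s ≡ true
allV-lookup⁺ p [] h = refl
allV-lookup⁺ p (x ∷ s) h rewrite h zero = allV-lookup⁺ p s (h ∘ suc)

allV-map : (p : B → Bool) (f : A → B) (s : Vec A m) → allV p (Vec.map f s) ≡ allV (p ∘ f) s
allV-map p f [] = refl
allV-map p f (x ∷ s) = cong (p (f x) ∧_) (allV-map p f s)

allV-pairs⁻ : (p : B → Bool) (f : A → A → B) (φ : Vec A k) → allV p (pairs f φ) ≡ true →
  ∀ {i j} → i Fin.< j → p (f (lookup φ i) (lookup φ j)) ≡ true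
allV-pairs⁻ p f (x ∷ φ) h {zero} {suc j} _ =
  allV-lookup (p ∘ f x) φ (trans (sym (allV-map p (f x) φ)) (proj₁ (allV-++⁻ p (Vec.map (f x) φ) (pairs f φ) h))) j
allV-pairs⁻ p f (x ∷ φ) h {suc i} {suc j} (s≤s i<j) =
  allV-pairs⁻ p f φ (proj₂ (allV-++⁻ p (Vec.map (f x) φ) (pairs f φ) h)) i<j

allV-pairs⁺ : (p : B → Bool) (f : A → A → B) (φ : Vec A k) →
  (∀ {i j} → i Fin.< j → p (f (lookup φ i) (lookup φ j)) ≡ true) → allV p (pairs f φ) ≡ true
allV-pairs⁺ p f [] h = refl
allV-pairs⁺ p f (x ∷ φ) h = allV-++⁺ p (Vec.map (f x) φ) (pairs f φ)
  (trans (allV-map p (f x) φ) (allV-lookup⁺ (p ∘ f x) φ λ j → h {zero} {suc j} (s≤s z≤n)))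
  (allV-pairs⁺ p f φ λ i<j → h (s≤s i<j))

-- Product spaces

allF : (Fin m → Bool) → Bool
allF {zero} p = true
allF {suc m} p = p zero ∧ allF (p ∘ suc)

allF⁻ : (p : Fin m → Bool) → allF p ≡ true → ∀ i → p i ≡ true
allF⁻ p h zero = proj₁ (∧-true⁻ {p zero} h)
allF⁻ p h (suc i) = allF⁻ (p ∘ suc) (proj₂ (∧-true⁻ {p zero} h)) i

allF⁺ : (p : Fin m → Bool) → (∀ i → p i ≡ true) → allF p ≡ true
allF⁺ {zero} p h = refl
allF⁺ {suc m} p h rewrite h zero = allF⁺ (p ∘ suc) (h ∘ suc)

allF-cong : {p q : Fin m → Bool} → (∀ i → p i ≡ q i) → allF p ≡ allF q
allF-cong {zero} h = refl
allF-cong {suc m} h = cong₂ _∧_ (h zero) (allF-cong (h ∘ suc))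

∑-vecs-const : (xs : List A) (m c : ℕ) → ∑ (vecs xs m) (λ _ → c) ≡ length xs ^ m * c
∑-vecs-const xs m c = trans (∑-const (vecs xs m) c) (cong (_* c) (length-vecs xs m))

-- Independence: `f` ignores coordinate `i`, and this coordinate equals `z` with probability 1/n.
fix-coordinate : (f : Vec (Fin n) N → ℕ) (i : Fin N) (z : Fin n) → (∀ g a → f (g [ i ]≔ a) ≡ f g) →
  n * ∑ (vecs (fins n) N) (λ g → 𝟙 (z == lookup g i) * f g) ≡ ∑ (vecs (fins n) N) f
fix-coordinate {n} {suc N} f zero z indep = begin
  n * ∑ (vecs (fins n) (suc N)) (λ g → 𝟙 (z == lookup g zero) * f g)
    ≡⟨ cong (n *_) (trans (∑-vecs (fins n) N _) (∑-cong (fins n) λ a → ∑-*ˡ (vecs (fins n) N) (𝟙 (z == a)) _)) ⟩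
  n * ∑ (fins n) (λ a → 𝟙 (z == a) * ∑ (vecs (fins n) N) (λ g → f (a ∷ g)))
    ≡⟨ cong (n *_) (∑-δ z _) ⟩
  n * ∑ (vecs (fins n) N) (λ g → f (z ∷ g))
    ≡⟨ cong (_* ∑ (vecs (fins n) N) (λ g → f (z ∷ g))) (length-fins n) ⟨
  length (fins n) * ∑ (vecs (fins n) N) (λ g → f (z ∷ g))
    ≡⟨ ∑-const (fins n) _ ⟨
  ∑ (fins n) (λ a → ∑ (vecs (fins n) N) (λ g → f (z ∷ g)))
    ≡⟨ ∑-cong (fins n) (λ a → ∑-cong (vecs (fins n) N) λ g → indep (a ∷ g) z) ⟩
  ∑ (fins n) (λ a → ∑ (vecs (fins n) N) (λ g → f (a ∷ g)))
    ≡⟨ ∑-vecs (fins n) N f ⟨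
  ∑ (vecs (fins n) (suc N)) f ∎
  where open ≡-Reasoning
fix-coordinate {n} {suc N} f (suc i) z indep = begin
  n * ∑ (vecs (fins n) (suc N)) (λ g → 𝟙 (z == lookup g (suc i)) * f g)
    ≡⟨ cong (n *_) (∑-vecs (fins n) N _) ⟩
  n * ∑ (fins n) (λ a → ∑ (vecs (fins n) N) (λ g → 𝟙 (z == lookup g i) * f (a ∷ g)))
    ≡⟨ ∑-*ˡ (fins n) n _ ⟨
  ∑ (fins n) (λ a → n * ∑ (vecs (fins n) N) (λ g → 𝟙 (z == lookup g i) * f (a ∷ g)))
    ≡⟨ ∑-cong (fins n) (λ a → fix-coordinate (λ g → f (a ∷ g)) i z λ g b → indep (a ∷ g) b) ⟩
  ∑ (fins n) (λ a → ∑ (vecs (fins n) N) (λ g → f (a ∷ g)))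
    ≡⟨ ∑-vecs (fins n) N f ⟨
  ∑ (vecs (fins n) (suc N)) f ∎
  where open ≡-Reasoning

count-constrained : (c : Fin m → Fin N) → Injective _≡_ _≡_ c → (z : Fin m → Fin n) →
  ∑ (vecs (fins n) N) (λ g → 𝟙 (allF (λ j → z j == lookup g (c j)))) * n ^ m ≡ n ^ N
count-constrained {zero} {N} {n} c inj z =
  trans (*-identityʳ _) (trans (∑-vecs-const (fins n) N 1) (trans (*-identityʳ _) (cong (_^ N) (length-fins n))))
count-constrained {suc m} {N} {n} c inj z = begin
  ∑ G (λ g → 𝟙 ((z zero == lookup g (c zero)) ∧ rest g)) * (n * n ^ m)
    ≡⟨ cong (_* (n * n ^ m)) (∑-cong G λ g → 𝟙-∧ (z zero == lookup g (c zero)) (rest g)) ⟩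
  ∑ G (λ g → 𝟙 (z zero == lookup g (c zero)) * 𝟙 (rest g)) * (n * n ^ m)
    ≡⟨ lem _ n (n ^ m) ⟩
  n * ∑ G (λ g → 𝟙 (z zero == lookup g (c zero)) * 𝟙 (rest g)) * n ^ m
    ≡⟨ cong (_* n ^ m) (fix-coordinate (𝟙 ∘ rest) (c zero) (z zero) indep) ⟩
  ∑ G (𝟙 ∘ rest) * n ^ m
    ≡⟨ count-constrained (c ∘ suc) (FinP.suc-injective ∘ inj) (z ∘ suc) ⟩
  n ^ N ∎
  where
  open ≡-Reasoning
  G = vecs (fins n) N
  rest : Vec (Fin n) N → Bool
  rest g = allF (λ j → z (suc j) == lookup g (c (suc j)))
  lem : ∀ a b c → a * (b * c) ≡ b * a * c
  lem = solve-∀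
  𝟙-∧ : ∀ a b → 𝟙 (a ∧ b) ≡ 𝟙 a * 𝟙 b
  𝟙-∧ true b = sym (+-identityʳ (𝟙 b))
  𝟙-∧ false b = refl
  indep : ∀ g a → 𝟙 (rest (g [ c zero ]≔ a)) ≡ 𝟙 (rest g)
  indep g a = cong 𝟙 (allF-cong λ j → cong (z (suc j) ==_)
    (lookup∘update′ (λ e → FinP.0≢1+n (inj (sym e))) g a))

∑-vec-δ : (w : Fin m → Fin n) (f : Vec (Fin n) m → ℕ) →
  ∑ (vecs (fins n) m) (λ φ → 𝟙 (allF (λ j → lookup φ j == w j)) * f φ) ≡ f (tabulate w)
∑-vec-δ {zero} w f = trans (+-identityʳ _) (+-identityʳ _)
∑-vec-δ {suc m} {n} w f = begin
  ∑ (vecs (fins n) (suc m)) (λ φ → 𝟙 (allF (λ j → lookup φ j == w j)) * f φ)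
    ≡⟨ ∑-vecs (fins n) m _ ⟩
  ∑ (fins n) (λ x → ∑ (vecs (fins n) m) (λ φ → 𝟙 ((x == w zero) ∧ allF (λ j → lookup φ j == w (suc j))) * f (x ∷ φ)))
    ≡⟨ ∑-cong (fins n) inner ⟩
  ∑ (fins n) (λ x → 𝟙 (w zero == x) * f (x ∷ tabulate (w ∘ suc)))
    ≡⟨ ∑-δ (w zero) _ ⟩
  f (tabulate w) ∎
  where
  open ≡-Reasoning
  inner : ∀ x → ∑ (vecs (fins n) m) (λ φ → 𝟙 ((x == w zero) ∧ allF (λ j → lookup φ j == w (suc j))) * f (x ∷ φ))
    ≡ 𝟙 (w zero == x) * f (x ∷ tabulate (w ∘ suc))
  inner x rewrite ==-sym (w zero) x with x == w zero
  ... | true  = trans (∑-vec-δ (w ∘ suc) (λ φ → f (x ∷ φ))) (sym (*-identityˡ _))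
  ... | false = ∑-zero (vecs (fins n) m)

-- The restriction of a uniform map to distinct arguments is uniform: `f` is expanded into point
-- masses, each of probability n^(-m) by `count-constrained`.
marginal : ∀ {R} (ι : Fin m → Fin R) → Injective _≡_ _≡_ ι → (f : Vec (Fin n) m → ℕ) →
  ∑ (vecs (fins n) R) (λ ψ → f (tabulate (lookup ψ ∘ ι))) * n ^ m ≡ n ^ R * ∑ (vecs (fins n) m) f
marginal {m} {n} {R} ι inj f = begin
  ∑ Ψ (λ ψ → f (tabulate (lookup ψ ∘ ι))) * n ^ m
    ≡⟨ cong (_* n ^ m) (∑-cong Ψ λ ψ → sym (∑-vec-δ (lookup ψ ∘ ι) f)) ⟩
  ∑ Ψ (λ ψ → ∑ Φ (λ φ → 𝟙 (allF (λ j → lookup φ j == lookup ψ (ι j))) * f φ)) * n ^ m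
    ≡⟨ cong (_* n ^ m) (∑-swap Ψ Φ _) ⟩
  ∑ Φ (λ φ → ∑ Ψ (λ ψ → 𝟙 (allF (λ j → lookup φ j == lookup ψ (ι j))) * f φ)) * n ^ m
    ≡⟨ ∑-*ʳ Φ (n ^ m) _ ⟨
  ∑ Φ (λ φ → ∑ Ψ (λ ψ → 𝟙 (allF (λ j → lookup φ j == lookup ψ (ι j))) * f φ) * n ^ m)
    ≡⟨ ∑-cong Φ (λ φ → trans (cong (_* n ^ m) (∑-*ʳ Ψ (f φ) (λ ψ → 𝟙 (allF (λ j → lookup φ j == lookup ψ (ι j)))))) (trans (lem (∑ Ψ (λ ψ → 𝟙 (allF (λ j → lookup φ j == lookup ψ (ι j))))) (f φ) (n ^ m)) (cong (_* f φ) (count-constrained ι inj (lookup φ))))) ⟩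
  ∑ Φ (λ φ → n ^ R * f φ)
    ≡⟨ ∑-*ˡ Φ (n ^ R) f ⟩
  n ^ R * ∑ Φ f ∎
  where
  open ≡-Reasoning
  Ψ = vecs (fins n) R
  Φ = vecs (fins n) m
  lem : ∀ a b c → a * b * c ≡ a * c * b
  lem = solve-∀

hits : Fin n → (Fin N → Bool) → Vec (Fin n) N → ℕ
hits {N = N} z D g = ∑ (fins N) (λ v → 𝟙 (D v ∧ (z == lookup g v)))

-- 2^(N - hits), the integer form of the exponential weight 2^(-hits) in Chernoff's bound for the
-- lower tail, written as a product over the coordinates.
misses-weight : Fin n → (Fin N → Bool) → Vec (Fin n) N → ℕ
misses-weight z D [] = 1
misses-weight z D (a ∷ g) = (if D zero ∧ (z == a) then 1 else 2) * misses-weight z (D ∘ suc) g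

misses-weight-hits : (z : Fin n) (D : Fin N → Bool) (g : Vec (Fin n) N) →
  misses-weight z D g * 2 ^ hits z D g ≡ 2 ^ N
misses-weight-hits z D [] = refl
misses-weight-hits {N = suc N} z D (a ∷ g) = trans
  (cong (λ s → (if b then 1 else 2) * misses-weight z (D ∘ suc) g * 2 ^ (𝟙 b + s)) (∑-map suc (fins N) _))
  (trans (step b) (cong (2 *_) (misses-weight-hits z (D ∘ suc) g)))
  where
  b = D zero ∧ (z == a)
  lem : ∀ w h → 1 * w * (2 * h) ≡ 2 * (w * h)
  lem = solve-∀
  step : ∀ b → (if b then 1 else 2) * misses-weight z (D ∘ suc) g * 2 ^ (𝟙 b + hits z (D ∘ suc) g)
    ≡ 2 * (misses-weight z (D ∘ suc) g * 2 ^ hits z (D ∘ suc) g)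
  step true  = lem (misses-weight z (D ∘ suc) g) (2 ^ hits z (D ∘ suc) g)
  step false = *-assoc 2 (misses-weight z (D ∘ suc) g) _

-- The coordinates are independent, and each one in `D` contributes the mean 1 - 1/2n = x / (x + 1),
-- as a hit has probability 1/n and halves the weight.
∑-misses-weight : ∀ x (z : Fin n) (D : Fin N → Bool) → suc x ≡ 2 * n →
  ∑ (vecs (fins n) N) (misses-weight z D) * suc x ^ ∑ (fins N) (𝟙 ∘ D) ≡ suc x ^ N * x ^ ∑ (fins N) (𝟙 ∘ D)
∑-misses-weight {N = zero} x z D e = refl
∑-misses-weight {n} {suc N} x z D e = begin
  ∑ (vecs (fins n) (suc N)) (misses-weight z D) * suc x ^ (𝟙 (D zero) + ∑ (map suc (fins N)) (𝟙 ∘ D))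
    ≡⟨ cong₂ (λ a b → a * suc x ^ (𝟙 (D zero) + b)) (trans (∑-vecs (fins n) N _)
         (trans (∑-cong (fins n) λ a → ∑-*ˡ (vecs (fins n) N) (if D zero ∧ (z == a) then 1 else 2) _) (∑-*ʳ (fins n) W _)))
         (∑-map suc (fins N) _) ⟩
  ∑ (fins n) (λ a → if D zero ∧ (z == a) then 1 else 2) * W * suc x ^ (𝟙 (D zero) + d)
    ≡⟨ head (D zero) ⟩
  suc x * x ^ 𝟙 (D zero) * (W * suc x ^ d)
    ≡⟨ cong (suc x * x ^ 𝟙 (D zero) *_) (∑-misses-weight x z (D ∘ suc) e) ⟩
  suc x * x ^ 𝟙 (D zero) * (suc x ^ N * x ^ d)
    ≡⟨ lem (suc x) (x ^ 𝟙 (D zero)) (suc x ^ N) (x ^ d) ⟩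
  suc x ^ suc N * (x ^ 𝟙 (D zero) * x ^ d)
    ≡⟨ cong (suc x ^ suc N *_) (^-distribˡ-+-* x (𝟙 (D zero)) d) ⟨
  suc x ^ suc N * x ^ (𝟙 (D zero) + d)
    ≡⟨ cong (λ b → suc x ^ suc N * x ^ (𝟙 (D zero) + b)) (∑-map suc (fins N) _) ⟨
  suc x ^ suc N * x ^ ∑ (fins (suc N)) (𝟙 ∘ D) ∎
  where
  open ≡-Reasoning
  d = ∑ (fins N) (𝟙 ∘ D ∘ suc)
  W = ∑ (vecs (fins n) N) (misses-weight z (D ∘ suc))
  lem : ∀ a b c d → a * b * (c * d) ≡ a * c * (b * d)
  lem = solve-∀
  l1 : ∀ x W S → x * W * ((1 + x) * S) ≡ (1 + x) * (x * 1) * (W * S)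
  l1 = solve-∀
  l2 : ∀ y W S → y * W * S ≡ y * 1 * (W * S)
  l2 = solve-∀
  x≡ : ∑ (fins n) (λ a → if z == a then 1 else 2) ≡ x
  x≡ = suc-injective (begin
    suc (∑ (fins n) (λ a → if z == a then 1 else 2))   ≡⟨ +-comm 1 _ ⟩
    ∑ (fins n) (λ a → if z == a then 1 else 2) + 1     ≡⟨ cong (∑ (fins n) (λ a → if z == a then 1 else 2) +_) (∑-δ1 z) ⟨
    ∑ (fins n) (λ a → if z == a then 1 else 2) + ∑ (fins n) (λ a → 𝟙 (z == a)) ≡⟨ ∑-+ (fins n) _ _ ⟨
    ∑ (fins n) (λ a → (if z == a then 1 else 2) + 𝟙 (z == a)) ≡⟨ ∑-cong (fins n) (λ a → two (z == a)) ⟩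
    ∑ (fins n) (λ _ → 2)                               ≡⟨ twos ⟩
    2 * n                                              ≡⟨ e ⟨
    suc x                                              ∎)
    where
    two : ∀ b → (if b then 1 else 2) + 𝟙 b ≡ 2
    two true = refl
    two false = refl
    twos : ∑ (fins n) (λ _ → 2) ≡ 2 * n
    twos = trans (∑-const (fins n) 2) (trans (*-comm (length (fins n)) 2) (cong (2 *_) (length-fins n)))
  twos′ : ∑ (fins n) (λ _ → 2) ≡ suc x
  twos′ = trans (∑-const (fins n) 2) (trans (*-comm (length (fins n)) 2) (trans (cong (2 *_) (length-fins n)) (sym e)))
  head : ∀ b → ∑ (fins n) (λ a → if b ∧ (z == a) then 1 else 2) * W * suc x ^ (𝟙 b + d)
    ≡ suc x * x ^ 𝟙 b * (W * suc x ^ d)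
  head true  = trans (cong (λ s → s * W * suc x ^ suc d) x≡) (l1 x W (suc x ^ d))
  head false = trans (cong (λ s → s * W * suc x ^ d) twos′) (l2 (suc x) W (suc x ^ d))

-- Supersaturation

∑-fins-+ : ∀ m n (f : Fin (m + n) → ℕ) → ∑ (fins (m + n)) f ≡ ∑ (fins m) (λ i → f (i ↑ˡ n)) + ∑ (fins n) (λ j → f (m ↑ʳ j))
∑-fins-+ zero n f = refl
∑-fins-+ (suc m) n f = trans (cong (f zero +_) (trans (∑-map suc (fins (m + n)) f) (trans (∑-fins-+ m n (f ∘ suc))
    (cong (_+ ∑ (fins n) (λ j → f (suc (m ↑ʳ j)))) (sym (∑-map suc (fins m) _))))))
  (sym (+-assoc (f zero) _ _))

∑-combine : ∀ m n (f : Fin (m * n) → ℕ) → ∑ (fins m) (λ x → ∑ (fins n) (λ y → f (combine x y))) ≡ ∑ (fins (m * n)) f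
∑-combine zero n f = refl
∑-combine (suc m) n f = trans (cong (∑ (fins n) (λ y → f (y ↑ˡ m * n)) +_)
    (trans (∑-map suc (fins m) _) (∑-combine m n (λ j → f (n ↑ʳ j)))))
  (sym (∑-fins-+ n (m * n) f))

infix 4 _≺_
_≺_ : Fin n → Fin n → Bool
x ≺ y = suc (toℕ x) ≤ᵇ toℕ y

≢⇒≺ : {x y : Fin n} → x ≢ y → (x ≺ y) ≡ true ⊎ (y ≺ x) ≡ true
≢⇒≺ {x = x} {y} x≢y with <-cmp (toℕ x) (toℕ y)
... | tri< lt _ _ = inj₁ (≤ᵇ-true⁺ lt)
... | tri≈ _ eq _ = ⊥-elim (x≢y (FinP.toℕ-injective eq))
... | tri> _ _ gt = inj₂ (≤ᵇ-true⁺ gt)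

-- The last index when p is nowhere true.
first : (Fin (suc r) → Bool) → Fin (suc r)
first {zero} p = zero
first {suc r} p = if p zero then zero else suc (first (p ∘ suc))

first-true : (p : Fin (suc r) → Bool) (c : Fin (suc r)) → p c ≡ true → p (first p) ≡ true
first-true {zero} p zero h = h
first-true {suc r} p c h with p zero in e
... | true = e
first-true {suc r} p zero h    | false = ⊥-elim (true≢false (trans (sym h) e))
first-true {suc r} p (suc c) h | false = first-true (p ∘ suc) c h

first-cong : {p p′ : Fin (suc r) → Bool} → (∀ c → p c ≡ p′ c) → first p ≡ first p′
first-cong {zero} h = refl
first-cong {suc r} {p} {p′} h rewrite h zero with p′ zero
... | true = refl
... | false = cong suc (first-cong (h ∘ suc))

some-true : (p : Fin m → Bool) → allF (not ∘ p) ≡ false → ∃ λ i → p i ≡ true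
some-true {suc m} p h with p zero in e
... | true = zero , e
... | false = let (i , q) = some-true (p ∘ suc) h in suc i , q

injectiveᵇ : Vec (Fin n) k → Bool
injectiveᵇ φ = allF (λ i → allF (λ j → (i == j) ∨ not (lookup φ i == lookup φ j)))

injectiveᵇ⁻ : (φ : Vec (Fin n) k) → injectiveᵇ φ ≡ true → Injective _≡_ _≡_ (lookup φ)
injectiveᵇ⁻ φ h {i} {j} e with allF⁻ _ (allF⁻ _ h i) j
... | q with i Fin.≟ j
...   | yes i≡j = i≡j
...   | no _ rewrite e | ==-refl (lookup φ j) = ⊥-elim (true≢false (sym q))

injectiveᵇ⁺ : (φ : Vec (Fin n) k) → Injective _≡_ _≡_ (lookup φ) → injectiveᵇ φ ≡ true
injectiveᵇ⁺ φ inj = allF⁺ _ λ i → allF⁺ _ λ j → one i j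
  where
  one : ∀ i j → (i == j) ∨ not (lookup φ i == lookup φ j) ≡ true
  one i j with i Fin.≟ j
  ... | yes _ = refl
  ... | no i≢j with lookup φ i Fin.≟ lookup φ j
  ...   | yes e = ⊥-elim (i≢j (inj e))
  ...   | no _ = refl

pair : Fin R → Fin R → Fin 2 → Fin R
pair a b zero = a
pair a b (suc zero) = b

pair-injective : {a b : Fin R} → a ≢ b → Injective _≡_ _≡_ (pair a b)
pair-injective a≢b {zero} {zero} e = refl
pair-injective a≢b {zero} {suc zero} e = ⊥-elim (a≢b e)
pair-injective a≢b {suc zero} {zero} e = ⊥-elim (a≢b (sym e))
pair-injective a≢b {suc zero} {suc zero} e = refl

marginal₂ : (f : Fin n → Fin n → ℕ) {a b : Fin R} → a ≢ b →
  ∑ (vecs (fins n) R) (λ ψ → f (lookup ψ a) (lookup ψ b)) * (n * n) ≡ n ^ R * ∑ (fins n) (λ x → ∑ (fins n) (f x))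
marginal₂ {n} {R} f {a} {b} a≢b = trans
  (cong (∑ (vecs (fins n) R) (λ ψ → f (lookup ψ a) (lookup ψ b)) *_) (cong (n *_) (sym (*-identityʳ n))))
  (trans (marginal (pair a b) (pair-injective a≢b) g)
    (cong (n ^ R *_) (trans (∑-vecs (fins n) 1 g) (∑-cong (fins n) λ x →
      trans (∑-vecs (fins n) 0 _) (∑-cong (fins n) λ y → +-identityʳ (f x y))))))
  where
  g : Vec (Fin n) 2 → ℕ
  g (x ∷ y ∷ []) = f x y

K-adj : {i j : Fin R} → adj (K R) i j ≡ true → i ≢ j
K-adj {i = i} h refl = true≢false (trans (sym h) (adj-irrefl (K _) i))

uncovered : (Fin r → Fin (n * n) → Bool) → Fin n → Fin n → Bool
uncovered D x y = (x ≺ y) ∧ allF (λ c → not (D c (combine x y)))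

-- Averaging over all maps [R] → [n]: unless two vertices coincide or a pair is uncovered, such a map is coloured
-- by D, so it contains a monochromatic K_k.
module _ {n R k r : ℕ} (D : Fin (suc r) → Fin (n * n) → Bool)
  (D-sym : ∀ c (x y : Fin n) → D c (combine x y) ≡ D c (combine y x))
  (arrows : Arrows (K R) k (suc r)) where

  private
    Ψ = vecs (fins n) R
    Ι = vecs (fins R) k
    P = fins R

    defect : Vec (Fin n) R → Fin R → Fin R → ℕ
    defect ψ a b = 𝟙 (not (a == b)) * (𝟙 (lookup ψ a == lookup ψ b) + 𝟙 (uncovered D (lookup ψ a) (lookup ψ b)))

    mono : Vec (Fin n) R → Fin (suc r) → Vec (Fin R) k → ℕ
    mono ψ c ι = 𝟙 (injectiveᵇ ι) * 𝟙 (allV (D c) (pairs combine (tabulate (lookup ψ ∘ lookup ι))))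

    total : Vec (Fin n) R → ℕ
    total ψ = ∑ P (λ a → ∑ P (defect ψ a)) + ∑ (fins (suc r)) (λ c → ∑ Ι (mono ψ c))

    1≤total : ∀ ψ → 1 ≤ total ψ
    1≤total ψ = n≢0⇒n>0 impossible
      where
      impossible : total ψ ≢ 0
      impossible e = <⇒≱ (≤-trans mono-positive (≤-trans (term≤∑ (mono ψ c) (∈-vecs-fins ι))
                        (term≤∑ (λ c → ∑ Ι (mono ψ c)) (∈-fins c)))) (≤-reflexive no-mono)
        where
        no-defects = m+n≡0⇒m≡0 (∑ P (λ a → ∑ P (defect ψ a))) e
        no-mono = m+n≡0⇒n≡0 (∑ P (λ a → ∑ P (defect ψ a))) e
        no-defect : ∀ a b → defect ψ a b ≡ 0
        no-defect a b = n≤0⇒n≡0 (≤-trans (term≤∑ (defect ψ a) (∈-fins b))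
          (≤-trans (term≤∑ (λ a → ∑ P (defect ψ a)) (∈-fins a)) (≤-reflexive no-defects)))
        𝟙≡0 : ∀ {b} → 𝟙 b ≡ 0 → b ≡ false
        𝟙≡0 {false} _ = refl
        clean : ∀ {a b} → a ≢ b →
          (lookup ψ a == lookup ψ b) ≡ false × uncovered D (lookup ψ a) (lookup ψ b) ≡ false
        clean {a} {b} a≢b with a Fin.≟ b | no-defect a b
        ... | yes a≡b | _ = ⊥-elim (a≢b a≡b)
        ... | no _ | e′ =
          let e″ = trans (sym (+-identityʳ _)) e′
          in 𝟙≡0 (m+n≡0⇒m≡0 _ e″) , 𝟙≡0 (m+n≡0⇒n≡0 (𝟙 (lookup ψ a == lookup ψ b)) e″)
        -- For a ≠ b the image pair is covered in one of its two orders, so the default value of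
        -- `first` does not occur; the diagonal carries no edge.
        colour : Fin R → Fin R → Fin (suc r)
        colour a b = first (λ c → D c (combine (lookup ψ a) (lookup ψ b)))
        colour-sym : ∀ a b → colour a b ≡ colour b a
        colour-sym a b = first-cong λ c → D-sym c (lookup ψ a) (lookup ψ b)
        covered-≺ : ∀ (x y : Fin n) → (x ≺ y) ≡ true → uncovered D x y ≡ false → ∃ λ c → D c (combine x y) ≡ true
        covered-≺ x y lt un = some-true (λ c → D c (combine x y)) (subst (λ b → b ∧ allF (λ c → not (D c (combine x y))) ≡ false) lt un)
        coloured : ∀ {a b} → a ≢ b → D (colour a b) (combine (lookup ψ a) (lookup ψ b)) ≡ true
        coloured {a} {b} a≢b with clean a≢b | clean (a≢b ∘ sym)
        ... | ne , un | _ , un′ with ≢⇒≺ {x = lookup ψ a} {lookup ψ b} (λ e → true≢false (trans (sym (subst (λ z → (lookup ψ a == z) ≡ true) e (==-refl (lookup ψ a)))) ne))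
        ...   | inj₁ lt = let (c , h) = covered-≺ (lookup ψ a) (lookup ψ b) lt un in first-true (λ c → D c (combine (lookup ψ a) (lookup ψ b))) c h
        ...   | inj₂ gt = let (c , h) = covered-≺ (lookup ψ b) (lookup ψ a) gt un′ in
                first-true (λ c → D c (combine (lookup ψ a) (lookup ψ b))) c (trans (D-sym c (lookup ψ a) (lookup ψ b)) h)
        found = arrows colour colour-sym
        c = proj₁ found
        f = proj₁ (proj₂ found)
        f-inj : Injective _≡_ _≡_ f
        f-inj = proj₁ (proj₂ (proj₂ found))
        f-mono = proj₂ (proj₂ (proj₂ found))
        ι : Vec (Fin R) k
        ι = tabulate f
        edge : ∀ i j → i Fin.< j → D c (combine (lookup (tabulate (lookup ψ ∘ lookup ι)) i) (lookup (tabulate (lookup ψ ∘ lookup ι)) j)) ≡ true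
        edge i j i<j rewrite lookup∘tabulate (lookup ψ ∘ lookup ι) i | lookup∘tabulate (lookup ψ ∘ lookup ι) j
          | lookup∘tabulate f i | lookup∘tabulate f j =
          let i≢j = FinP.<⇒≢ i<j
              (is-edge , col≡c) = f-mono i j i≢j
          in subst (λ c → D c (combine (lookup ψ (f i)) (lookup ψ (f j))) ≡ true) col≡c (coloured (K-adj {i = f i} {f j} is-edge))
        mono-positive : 1 ≤ mono ψ c ι
        mono-positive rewrite injectiveᵇ⁺ ι (λ {i} {j} e → f-inj (trans (sym (lookup∘tabulate f i)) (trans e (lookup∘tabulate f j))))
          | allV-pairs⁺ (D c) combine (tabulate (lookup ψ ∘ lookup ι)) (λ {i} {j} i<j → edge i j i<j) = s≤s z≤n

    d : ℕ
    d = ∑ (fins n) (λ x → ∑ (fins n) (λ y → 𝟙 (uncovered D x y)))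

    ∑-diagonal : ∑ (fins n) (λ x → ∑ (fins n) (λ y → 𝟙 (x == y))) ≡ n
    ∑-diagonal = trans (∑-cong (fins n) ∑-δ1) (trans (∑-const (fins n) 1) (trans (*-identityʳ _) (length-fins n)))

    ∑defect : ∀ a b → ∑ Ψ (λ ψ → defect ψ a b) * (n * n) ≤ n ^ R * (n + d)
    ∑defect a b with a Fin.≟ b
    ... | yes _ = ≤-trans (≤-reflexive (cong (_* (n * n)) (∑-zero Ψ))) z≤n
    ... | no a≢b = ≤-reflexive (trans (cong (_* (n * n)) (∑-cong Ψ λ ψ → *-identityˡ _))
      (trans (marginal₂ (λ x y → 𝟙 (x == y) + 𝟙 (uncovered D x y)) a≢b)
        (cong (n ^ R *_) (trans (∑-cong (fins n) λ x → ∑-+ (fins n) _ _) (trans (∑-+ (fins n) _ _) (cong (_+ d) ∑-diagonal))))))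

    ∑mono : ∀ c ι → ∑ Ψ (λ ψ → mono ψ c ι) * n ^ k ≤ n ^ R * ∑ (vecs (fins n) k) (λ φ → 𝟙 (allV (D c) (pairs combine φ)))
    ∑mono c ι with injectiveᵇ ι in e
    ... | false = ≤-trans (≤-reflexive (cong (_* n ^ k) (∑-zero Ψ))) z≤n
    ... | true = ≤-reflexive (trans (cong (_* n ^ k) (∑-cong Ψ λ ψ → *-identityˡ _))
      (marginal (lookup ι) (injectiveᵇ⁻ ι e) (λ φ → 𝟙 (allV (D c) (pairs combine φ)))))

  -- Let d be the number of uncovered pairs. Among all maps, at most a quarter contain a
  -- monochromatic clique, by a union bound over colours and index tuples. At most a fraction R^2 /
  -- n ≤ 1/4 identify two indices, and at most R^2 d / n^2 meet an uncovered pair. These add up to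
  -- at least 1, so R^2 d ≥ n^2 / 2.
  supersaturation : 1 ≤ R → 4 * (R * R) ≤ n →
    (∀ c → ∑ (vecs (fins n) k) (λ φ → 𝟙 (allV (D c) (pairs combine φ))) * (4 * (suc r * R ^ k)) ≤ n ^ k) →
    n * n ≤ 2 * (R * R) * ∑ (fins n) (λ x → ∑ (fins n) (λ y → 𝟙 (uncovered D x y)))
  supersaturation 1≤R 4RR≤n small = *-cancelˡ-≤ (2 * n ^ R) {{>-nonZero 1≤2nR}} final
    where
    open ≤-Reasoning
    1≤n : 1 ≤ n
    1≤n = ≤-trans (*-mono-≤ {1} {4} (s≤s z≤n) (*-mono-≤ 1≤R 1≤R)) 4RR≤n
    1≤2nR : 1 ≤ 2 * n ^ R
    1≤2nR = *-mono-≤ {1} {2} (s≤s z≤n) (m^n>0 n {{>-nonZero 1≤n}} R)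
    Aₛ = ∑ Ψ (λ ψ → ∑ P (λ a → ∑ P (defect ψ a)))
    Cₛ = ∑ Ψ (λ ψ → ∑ (fins (suc r)) (λ c → ∑ Ι (mono ψ c)))
    length-P : length P ≡ R
    length-P = length-fins R
    nR≤ : n ^ R ≤ Aₛ + Cₛ
    nR≤ = begin
      n ^ R                       ≡⟨ trans (length-vecs (fins n) R) (cong (_^ R) (length-fins n)) ⟨
      length Ψ                    ≡⟨ length-∑ Ψ ⟩
      ∑ Ψ (λ _ → 1)               ≤⟨ ∑-mono Ψ 1≤total ⟩
      ∑ Ψ total                   ≡⟨ ∑-+ Ψ _ _ ⟩
      Aₛ + Cₛ                     ∎
    A≤ : Aₛ * (n * n) ≤ R * R * (n ^ R * (n + d))
    A≤ = begin
      Aₛ * (n * n)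
        ≡⟨ cong (_* (n * n)) (trans (∑-swap Ψ P _) (∑-cong P λ a → ∑-swap Ψ P _)) ⟩
      ∑ P (λ a → ∑ P (λ b → ∑ Ψ (λ ψ → defect ψ a b))) * (n * n)
        ≡⟨ trans (sym (∑-*ʳ P (n * n) _)) (∑-cong P λ a → sym (∑-*ʳ P (n * n) _)) ⟩
      ∑ P (λ a → ∑ P (λ b → ∑ Ψ (λ ψ → defect ψ a b) * (n * n)))
        ≤⟨ ∑-≤const P (R * (n ^ R * (n + d))) (λ {a} _ → ≤-trans (∑-≤const P (n ^ R * (n + d)) (λ {b} _ → ∑defect a b)) (≤-reflexive (cong (_* (n ^ R * (n + d))) length-P))) ⟩
      length P * (R * (n ^ R * (n + d)))
        ≡⟨ trans (cong (_* (R * (n ^ R * (n + d)))) length-P) (sym (*-assoc R R _)) ⟩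
      R * R * (n ^ R * (n + d)) ∎
    E = 4 * (suc r * R ^ k)
    one : ∀ c ι → ∑ Ψ (λ ψ → mono ψ c ι) * E ≤ n ^ R
    one c ι = *-cancelʳ-≤ _ _ (n ^ k) {{m^n≢0 n k {{>-nonZero 1≤n}}}} (begin
      ∑ Ψ (λ ψ → mono ψ c ι) * E * n ^ k    ≡⟨ l1 (∑ Ψ (λ ψ → mono ψ c ι)) E (n ^ k) ⟩
      ∑ Ψ (λ ψ → mono ψ c ι) * n ^ k * E    ≤⟨ *-monoˡ-≤ E (∑mono c ι) ⟩
      n ^ R * ∑ (vecs (fins n) k) (λ φ → 𝟙 (allV (D c) (pairs combine φ))) * E ≡⟨ *-assoc (n ^ R) _ E ⟩
      n ^ R * (∑ (vecs (fins n) k) (λ φ → 𝟙 (allV (D c) (pairs combine φ))) * E) ≤⟨ *-monoʳ-≤ (n ^ R) (small c) ⟩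
      n ^ R * n ^ k                         ∎)
      where
      l1 : ∀ a b c → a * b * c ≡ a * c * b
      l1 = solve-∀
    length-Ι : length Ι ≡ R ^ k
    length-Ι = trans (length-vecs (fins R) k) (cong (_^ k) length-P)
    C≤ : 4 * Cₛ ≤ n ^ R
    C≤ = *-cancelʳ-≤ _ _ (suc r * R ^ k) {{>-nonZero (*-mono-≤ {1} {suc r} (s≤s z≤n) (m^n>0 R {{>-nonZero 1≤R}} k))}} (begin
      4 * Cₛ * (suc r * R ^ k)    ≡⟨ l2 Cₛ (suc r * R ^ k) ⟩
      Cₛ * E
        ≡⟨ cong (_* E) (trans (∑-swap Ψ (fins (suc r)) _) (∑-cong (fins (suc r)) λ c → ∑-swap Ψ Ι _)) ⟩
      ∑ (fins (suc r)) (λ c → ∑ Ι (λ ι → ∑ Ψ (λ ψ → mono ψ c ι))) * E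
        ≡⟨ trans (sym (∑-*ʳ (fins (suc r)) E (λ c → ∑ Ι (λ ι → ∑ Ψ (λ ψ → mono ψ c ι))))) (∑-cong (fins (suc r)) λ c → sym (∑-*ʳ Ι E (λ ι → ∑ Ψ (λ ψ → mono ψ c ι)))) ⟩
      ∑ (fins (suc r)) (λ c → ∑ Ι (λ ι → ∑ Ψ (λ ψ → mono ψ c ι) * E))
        ≤⟨ ∑-≤const (fins (suc r)) (R ^ k * n ^ R) (λ {c} _ → ≤-trans (∑-≤const Ι (n ^ R) (λ {ι} _ → one c ι)) (≤-reflexive (cong (_* n ^ R) length-Ι))) ⟩
      length (fins (suc r)) * (R ^ k * n ^ R) ≡⟨ cong (_* (R ^ k * n ^ R)) (length-fins (suc r)) ⟩
      suc r * (R ^ k * n ^ R)     ≡⟨ l3 (suc r) (R ^ k) (n ^ R) ⟩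
      n ^ R * (suc r * R ^ k)     ∎)
      where
      l2 : ∀ a b → 4 * a * b ≡ a * (4 * b)
      l2 = solve-∀
      l3 : ∀ a b c → a * (b * c) ≡ c * (a * b)
      l3 = solve-∀
    final : 2 * n ^ R * (n * n) ≤ 2 * n ^ R * (2 * (R * R) * d)
    final = +-cancelˡ-≤ (2 * (n ^ R * (n * n))) _ _ (begin
      2 * (n ^ R * (n * n)) + 2 * n ^ R * (n * n)   ≡⟨ l4 (n ^ R) (n * n) ⟩
      4 * (n ^ R * (n * n))                         ≤⟨ *-monoʳ-≤ 4 (*-monoˡ-≤ (n * n) nR≤) ⟩
      4 * ((Aₛ + Cₛ) * (n * n))                     ≡⟨ l5 Aₛ Cₛ (n * n) ⟩
      4 * (Aₛ * (n * n)) + 4 * Cₛ * (n * n)         ≤⟨ +-mono-≤ (*-monoʳ-≤ 4 A≤) (*-monoˡ-≤ (n * n) C≤) ⟩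
      4 * (R * R * (n ^ R * (n + d))) + n ^ R * (n * n) ≡⟨ l6 (R * R) (n ^ R) n d ⟩
      4 * (R * R) * (n * n ^ R) + n ^ R * (n * n) + 2 * n ^ R * (2 * (R * R) * d)
        ≤⟨ +-monoˡ-≤ _ (+-monoˡ-≤ (n ^ R * (n * n)) (*-monoˡ-≤ (n * n ^ R) 4RR≤n)) ⟩
      n * (n * n ^ R) + n ^ R * (n * n) + 2 * n ^ R * (2 * (R * R) * d) ≡⟨ l7 n (n ^ R) _ ⟩
      2 * (n ^ R * (n * n)) + 2 * n ^ R * (2 * (R * R) * d) ∎)
      where
      l4 : ∀ a b → 2 * (a * b) + 2 * a * b ≡ 4 * (a * b)
      l4 = solve-∀
      l5 : ∀ a c x → 4 * ((a + c) * x) ≡ 4 * (a * x) + 4 * c * x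
      l5 = solve-∀
      l6 : ∀ q y n d → 4 * (q * (y * (n + d))) + y * (n * n) ≡ 4 * q * (n * y) + y * (n * n) + 2 * y * (2 * q * d)
      l6 = solve-∀
      l7 : ∀ n y z → n * (n * y) + y * (n * n) + z ≡ 2 * (y * (n * n)) + z
      l7 = solve-∀

-- Random graphs

-- Both orders of a pair read the same coordinate of the random vector, which makes the random graph
-- symmetric.
code : Fin n → Fin n → Fin (n * n)
code x y = if x ≺ y then combine x y else combine y x

≺⇒< : (x y : Fin n) → (x ≺ y) ≡ true → toℕ x < toℕ y
≺⇒< x y = ≤ᵇ-true⁻ (suc (toℕ x)) (toℕ y)

code-sym : (x y : Fin n) → code x y ≡ code y x
code-sym x y with x ≺ y in e | y ≺ x in e′
... | true  | false = refl
... | false | true  = refl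
... | true  | true  = ⊥-elim (<-asym (≺⇒< x y e) (≺⇒< y x e′))
... | false | false = cong₂ combine (sym x≡y) x≡y
  where
  x≡y = FinP.toℕ-injective (≤-antisym (s≤s⁻¹ (≤ᵇ-false⁻ (suc (toℕ y)) (toℕ x) e′)) (s≤s⁻¹ (≤ᵇ-false⁻ (suc (toℕ x)) (toℕ y) e)))

code-injective : (x y u v : Fin n) → code x y ≡ code u v → (x ≡ u × y ≡ v) ⊎ (x ≡ v × y ≡ u)
code-injective x y u v e with x ≺ y | u ≺ v
... | true  | true  = inj₁ (FinP.combine-injective x y u v e)
... | true  | false = inj₂ (FinP.combine-injective x y v u e)
... | false | true  = let (a , b) = FinP.combine-injective y x u v e in inj₂ (b , a)
... | false | false = let (a , b) = FinP.combine-injective y x v u e in inj₁ (b , a)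

All-pairs : {P : A → Set} {Q : B → Set} (f : A → A → B) (xs : Vec A k) → VAll P xs →
  (∀ {u v} → P u → P v → Q (f u v)) → VAll Q (pairs f xs)
All-pairs f [] [] h = []
All-pairs f (x ∷ xs) (px ∷ pxs) h = VAllP.++⁺ (VAllP.map⁺ (VAll.map (h px) pxs)) (All-pairs f xs pxs h)

-- The pairs of a potential clique read different coordinates and are therefore independent as
-- edges.
codes-unique : (xs : Vec (Fin n) k) → Unique xs → Unique (pairs code xs)
codes-unique [] [] = []
codes-unique (x ∷ xs) (x∉ ∷ xs!) = VAllPairsP.++⁺ (VAllPairsP.map⁺ (row xs x∉ xs!)) (codes-unique xs xs!)
  (VAllP.map⁺ (VAll.map (λ {y} _ → All-pairs code xs x∉ (cross y)) x∉))
  where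
  row : ∀ {m} (ys : Vec (Fin _) m) → VAll (x ≢_) ys → Unique ys → VAllPairs (λ y z → code x y ≢ code x z) ys
  row [] [] [] = []
  row (y ∷ ys) (x≢y ∷ x∉ys) (y∉ ∷ ys!) = VAll.map differ y∉ ∷ row ys x∉ys ys!
    where
    differ : ∀ {z} → y ≢ z → code x y ≢ code x z
    differ {z} y≢z e with code-injective x y x z e
    ... | inj₁ (_ , y≡z) = y≢z y≡z
    ... | inj₂ (_ , y≡x) = x≢y (sym y≡x)
  cross : ∀ y {u v} → x ≢ u → x ≢ v → code x y ≢ code u v
  cross y {u} {v} x≢u x≢v e with code-injective x y u v e
  ... | inj₁ (x≡u , _) = x≢u x≡u
  ... | inj₂ (x≡v , _) = x≢v x≡v

allV≡allF : (p : A → Bool) (t : Vec A m) → allV p t ≡ allF (p ∘ lookup t)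
allV≡allF p [] = refl
allV≡allF p (x ∷ t) = cong (p x ∧_) (allV≡allF p t)

allV-mono : {p q : A → Bool} → (∀ v → p v ≡ true → q v ≡ true) → (t : Vec A m) → allV p t ≡ true → allV q t ≡ true
allV-mono h [] e = refl
allV-mono {p = p} h (x ∷ t) e with ∧-true⁻ {p x} e
... | px , pt rewrite h x px = allV-mono h t pt

𝟙-mono : ∀ {a b} → (a ≡ true → b ≡ true) → 𝟙 a ≤ 𝟙 b
𝟙-mono {false} h = z≤n
𝟙-mono {true} h rewrite h refl = ≤-refl

isClique : Fin m → Vec (Fin m) (n * n) → Vec (Fin n) k → Bool
isClique z g φ = injectiveᵇ φ ∧ allV (λ v → z == lookup g v) (pairs code φ)

cliqueCount : Fin m → ∀ n k → Vec (Fin m) (n * n) → ℕ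
cliqueCount z n k g = ∑ (vecs (fins n) k) (λ φ → 𝟙 (isClique z g φ))

∑-isClique : ∀ {q} (z : Fin q) (φ : Vec (Fin n) k) →
  ∑ (vecs (fins q) (n * n)) (λ g → 𝟙 (isClique z g φ)) * q ^ tri k ≤ q ^ (n * n)
∑-isClique {n} {k} {q} z φ with injectiveᵇ φ in e
... | false = ≤-trans (≤-reflexive (cong (_* q ^ tri k) (∑-zero (vecs (fins q) (n * n))))) z≤n
... | true = ≤-reflexive (trans
  (cong (_* q ^ tri k) (∑-cong (vecs (fins q) (n * n)) λ g → cong 𝟙 (allV≡allF (λ v → z == lookup g v) (pairs code φ))))
  (count-constrained (lookup (pairs code φ)) (λ {i} {j} → UniqueP.lookup-injective (codes-unique φ φ!) i j) (λ _ → z)))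
  where
  φ! : Unique φ
  φ! = subst Unique (tabulate∘lookup φ) (UniqueP.tabulate⁺ (injectiveᵇ⁻ φ e))

∑-cliqueCount : ∀ {q} (z : Fin q) n k →
  ∑ (vecs (fins q) (n * n)) (cliqueCount z n k) * q ^ tri k ≤ n ^ k * q ^ (n * n)
∑-cliqueCount {q} z n k = begin
  ∑ G (cliqueCount z n k) * q ^ tri k                          ≡⟨ cong (_* q ^ tri k) (∑-swap G Φ _) ⟩
  ∑ Φ (λ φ → ∑ G (λ g → 𝟙 (isClique z g φ))) * q ^ tri k       ≡⟨ ∑-*ʳ Φ (q ^ tri k) _ ⟨
  ∑ Φ (λ φ → ∑ G (λ g → 𝟙 (isClique z g φ)) * q ^ tri k)       ≤⟨ ∑-≤const Φ (q ^ (n * n)) (λ {φ} _ → ∑-isClique z φ) ⟩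
  length Φ * q ^ (n * n)
    ≡⟨ cong (_* q ^ (n * n)) (trans (length-vecs (fins n) k) (cong (_^ k) (length-fins n))) ⟩
  n ^ k * q ^ (n * n)                                          ∎
  where
  open ≤-Reasoning
  G = vecs (fins q) (n * n)
  Φ = vecs (fins n) k

-- The mean of 2^(-hits) is (1 - 1/2q)^|D|, which `decay` makes at most 2^(-h) once |D| ≥ 2qh; the
-- surplus of |D| over 2qh can only help.
∑-misses-weight-≤ : ∀ {q} (z : Fin q) (D : Fin N → Bool) h → 1 ≤ q → 2 * q * h ≤ ∑ (fins N) (𝟙 ∘ D) →
  ∑ (vecs (fins q) N) (misses-weight z D) * 2 ^ h ≤ (2 * q) ^ N
∑-misses-weight-≤ {N} {q} z D h 1≤q h≤ = *-cancelʳ-≤ _ _ (suc x ^ d) {{m^n≢0 (suc x) d}} (begin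
  W * 2 ^ h * suc x ^ d        ≡⟨ l1 W (2 ^ h) (suc x ^ d) ⟩
  W * suc x ^ d * 2 ^ h        ≡⟨ cong (_* 2 ^ h) (∑-misses-weight x z D sx) ⟩
  suc x ^ N * x ^ d * 2 ^ h    ≡⟨ l2 (suc x ^ N) (x ^ d) (2 ^ h) ⟩
  suc x ^ N * (2 ^ h * x ^ d)  ≤⟨ *-monoʳ-≤ (suc x ^ N) power ⟩
  suc x ^ N * suc x ^ d        ≡⟨ cong (λ s → s ^ N * suc x ^ d) sx ⟩
  (2 * q) ^ N * suc x ^ d      ∎)
  where
  open ≤-Reasoning
  x = pred (2 * q)
  sx : suc x ≡ 2 * q
  sx = suc-pred (2 * q) {{>-nonZero (*-mono-≤ {1} {2} (s≤s z≤n) 1≤q)}}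
  d = ∑ (fins N) (𝟙 ∘ D)
  W = ∑ (vecs (fins q) N) (misses-weight z D)
  l1 : ∀ a b c → a * b * c ≡ a * c * b
  l1 = solve-∀
  l2 : ∀ a b c → a * b * c ≡ a * (c * b)
  l2 = solve-∀
  e = d ∸ suc x * h
  d≡ : d ≡ suc x * h + e
  d≡ = sym (m+[n∸m]≡n (≤-trans (≤-reflexive (cong (_* h) sx)) h≤))
  power : 2 ^ h * x ^ d ≤ suc x ^ d
  power = begin
    2 ^ h * x ^ d                          ≡⟨ cong (λ s → 2 ^ h * x ^ s) d≡ ⟩
    2 ^ h * x ^ (suc x * h + e)            ≡⟨ cong (2 ^ h *_) (^-distribˡ-+-* x (suc x * h) e) ⟩
    2 ^ h * (x ^ (suc x * h) * x ^ e)      ≡⟨ *-assoc (2 ^ h) _ _ ⟨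
    2 ^ h * x ^ (suc x * h) * x ^ e        ≤⟨ *-mono-≤ (decay x h) (^-monoˡ-≤ e (n≤1+n x)) ⟩
    suc x ^ (suc x * h) * suc x ^ e        ≡⟨ ^-distribˡ-+-* (suc x) (suc x * h) e ⟨
    suc x ^ (suc x * h + e)                ≡⟨ cong (suc x ^_) d≡ ⟨
    suc x ^ d                              ∎

-- Markov's inequality for the number of cliques and Chernoff's for every D, in one union bound.
sparse-but-hitting : ∀ {q} (z : Fin q) n k (Ds : List A) (U : A → Fin (n * n) → Bool) h t → 1 ≤ q → 1 ≤ t →
  2 * n ^ k ≤ t * q ^ tri k → 4 * (2 ^ t * length Ds) ≤ 2 ^ h →
  (∀ {D} → D ∈ Ds → 2 * q * h ≤ ∑ (fins (n * n)) (𝟙 ∘ U D)) →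
  ∃ λ g → cliqueCount z n k g < t × (∀ {D} → D ∈ Ds → t < hits z (U D) g)
sparse-but-hitting {q = q} z n k Ds U h t 1≤q 1≤t cliques-few Ds-few Ds-big =
  let (g , _ , Fg<) = ∃-below-average G F (t * 2 ^ M) ∑F<
  in g , *-cancelʳ-< _ _ _ (≤-<-trans (m≤m+n _ _) Fg<) , λ D∈ → hitting g Fg< D∈
  where
  open ≤-Reasoning
  M = n * n
  G = vecs (fins q) M
  Wg : Vec (Fin q) M → ℕ
  Wg g = ∑ Ds (λ D → misses-weight z (U D) g)
  -- F g < t 2^M yields both demands: the first summand forces fewer than t cliques, the second 2^(t
  -- - hits) < 1 for every D. On average the first is at most 1/2 and the second at most 1/4 of t
  -- 2^M.
  F : Vec (Fin q) M → ℕ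
  F g = cliqueCount z n k g * 2 ^ M + t * (2 ^ t * Wg g)
  hitting : ∀ g → F g < t * 2 ^ M → ∀ {D} → D ∈ Ds → t < hits z (U D) g
  hitting g Fg< {D} D∈ = ≰⇒> λ hits≤t → <⇒≱ small (begin
    2 ^ M                                                  ≡⟨ misses-weight-hits z (U D) g ⟨
    misses-weight z (U D) g * 2 ^ hits z (U D) g           ≤⟨ *-monoʳ-≤ (misses-weight z (U D) g) (^-monoʳ-≤ 2 hits≤t) ⟩
    misses-weight z (U D) g * 2 ^ t                        ≡⟨ *-comm (misses-weight z (U D) g) _ ⟩
    2 ^ t * misses-weight z (U D) g                        ≤⟨ *-monoʳ-≤ (2 ^ t) (term≤∑ (λ D → misses-weight z (U D) g) D∈) ⟩
    2 ^ t * Wg g                                           ∎)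
    where
    small : 2 ^ t * Wg g < 2 ^ M
    small = *-cancelˡ-< t _ _ (≤-<-trans (m≤n+m _ _) Fg<)
  X = ∑ G (cliqueCount z n k)
  W = ∑ G Wg
  2X≤ : 2 * X ≤ t * q ^ M
  2X≤ = *-cancelʳ-≤ _ _ (q ^ tri k) {{m^n≢0 q (tri k) {{>-nonZero 1≤q}}}} (begin
    2 * X * q ^ tri k           ≡⟨ *-assoc 2 X _ ⟩
    2 * (X * q ^ tri k)         ≤⟨ *-monoʳ-≤ 2 (∑-cliqueCount z n k) ⟩
    2 * (n ^ k * q ^ M)         ≡⟨ *-assoc 2 (n ^ k) _ ⟨
    2 * n ^ k * q ^ M           ≤⟨ *-monoˡ-≤ (q ^ M) cliques-few ⟩
    t * q ^ tri k * q ^ M       ≡⟨ l1 t (q ^ tri k) (q ^ M) ⟩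
    t * q ^ M * q ^ tri k       ∎)
    where
    l1 : ∀ a b c → a * b * c ≡ a * c * b
    l1 = solve-∀
  W≤ : W * 2 ^ h ≤ length Ds * (2 * q) ^ M
  W≤ = begin
    W * 2 ^ h                                                  ≡⟨ cong (_* 2 ^ h) (∑-swap G Ds _) ⟩
    ∑ Ds (λ D → ∑ G (misses-weight z (U D))) * 2 ^ h           ≡⟨ ∑-*ʳ Ds (2 ^ h) _ ⟨
    ∑ Ds (λ D → ∑ G (misses-weight z (U D)) * 2 ^ h)
      ≤⟨ ∑-≤const Ds ((2 * q) ^ M) (λ {D} D∈ → ∑-misses-weight-≤ z (U D) h 1≤q (Ds-big D∈)) ⟩
    length Ds * (2 * q) ^ M                                    ∎
  4W≤ : 4 * (2 ^ t * W) ≤ (2 * q) ^ M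
  4W≤ = *-cancelʳ-≤ _ _ (2 ^ h) {{m^n≢0 2 h}} (begin
    4 * (2 ^ t * W) * 2 ^ h               ≡⟨ l1 (2 ^ t) W (2 ^ h) ⟩
    4 * (2 ^ t * (W * 2 ^ h))             ≤⟨ *-monoʳ-≤ 4 (*-monoʳ-≤ (2 ^ t) W≤) ⟩
    4 * (2 ^ t * (length Ds * (2 * q) ^ M)) ≡⟨ l2 (2 ^ t) (length Ds) ((2 * q) ^ M) ⟩
    (2 * q) ^ M * (4 * (2 ^ t * length Ds)) ≤⟨ *-monoʳ-≤ ((2 * q) ^ M) Ds-few ⟩
    (2 * q) ^ M * 2 ^ h                   ∎)
    where
    l1 : ∀ a b c → 4 * (a * b) * c ≡ 4 * (a * (b * c))
    l1 = solve-∀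
    l2 : ∀ a b c → 4 * (a * (b * c)) ≡ c * (4 * (a * b))
    l2 = solve-∀
  ∑F≡ : ∑ G F ≡ X * 2 ^ M + t * (2 ^ t * W)
  ∑F≡ = trans (∑-+ G _ _) (cong₂ _+_ (∑-*ʳ G (2 ^ M) _)
    (trans (∑-*ˡ G t _) (cong (t *_) (∑-*ˡ G (2 ^ t) _))))
  Y = t * (q ^ M * 2 ^ M)
  1≤Y : 1 ≤ Y
  1≤Y = *-mono-≤ 1≤t (*-mono-≤ (m^n>0 q {{>-nonZero 1≤q}} M) (m^n>0 2 M))
  ∑F< : ∑ G F < length G * (t * 2 ^ M)
  ∑F< = *-cancelˡ-< 4 _ _ (begin-strict
    4 * ∑ G F                                            ≡⟨ cong (4 *_) ∑F≡ ⟩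
    4 * (X * 2 ^ M + t * (2 ^ t * W))                    ≡⟨ l3 X (2 ^ M) t (2 ^ t * W) ⟩
    2 * (2 * X * 2 ^ M) + t * (4 * (2 ^ t * W))
      ≤⟨ +-mono-≤ (*-monoʳ-≤ 2 (*-monoˡ-≤ (2 ^ M) 2X≤)) (*-monoʳ-≤ t 4W≤) ⟩
    2 * (t * q ^ M * 2 ^ M) + t * (2 * q) ^ M
      ≡⟨ cong (λ s → 2 * (t * q ^ M * 2 ^ M) + t * s) (^-distribʳ-* M 2 q) ⟩
    2 * (t * q ^ M * 2 ^ M) + t * (2 ^ M * q ^ M)        ≡⟨ l4 t (q ^ M) (2 ^ M) ⟩
    3 * Y                                                <⟨ +-monoˡ-≤ (3 * Y) 1≤Y ⟩
    4 * Y                                                ≡⟨ cong (4 *_) (l5 t (q ^ M) (2 ^ M)) ⟩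
    4 * (q ^ M * (t * 2 ^ M))
      ≡⟨ cong (λ s → 4 * (s * (t * 2 ^ M))) (trans (length-vecs (fins q) M) (cong (_^ M) (length-fins q))) ⟨
    4 * (length G * (t * 2 ^ M))                         ∎)
    where
    l3 : ∀ X p t w → 4 * (X * p + t * w) ≡ 2 * (2 * X * p) + t * (4 * w)
    l3 = solve-∀
    l4 : ∀ t q p → 2 * (t * q * p) + t * (p * q) ≡ 3 * (t * (q * p))
    l4 = solve-∀
    l5 : ∀ t q p → t * (q * p) ≡ q * (t * p)
    l5 = solve-∀

-- The altered graph and the containers of its colour classes

any≡true⁺ : (p : A → Bool) (xs : List A) {x : A} → x ∈ xs → p x ≡ true → any p xs ≡ true
any≡true⁺ p xs {x} x∈ h with any p xs in e
... | true = refl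
... | false = trans (sym (any≡false⁻ p xs e x∈)) h

search : (xs : List A) (ys : List B) (p : A → B → Bool) →
  (∃ λ x → ∃ λ y → p x y ≡ true) ⊎ (∀ x y → x ∈ xs → y ∈ ys → p x y ≡ false)
search [] ys p = inj₂ λ _ _ ()
search (x ∷ xs) ys p with any-or-none ys (p x) | search xs ys p
... | inj₁ (y , _ , h) | _ = inj₁ (x , y , h)
... | inj₂ _ | inj₁ found = inj₁ found
... | inj₂ none | inj₂ none′ = inj₂ λ { _ _ (here refl) y∈ → none y∈ ; _ _ (there x∈) y∈ → none′ _ _ x∈ y∈ }

∑𝟙<⇒∃ : (xs : List A) (p q : A → Bool) → ∑ xs (𝟙 ∘ p) < ∑ xs (𝟙 ∘ q) → ∃ λ x → x ∈ xs × q x ≡ true × p x ≡ false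
∑𝟙<⇒∃ xs p q h with any-or-none xs (λ x → q x ∧ not (p x))
... | inj₁ (x , x∈ , e) = let (qx , npx) = ∧-true⁻ {q x} e in x , x∈ , qx , not-true⁻ npx
... | inj₂ none = ⊥-elim (<⇒≱ h (∑-mono-∈ xs λ x∈ → 𝟙-mono (implies (none x∈))))
  where
  implies : ∀ {a b} → a ∧ not b ≡ false → a ≡ true → b ≡ true
  implies {true} {true} _ _ = refl

rowOf colOf : ∀ n → Fin (n * n) → Fin n
rowOf n v = proj₁ (remQuot {n} n v)
colOf n v = proj₂ (remQuot {n} n v)

rowOf-combine : (x y : Fin n) → rowOf n (combine x y) ≡ x
rowOf-combine x y = cong proj₁ (FinP.remQuot-combine x y)

colOf-combine : (x y : Fin n) → colOf n (combine x y) ≡ y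
colOf-combine x y = cong proj₂ (FinP.remQuot-combine x y)

swap : ∀ n → Fin (n * n) → Fin (n * n)
swap n v = combine (colOf n v) (rowOf n v)

swap-combine : (x y : Fin n) → swap n (combine x y) ≡ combine y x
swap-combine x y = cong₂ combine (colOf-combine x y) (rowOf-combine x y)

-- A container of ordered pairs need not be symmetric, but colour classes are, so they also lie in
-- its intersection with its transpose. Supersaturation asks for this symmetry.
shadow : ∀ n → Vec (Fin (n * n) → Bool) r → Fin r → Fin (n * n) → Bool
shadow n Cs c v = lookup Cs c v ∧ lookup Cs c (swap n v)

shadow-sym : (Cs : Vec (Fin (n * n) → Bool) r) → ∀ c (x y : Fin n) → shadow n Cs c (combine x y) ≡ shadow n Cs c (combine y x)
shadow-sym {n} Cs c x y = begin
  L (combine x y) ∧ L (swap n (combine x y)) ≡⟨ cong (λ v → L (combine x y) ∧ L v) (swap-combine x y) ⟩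
  L (combine x y) ∧ L (combine y x)          ≡⟨ ∧-comm (L (combine x y)) (L (combine y x)) ⟩
  L (combine y x) ∧ L (combine x y)          ≡⟨ cong (λ v → L (combine y x) ∧ L v) (swap-combine y x) ⟨
  L (combine y x) ∧ L (swap n (combine y x)) ∎
  where
  open ≡-Reasoning
  L = lookup Cs c

leftover : ∀ n → Vec (Fin (n * n) → Bool) r → Fin (n * n) → Bool
leftover n Cs v = uncovered (shadow n Cs) (rowOf n v) (colOf n v)

leftover-combine : (Cs : Vec (Fin (n * n) → Bool) r) (x y : Fin n) → leftover n Cs (combine x y) ≡ uncovered (shadow n Cs) x y
leftover-combine {n} Cs x y = cong₂ (uncovered (shadow n Cs)) (rowOf-combine x y) (colOf-combine x y)

∈-vecs⁻ : {xs : List A} {v : Vec A m} → v ∈ vecs xs m → ∀ i → lookup v i ∈ xs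
∈-vecs⁻ {m = suc m} {xs} {v} v∈ i = go xs v∈ i id
  where
  go : ∀ ys → v ∈ List.concatMap (λ x → map (x ∷_) (vecs xs m)) ys → ∀ i → (∀ {x} → x ∈ ys → x ∈ xs) → lookup v i ∈ xs
  go (x ∷ ys) v∈ i sub with ∈-++⁻ (map (x ∷_) (vecs xs m)) v∈
  ... | inj₂ v∈′ = go ys v∈′ i (sub ∘ there)
  ... | inj₁ v∈′ with ∈-map⁻ (x ∷_) v∈′
  go (x ∷ ys) v∈ zero sub    | inj₁ _ | _ , _ , refl = sub (here refl)
  go (x ∷ ys) v∈ (suc i) sub | inj₁ _ | _ , v∈″ , refl = ∈-vecs⁻ v∈″ i

module RandomGraph {q n k : ℕ} (z : Fin q) (g : Vec (Fin q) (n * n)) where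

  Φ : List (Vec (Fin n) (suc (suc k)))
  Φ = vecs (fins n) (suc (suc k))

  firstEdge : Vec (Fin n) (suc (suc k)) → Fin (n * n)
  firstEdge φ = code (lookup φ zero) (lookup φ (suc zero))

  removed : Fin (n * n) → Bool
  removed v = any (λ φ → isClique z g φ ∧ (firstEdge φ == v)) Φ

  ∑-removed : ∑ (fins (n * n)) (𝟙 ∘ removed) ≤ cliqueCount z n (suc (suc k)) g
  ∑-removed = begin
    ∑ V (𝟙 ∘ removed)
      ≤⟨ ∑-mono V (λ v → 𝟙-any≤∑ (λ φ → isClique z g φ ∧ (firstEdge φ == v)) Φ) ⟩
    ∑ V (λ v → ∑ Φ (λ φ → 𝟙 (isClique z g φ ∧ (firstEdge φ == v))))       ≡⟨ ∑-swap V Φ _ ⟩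
    ∑ Φ (λ φ → ∑ V (λ v → 𝟙 (isClique z g φ ∧ (firstEdge φ == v))))       ≤⟨ ∑-mono Φ one ⟩
    ∑ Φ (λ φ → 𝟙 (isClique z g φ))                                       ∎
    where
    open ≤-Reasoning
    V = fins (n * n)
    one : ∀ φ → ∑ V (λ v → 𝟙 (isClique z g φ ∧ (firstEdge φ == v))) ≤ 𝟙 (isClique z g φ)
    one φ with isClique z g φ
    ... | false = ≤-reflexive (∑-zero V)
    ... | true  = ≤-reflexive (∑-δ1 (firstEdge φ))

  edge : Fin n → Fin n → Bool
  edge x y = not (x == y) ∧ ((z == lookup g (code x y)) ∧ not (removed (code x y)))

  -- Alteration: the edge firstEdge φ of every clique φ is deleted.
  graph : Graph n
  graph = record
    { adj = edge
    ; adj-sym = λ x y → cong₂ (λ b v → not b ∧ ((z == lookup g v) ∧ not (removed v))) (==-sym x y) (code-sym x y)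
    ; adj-irrefl = λ x → cong (λ b → not b ∧ ((z == lookup g (code x x)) ∧ not (removed (code x x)))) (==-refl x) }

  clique-free : ¬ ContainsClique graph (suc (suc k))
  clique-free (f , f-inj , f-adj) = true≢false (trans (sym is-removed) not-removed)
    where
    φ = tabulate f
    lk : ∀ i → lookup φ i ≡ f i
    lk = lookup∘tabulate f
    edge-at : ∀ {i j} → i ≢ j → (z == lookup g (code (lookup φ i) (lookup φ j))) ∧ not (removed (code (lookup φ i) (lookup φ j))) ≡ true
    edge-at {i} {j} i≢j rewrite lk i | lk j = proj₂ (∧-true⁻ {not (f i == f j)} (f-adj i j i≢j))
    clique : isClique z g φ ≡ true
    clique = cong₂ _∧_
      (injectiveᵇ⁺ φ λ {i} {j} e → f-inj (trans (sym (lk i)) (trans e (lk j))))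
      (allV-pairs⁺ (λ v → z == lookup g v) code φ λ {i} {j} i<j → proj₁ (∧-true⁻ (edge-at (FinP.<⇒≢ i<j))))
    not-removed : removed (firstEdge φ) ≡ false
    not-removed = not-true⁻ (proj₂ (∧-true⁻ {z == lookup g (firstEdge φ)} (edge-at {zero} {suc zero} λ ())))
    is-removed : removed (firstEdge φ) ≡ true
    is-removed = any≡true⁺ _ Φ (∈-vecs-fins φ) (cong₂ _∧_ clique (==-refl (firstEdge φ)))

  module Colouring {r : ℕ} (col : Fin n → Fin n → Fin r) (col-sym : IsEdgeColouring r col) where

    inColour : Fin r → Fin (n * n) → Bool
    inColour c v = edge (rowOf n v) (colOf n v) ∧ (col (rowOf n v) (colOf n v) == c)

    inColour-combine : ∀ c (x y : Fin n) → inColour c (combine x y) ≡ edge x y ∧ (col x y == c)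
    inColour-combine c x y = cong₂ (λ x y → edge x y ∧ (col x y == c)) (rowOf-combine x y) (colOf-combine x y)

    monochromatic : ∀ {m} c (φ : Vec (Fin n) m) → allV (inColour c) (pairs combine φ) ≡ true → HasMonoClique graph m r col
    monochromatic c φ h = c , lookup φ , inj , mono-≢
      where
      mono-≺ : ∀ {i j} → i Fin.< j → edge (lookup φ i) (lookup φ j) ≡ true × col (lookup φ i) (lookup φ j) ≡ c
      mono-≺ {i} {j} i<j =
        let (e , h) = ∧-true⁻ {edge (lookup φ i) (lookup φ j)} (trans (sym (inColour-combine c (lookup φ i) (lookup φ j))) (allV-pairs⁻ (inColour c) combine φ h i<j))
        in e , ==⇒≡ _ _ h
      mono-≢ : ∀ i j → i ≢ j → edge (lookup φ i) (lookup φ j) ≡ true × col (lookup φ i) (lookup φ j) ≡ c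
      mono-≢ i j i≢j with FinP.<-cmp i j
      ... | tri< i<j _ _ = mono-≺ i<j
      ... | tri≈ _ i≡j _ = ⊥-elim (i≢j i≡j)
      ... | tri> _ _ j<i = let (e , h) = mono-≺ j<i in
        trans (adj-sym graph (lookup φ i) (lookup φ j)) e , trans (col-sym (lookup φ i) (lookup φ j)) h
      inj : Injective _≡_ _≡_ (lookup φ)
      inj {i} {j} e with i Fin.≟ j
      ... | yes i≡j = i≡j
      ... | no i≢j = ⊥-elim (true≢false (trans (sym (proj₁ (mono-≢ i j i≢j)))
        (trans (cong (λ y → edge y (lookup φ j)) e) (adj-irrefl graph (lookup φ j)))))

    mono-or-independent : ∀ m → HasMonoClique graph m r col ⊎ (∀ c → Independent (inColour c) (cliques n m))
    mono-or-independent m =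
      [ (λ { (c , φ , h) → inj₁ (monochromatic c φ h) }) , (λ none → inj₂ λ c {t} t∈ → independent c none (∈-map⁻ (pairs combine) t∈)) ]′
        (search (fins r) (vecs (fins n) m) (λ c φ → allV (inColour c) (pairs combine φ)))
      where
      independent : ∀ c → (∀ c φ → c ∈ fins r → φ ∈ vecs (fins n) m → allV (inColour c) (pairs combine φ) ≡ false) →
        ∀ {t} → (∃ λ φ → φ ∈ vecs (fins n) m × t ≡ pairs combine φ) → allV (inColour c) t ≡ false
      independent c none (φ , φ∈ , refl) = none c φ (∈-fins c) φ∈

    -- Fewer edges are deleted than random edges fall on leftover pairs, so some leftover pair
    -- survives as an edge. Its colour class contains it in both orders, hence so does the container
    -- of that colour, and the pair was covered after all.
    not-all-covered : (Cs : Vec (Fin (n * n) → Bool) r) → (∀ c v → inColour c v ≡ true → lookup Cs c v ≡ true) →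
      ¬ (cliqueCount z n (suc (suc k)) g < hits z (leftover n Cs) g)
    not-all-covered Cs covers few = true≢false (trans (sym shadowed) not-shadowed)
      where
      survivor = ∑𝟙<⇒∃ (fins (n * n)) removed (λ v → leftover n Cs v ∧ (z == lookup g v)) (≤-<-trans ∑-removed few)
      v = proj₁ survivor
      v-hit = proj₁ (proj₂ (proj₂ survivor))
      x = rowOf n v
      y = colOf n v
      U-v : uncovered (shadow n Cs) x y ≡ true
      U-v = proj₁ (∧-true⁻ {leftover n Cs v} v-hit)
      x≺y : (x ≺ y) ≡ true
      x≺y = proj₁ (∧-true⁻ {x ≺ y} U-v)
      code-xy : code x y ≡ v
      code-xy = trans (cong (if_then combine x y else combine y x) x≺y) (FinP.combine-remQuot {n} n v)
      not-equal : (d : Dec (x ≡ y)) → not (does d) ≡ true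
      not-equal (yes e) = ⊥-elim (<-irrefl (cong toℕ e) (≺⇒< x y x≺y))
      not-equal (no _) = refl
      is-edge : edge x y ≡ true
      is-edge = cong₂ _∧_ (not-equal (x Fin.≟ y)) (trans (cong (λ w → (z == lookup g w) ∧ not (removed w)) code-xy)
        (cong₂ _∧_ (proj₂ (∧-true⁻ {leftover n Cs v} v-hit)) (cong not (proj₂ (proj₂ (proj₂ survivor))))))
      c = col x y
      in-C : ∀ x′ y′ → edge x′ y′ ≡ true → col x′ y′ ≡ c → lookup Cs c (combine x′ y′) ≡ true
      in-C x′ y′ e col≡ = covers c (combine x′ y′)
        (trans (inColour-combine c x′ y′) (cong₂ _∧_ e (trans (cong (_== c) col≡) (==-refl c))))
      shadowed : shadow n Cs c (combine x y) ≡ true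
      shadowed = cong₂ _∧_ (in-C x y is-edge refl)
        (trans (cong (lookup Cs c) (swap-combine x y)) (in-C y x (trans (adj-sym graph y x) is-edge) (col-sym y x)))
      not-shadowed : shadow n Cs c (combine x y) ≡ false
      not-shadowed = not-true⁻ (allF⁻ (λ c → not (shadow n Cs c (combine x y))) (proj₂ (∧-true⁻ {x ≺ y} U-v)) c)

  graph-arrows : ∀ {m r} (𝒞 : List (Fin (n * n) → Bool)) →
    (∀ I → Independent I (cliques n m) → ∃ λ C → C ∈ 𝒞 × (∀ v → I v ≡ true → C v ≡ true)) →
    (∀ {Cs} → Cs ∈ vecs 𝒞 r → cliqueCount z n (suc (suc k)) g < hits z (leftover n Cs) g) →
    Arrows graph m r
  graph-arrows {m} {r} 𝒞 covers hitting col col-sym = [ id , impossible ]′ (mono-or-independent m)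
    where
    open Colouring col col-sym
    impossible : (∀ c → Independent (inColour c) (cliques n m)) → HasMonoClique graph m r col
    impossible independent = ⊥-elim (not-all-covered Cs
      (λ c v Iv → trans (cong (λ C → C v) (lk c)) (proj₂ (proj₂ (container c)) v Iv)) (hitting Cs∈))
      where
      container : ∀ c → ∃ λ C → C ∈ 𝒞 × (∀ v → inColour c v ≡ true → C v ≡ true)
      container c = covers (inColour c) (independent c)
      Cs : Vec (Fin (n * n) → Bool) r
      Cs = tabulate (proj₁ ∘ container)
      lk : ∀ c → lookup Cs c ≡ proj₁ (container c)
      lk = lookup∘tabulate (proj₁ ∘ container)
      Cs∈ : Cs ∈ vecs 𝒞 r
      Cs∈ = ∈-vecs Cs λ c → subst (_∈ 𝒞) (sym (lk c)) (proj₁ (proj₂ (container c)))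

-- `t` limits the deleted edges and 2^h is the budget of the union bound. The last three hypotheses
-- are Markov's bound for the (k+2)-cliques, the union bound over (r+1)-tuples of containers, and
-- the requirement that the n^2 / 2R^2 uncovered pairs number at least 2qh.
folkman-graph : ∀ {n q k r R h t} (𝒞 : List (Fin (n * n) → Bool)) → 1 ≤ q → 1 ≤ t → 1 ≤ R → 4 * (R * R) ≤ n →
  Arrows (K R) (suc k) (suc r) →
  (∀ {C} → C ∈ 𝒞 → length (filterᵇ (allV C) (cliques n (suc k))) * (4 * (suc r * R ^ suc k)) ≤ length (cliques n (suc k))) →
  (∀ I → Independent I (cliques n (suc k)) → ∃ λ C → C ∈ 𝒞 × (∀ v → I v ≡ true → C v ≡ true)) →
  2 * n ^ suc (suc k) ≤ t * q ^ tri (suc (suc k)) →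
  4 * (2 ^ t * length 𝒞 ^ suc r) ≤ 2 ^ h →
  2 * (R * R) * (2 * q * h) ≤ n * n →
  Σ (Graph n) λ G → IsFolkman G (suc k) (suc r)
folkman-graph {n} {q@(suc _)} {k} {r} {R} {h} {t} 𝒞 1≤q 1≤t 1≤R 4RR≤n arrows small covers cliques-few 𝒞-few h-small =
  let (g , sparse , hitting) = chosen
      open RandomGraph {n = n} {k = k} z g
  in graph , graph-arrows 𝒞 covers (λ Cs∈ → <-trans sparse (hitting Cs∈)) , clique-free
  where
  z : Fin q
  z = zero

  𝒞s = vecs 𝒞 (suc r)

  U-big : ∀ {Cs} → Cs ∈ 𝒞s → 2 * q * h ≤ ∑ (fins (n * n)) (𝟙 ∘ leftover n Cs)
  U-big {Cs} Cs∈ = *-cancelˡ-≤ (2 * (R * R)) {{>-nonZero (*-mono-≤ {1} {2} (s≤s z≤n) (*-mono-≤ 1≤R 1≤R))}} (begin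
    2 * (R * R) * (2 * q * h)   ≤⟨ h-small ⟩
    n * n                       ≤⟨ supersaturation (shadow n Cs) (shadow-sym Cs) arrows 1≤R 4RR≤n few ⟩
    2 * (R * R) * ∑ (fins n) (λ x → ∑ (fins n) (λ y → 𝟙 (uncovered (shadow n Cs) x y)))
      ≡⟨ cong (2 * (R * R) *_) (trans (∑-cong (fins n) λ x → ∑-cong (fins n) λ y → cong 𝟙 (sym (leftover-combine Cs x y))) (∑-combine n n (𝟙 ∘ leftover n Cs))) ⟩
    2 * (R * R) * ∑ (fins (n * n)) (𝟙 ∘ leftover n Cs) ∎)
    where
    open ≤-Reasoning
    few : ∀ c → ∑ (vecs (fins n) (suc k)) (λ φ → 𝟙 (allV (shadow n Cs c) (pairs combine φ))) * (4 * (suc r * R ^ suc k)) ≤ n ^ suc k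
    few c = begin
      ∑ (vecs (fins n) (suc k)) (λ φ → 𝟙 (allV (shadow n Cs c) (pairs combine φ))) * E
        ≤⟨ *-monoˡ-≤ E (∑-mono (vecs (fins n) (suc k)) λ φ → 𝟙-mono (allV-mono (λ v → proj₁ ∘ ∧-true⁻ {lookup Cs c v}) (pairs combine φ))) ⟩
      ∑ (vecs (fins n) (suc k)) (λ φ → 𝟙 (allV (lookup Cs c) (pairs combine φ))) * E
        ≡⟨ cong (_* E) (∑-map (pairs combine) (vecs (fins n) (suc k)) _) ⟨
      ∑ (cliques n (suc k)) (λ e → 𝟙 (allV (lookup Cs c) e)) * E
        ≡⟨ cong (_* E) (length-filter-∑ (allV (lookup Cs c)) (cliques n (suc k))) ⟨
      length (filterᵇ (allV (lookup Cs c)) (cliques n (suc k))) * E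
        ≤⟨ small (∈-vecs⁻ Cs∈ c) ⟩
      length (cliques n (suc k)) ≡⟨ length-cliques n (suc k) ⟩
      n ^ suc k ∎
      where E = 4 * (suc r * R ^ suc k)

  chosen : ∃ λ g → cliqueCount z n (suc (suc k)) g < t × (∀ {Cs} → Cs ∈ 𝒞s → t < hits z (leftover n Cs) g)
  chosen = sparse-but-hitting z n (suc (suc k)) 𝒞s (leftover n) h t 1≤q 1≤t cliques-few
    (≤-trans (≤-reflexive (cong (λ l → 4 * (2 ^ t * l)) (length-vecs 𝒞 (suc r)))) 𝒞-few) U-big

-- Ramsey numbers

minF : Fin n → Fin n → Fin n
minF i j = if i ≺ j then i else j

minF-sel : (i j : Fin n) → minF i j ≡ i ⊎ minF i j ≡ j
minF-sel i j with i ≺ j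
... | true  = inj₁ refl
... | false = inj₂ refl

minF-comm : (i j : Fin n) → minF i j ≡ minF j i
minF-comm i j with i ≺ j in e | j ≺ i in e′
... | true  | false = refl
... | false | true  = refl
... | true  | true  = ⊥-elim (<-asym (≺⇒< i j e) (≺⇒< j i e′))
... | false | false = FinP.toℕ-injective (≤-antisym (s≤s⁻¹ (≤ᵇ-false⁻ (suc (toℕ i)) (toℕ j) e)) (s≤s⁻¹ (≤ᵇ-false⁻ (suc (toℕ j)) (toℕ i) e′)))

-- With R ≤ r colours available, colouring ij by min(i, j) leaves no monochromatic triangle.
arrows⇒r<R : 3 ≤ k → Arrows (K R) k r → r < R
arrows⇒r<R {k} {R} {r} 3≤k arrows = ≰⇒> λ R≤r → triangle-free R≤r (arrows (col R≤r) λ i j → cong (λ x → Fin.inject≤ x R≤r) (minF-comm i j))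
  where
  col : R ≤ r → Fin R → Fin R → Fin r
  col R≤r i j = Fin.inject≤ (minF i j) R≤r
  triangle-free : (R≤r : R ≤ r) → ¬ HasMonoClique (K R) k r (col R≤r)
  -- The colour of edge 01 is one of its ends. The triangle edge that avoids this end has one of its
  -- own ends as colour, so the two colours differ.
  triangle-free R≤r (c , φ , φ-inj , mono) = [ case-a , case-b ]′ (minF-sel (f 0F) (f 1F))
    where
    ι : Fin 3 → Fin k
    ι i = Fin.inject≤ i 3≤k
    f : Fin 3 → Fin R
    f = φ ∘ ι
    f-≢ : ∀ {i j} → i ≢ j → f i ≢ f j
    f-≢ i≢j e = i≢j (FinP.inject≤-injective 3≤k 3≤k _ _ (φ-inj e))
    same : ∀ {i j i′ j′} → i ≢ j → i′ ≢ j′ → minF (f i) (f j) ≡ minF (f i′) (f j′)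
    same {i} {j} {i′} {j′} i≢j i′≢j′ = FinP.inject≤-injective R≤r R≤r _ _
      (trans (proj₂ (mono (ι i) (ι j) (i≢j ∘ FinP.inject≤-injective 3≤k 3≤k i j)))
        (sym (proj₂ (mono (ι i′) (ι j′) (i′≢j′ ∘ FinP.inject≤-injective 3≤k 3≤k i′ j′)))))
    case-a : minF (f 0F) (f 1F) ≢ f 0F
    case-a e = [ (λ e′ → f-≢ {0F} {1F} (λ ()) (trans (sym e) (trans (same {0F} {1F} {1F} {2F} (λ ()) (λ ())) e′)))
               , (λ e′ → f-≢ {0F} {2F} (λ ()) (trans (sym e) (trans (same {0F} {1F} {1F} {2F} (λ ()) (λ ())) e′))) ]′ (minF-sel (f 1F) (f 2F))
    case-b : minF (f 0F) (f 1F) ≢ f 1F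
    case-b e = [ (λ e′ → f-≢ {1F} {0F} (λ ()) (trans (sym e) (trans (same {0F} {1F} {0F} {2F} (λ ()) (λ ())) e′)))
               , (λ e′ → f-≢ {1F} {2F} (λ ()) (trans (sym e) (trans (same {0F} {1F} {0F} {2F} (λ ()) (λ ())) e′))) ]′ (minF-sel (f 0F) (f 2F))

-- Upper bound for the Ramsey number

AllPairs-filterᵇ : {P : A → A → Set} (p : A → Bool) {xs : List A} →
  LAllPairs.AllPairs P xs → LAllPairs.AllPairs P (filterᵇ p xs)
AllPairs-filterᵇ p [] = []
AllPairs-filterᵇ p {x ∷ xs} (px ∷ pxs) with p x
... | true  = LAll.tabulate (λ y∈ → LAll.lookup px (proj₁ (∈-filterᵇ⁻ p xs y∈))) ∷ AllPairs-filterᵇ p pxs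
... | false = AllPairs-filterᵇ p pxs

AllPairs-lookup : {P : A → A → Set} {xs : List A} → LAllPairs.AllPairs P xs → ∀ {i j} → i Fin.< j →
  P (List.lookup xs i) (List.lookup xs j)
AllPairs-lookup (px ∷ pxs) {zero} {suc j} _ = LAll.lookup px (∈-lookup j)
AllPairs-lookup (px ∷ pxs) {suc i} {suc j} (s≤s i<j) = AllPairs-lookup pxs i<j

fins-unique : ∀ n → LAllPairs.AllPairs _≢_ (fins n)
fins-unique zero = []
fins-unique (suc n) = LAllP.map⁺ (LAll.tabulate λ _ ()) ∷ LAllPairsP.map⁺ (LAllPairs.map (λ i≢j → i≢j ∘ FinP.suc-injective) (fins-unique n))

∑-classes : ∀ {r} (f : A → Fin r) (xs : List A) →
  ∑ (fins r) (λ c → length (filterᵇ (λ x → f x == c) xs)) ≡ length xs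
∑-classes {r = r} f xs = begin
  ∑ (fins r) (λ c → length (filterᵇ (λ x → f x == c) xs)) ≡⟨ ∑-cong (fins r) (λ c → length-filter-∑ _ xs) ⟩
  ∑ (fins r) (λ c → ∑ xs (λ x → 𝟙 (f x == c)))           ≡⟨ ∑-swap (fins r) xs _ ⟩
  ∑ xs (λ x → ∑ (fins r) (λ c → 𝟙 (f x == c)))           ≡⟨ ∑-cong xs (λ x → ∑-δ1 (f x)) ⟩
  ∑ xs (λ _ → 1)                                         ≡⟨ length-∑ xs ⟨
  length xs                                              ∎
  where open ≡-Reasoning

-- The hypothesis is r (s - 1) < |xs| without subtraction. If every class had fewer than s members,
-- then adding 1 to each of the r classes would contradict it.
pigeonhole : ∀ {r} (f : A → Fin r) (xs : List A) s → r * s < length xs + r →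
  ∃ λ c → s ≤ length (filterᵇ (λ x → f x == c) xs)
pigeonhole {r = r} f xs s h with any-or-none (fins r) (λ c → s ≤ᵇ length (filterᵇ (λ x → f x == c) xs))
... | inj₁ (c , _ , e) = c , ≤ᵇ-true⁻ s _ e
... | inj₂ none = ⊥-elim (<⇒≱ h (begin
  length xs + r
    ≡⟨ cong₂ _+_ (∑-classes f xs) (trans (trans (∑-const (fins r) 1) (*-identityʳ _)) (length-fins r)) ⟨
  ∑ (fins r) (λ c → length (filterᵇ (λ x → f x == c) xs)) + ∑ (fins r) (λ _ → 1) ≡⟨ ∑-+ (fins r) _ _ ⟨
  ∑ (fins r) (λ c → length (filterᵇ (λ x → f x == c) xs) + 1)
    ≤⟨ ∑-≤const (fins r) s (λ {c} c∈ → ≤-trans (≤-reflexive (+-comm _ 1)) (≤ᵇ-false⁻ s _ (none c∈))) ⟩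
  length (fins r) * s                                                 ≡⟨ cong (_* s) (length-fins r) ⟩
  r * s                                                               ∎))
  where open ≤-Reasoning

module _ {n r : ℕ} (2≤r : 2 ≤ r) (col : Fin n → Fin n → Fin r) where

  Link : Fin n × Fin r → Fin n × Fin r → Set
  Link (x , c) (y , _) = x ≢ y × col x y ≡ c

  -- Neighbourhood chasing: pick a vertex, keep only its neighbours in the most frequent colour, and
  -- repeat. Each picked vertex is labelled with the colour of its edges to all later ones, and the
  -- supply shrinks by a factor r per step.
  chain : ∀ m (xs : List (Fin n)) → LAllPairs.AllPairs _≢_ xs → r ^ m ≤ length xs →
    ∃ λ ch → length ch ≡ m × LAll.All (λ p → proj₁ p ∈ xs) ch × LAllPairs.AllPairs Link ch
  chain zero xs xs! h = [] , refl , [] , []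
  chain (suc m) [] xs! h = ⊥-elim (<⇒≱ (m^n>0 r {{>-nonZero (≤-trans (n≤1+n 1) 2≤r)}} (suc m)) h)
  chain (suc m) (x ∷ xs) (x∉ ∷ xs!) h =
    -- r^(m+1) ≤ 1 + |xs| gives r^(m+1) < |xs| + 2, and 2 ≤ r makes up for the picked vertex.
    let (c , big) = pigeonhole (col x) xs (r ^ m) (≤-trans (s≤s h) (≤-trans (≤-reflexive (+-comm 2 (length xs))) (+-monoʳ-≤ (length xs) 2≤r)))
        ys = filterᵇ (λ y → col x y == c) xs
        (ch , len , ch⊆ , linked) = chain m ys (AllPairs-filterᵇ _ xs!) big
        in-xs = λ {y} (y∈ : y ∈ ys) → ∈-filterᵇ⁻ (λ y → col x y == c) xs y∈
    in (x , c) ∷ ch , cong suc len , here refl ∷ LAll.map (there ∘ proj₁ ∘ in-xs) ch⊆ ,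
       LAll.map (λ y∈ → LAll.lookup x∉ (proj₁ (in-xs y∈)) , ==⇒≡ _ _ (proj₂ (in-xs y∈))) ch⊆ ∷ linked

-- Among r k chained vertices some k share a label, and the colour of a pair is the label of its
-- earlier vertex.
ramsey-bound : ∀ r k → 2 ≤ r → Arrows (K (r ^ (r * k))) k r
ramsey-bound r k 2≤r col col-sym =
  let (ch , len , _ , linked) = chain 2≤r col (r * k) (fins (r ^ (r * k))) (fins-unique _) (≤-reflexive (sym (length-fins _)))
      (c , k≤) = pigeonhole proj₂ ch k (subst (λ l → r * k < l + r) (sym len) (m<m+n (r * k) (≤-trans (n≤1+n 1) 2≤r)))
  in monochromatic ch c k≤ linked
  where
  monochromatic : ∀ ch c → k ≤ length (filterᵇ (λ p → proj₂ p == c) ch) → LAllPairs.AllPairs (Link 2≤r col) ch →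
    HasMonoClique (K (r ^ (r * k))) k r col
  monochromatic ch c k≤ linked = c , f , f-injective , mono
    where
    cs = filterᵇ (λ p → proj₂ p == c) ch
    at : Fin k → Fin (length cs)
    at i = Fin.inject≤ i k≤
    f : Fin k → Fin (r ^ (r * k))
    f i = proj₁ (List.lookup cs (at i))
    label : ∀ i → proj₂ (List.lookup cs i) ≡ c
    label i = ==⇒≡ _ _ (proj₂ (∈-filterᵇ⁻ (λ p → proj₂ p == c) ch (∈-lookup {xs = cs} i)))
    forward : ∀ {i j} → i Fin.< j → f i ≢ f j × col (f i) (f j) ≡ c
    forward {i} {j} i<j =
      let (ne , e) = AllPairs-lookup (AllPairs-filterᵇ (λ p → proj₂ p == c) linked) {at i} {at j}
                       (subst₂ _<_ (sym (FinP.toℕ-inject≤ i k≤)) (sym (FinP.toℕ-inject≤ j k≤)) i<j)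
      in ne , trans e (label (at i))
    both : ∀ i j → i ≢ j → f i ≢ f j × col (f i) (f j) ≡ c
    both i j i≢j with FinP.<-cmp i j
    ... | tri< i<j _ _ = forward i<j
    ... | tri≈ _ i≡j _ = ⊥-elim (i≢j i≡j)
    ... | tri> _ _ j<i = let (ne , e) = forward j<i in ne ∘ sym , trans (col-sym (f i) (f j)) e
    f-injective : Injective _≡_ _≡_ f
    f-injective {i} {j} e with i Fin.≟ j
    ... | yes i≡j = i≡j
    ... | no i≢j = ⊥-elim (proj₁ (both i j i≢j) e)
    ≢⇒adj : ∀ {N} {x y : Fin N} → x ≢ y → adj (K N) x y ≡ true
    ≢⇒adj {x = x} {y} x≢y with x Fin.≟ y
    ... | yes e = ⊥-elim (x≢y e)
    ... | no _ = refl
    mono : ∀ i j → i ≢ j → adj (K (r ^ (r * k))) (f i) (f j) ≡ true × col (f i) (f j) ≡ c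
    mono i j i≢j = let (ne , e) = both i j i≢j in ≢⇒adj ne , e

ramsey-number≤ : ∀ r k → 2 ≤ r → IsRamseyNumber k r R → R ≤ r ^ (r * k)
ramsey-number≤ r k 2≤r (_ , least) = ≮⇒≥ λ lt → least (r ^ (r * k)) lt (ramsey-bound r k 2≤r)

-- Choice of parameters

1≤^ : ∀ {x} → 1 ≤ x → ∀ e → 1 ≤ x ^ e
1≤^ {x} 1≤x e = m^n>0 x {{>-nonZero 1≤x}} e

^-exponent-≤ : ∀ {x} → 1 ≤ x → ∀ {a b} → a ≤ b → x ^ a ≤ x ^ b
^-exponent-≤ {x} 1≤x = ^-monoʳ-≤ x {{>-nonZero 1≤x}}

-- Two vertices span a single pair.
3≤tri⇒3≤ : ∀ w → 2 ≤ tri w → 3 ≤ w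
3≤tri⇒3≤ (suc zero) ()
3≤tri⇒3≤ (suc (suc zero)) (s≤s ())
3≤tri⇒3≤ (suc (suc (suc w))) _ = s≤s (s≤s (s≤s z≤n))

2*pred-tri : ∀ u → 2 * pred (tri (suc (suc u))) ≡ u * (3 + u)
2*pred-tri u = +-cancelʳ-≡ 2 _ _ (begin
  2 * pred (tri (suc (suc u))) + 2     ≡⟨ lem (pred (tri (suc (suc u)))) ⟩
  2 * suc (pred (tri (suc (suc u))))   ≡⟨⟩
  2 * tri (suc (suc u))                ≡⟨ 2*tri (suc u) ⟩
  suc (suc u) * suc u                  ≡⟨ lem2 u ⟩
  u * (3 + u) + 2                      ∎)
  where
  open ≡-Reasoning
  lem : ∀ a → 2 * a + 2 ≡ 2 * suc a
  lem = solve-∀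
  lem2 : ∀ u → suc (suc u) * suc u ≡ u * (3 + u) + 2
  lem2 = solve-∀

-- Exponents of Z in p^(tri w - 1) Z^(k+1) ≤ n^(w-2) for w = u + 2. The ratio (tri w - 1) / (w - 2)
-- = (w + 1) / 2 is largest at w = k, whence the threshold n^(2/(k+1)) = Z^(8k+16); taking p =
-- Z^(8k+14) below it leaves room for Z^(k+1).
codegree-exponents : ∀ k u → 1 ≤ u → suc (suc u) ≤ k →
  (8 * k + 14) * pred (tri (suc (suc u))) + suc k ≤ (4 * (suc k * suc (suc k))) * u
codegree-exponents k u 1≤u u≤k = begin
  (8 * k + 14) * e + suc k                  ≡⟨ cong (_+ suc k) (l1 k e) ⟩
  (4 * k + 7) * (2 * e) + suc k             ≡⟨ cong (λ s → (4 * k + 7) * s + suc k) (2*pred-tri u) ⟩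
  (4 * k + 7) * (u * (3 + u)) + suc k
    ≤⟨ +-mono-≤ (*-monoʳ-≤ (4 * k + 7) (*-monoʳ-≤ u (s≤s u≤k))) (≤-trans (≤-reflexive (sym (*-identityˡ (suc k)))) (*-monoˡ-≤ (suc k) 1≤u)) ⟩
  (4 * k + 7) * (u * suc k) + u * suc k     ≡⟨ l2 k u ⟩
  (4 * (suc k * suc (suc k))) * u           ∎
  where
  open ≤-Reasoning
  e = pred (tri (suc (suc u)))
  l1 : ∀ k e → (8 * k + 14) * e ≡ (4 * k + 7) * (2 * e)
  l1 = solve-∀
  l2 : ∀ k u → (4 * k + 7) * (u * suc k) + u * suc k ≡ (4 * (suc k * suc (suc k))) * u
  l2 = solve-∀

2*n≤2^n : ∀ n → 1 ≤ n → 2 * n ≤ 2 ^ n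
2*n≤2^n (suc zero) _ = ≤-refl
2*n≤2^n (suc (suc n)) _ = begin
  2 * suc (suc n)           ≡⟨ lem n ⟩
  2 * suc n + 2 * 1         ≤⟨ +-mono-≤ (2*n≤2^n (suc n) (s≤s z≤n)) (*-monoʳ-≤ 2 (m^n>0 2 n)) ⟩
  2 ^ suc n + 2 ^ suc n     ≡⟨ cong (2 ^ suc n +_) (+-identityʳ _) ⟨
  2 * 2 ^ suc n             ∎
  where
  open ≤-Reasoning
  lem : ∀ n → 2 * suc (suc n) ≡ 2 * suc n + 2 * 1
  lem = solve-∀

n≤2^n : ∀ n → n ≤ 2 ^ n
n≤2^n zero = z≤n
n≤2^n (suc n) = ≤-trans (m≤n*m (suc n) 2) (2*n≤2^n (suc n) (s≤s z≤n))

-- The codegree condition needs q below n^(2/(k+1)) and the deletion of the K_{k+1} needs q above n^(2/(k+2));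
-- the ratio of these two bounds is Z^8.
module Assembly (k₁ r₁ R Z P Λ e n q₀ p q h t b θ : ℕ)
  (n≡  : n ≡ Z ^ (4 * (suc ((suc k₁)) * suc (suc ((suc k₁))))))
  (p≡  : p ≡ Z ^ (8 * (suc k₁) + 14))
  (q₀≡ : q₀ ≡ Z ^ (8 * (suc k₁) + 13))
  (q≡  : q ≡ Z ^ (8 * (suc k₁) + 10))
  -- `h` is n^2 / (q Z), where Z pays for 4R^2; `t` is Z times n^(k+1) / q^tri(k+1), the bound for
  -- the expected number of (k+1)-cliques; `b` is 4n^2 / q₀ = 4h / Z^2.
  (h≡  : h ≡ Z ^ (8 * ((suc k₁) * (suc k₁)) + 16 * (suc k₁) + 5))
  (t≡  : t ≡ Z ^ (7 * ((suc k₁) * (suc k₁)) + 15 * (suc k₁) + 9))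
  (b≡  : b ≡ 4 * Z ^ (8 * ((suc k₁) * (suc k₁)) + 16 * (suc k₁) + 3))
  (θ≡  : θ ≡ Z ^ e)
  -- That is, θ = n^(k-2) / Z^(k+1), stated without subtraction.
  (e≡  : 8 * (suc ((suc k₁)) * suc (suc ((suc k₁)))) + e + suc ((suc k₁)) ≡ 4 * (suc ((suc k₁)) * suc (suc ((suc k₁)))) * (suc k₁))
  (P≡  : P ≡ ((suc k₁) ^ 4) ^ tri ((suc k₁)))
  (3≤k : 3 ≤ (suc k₁)) (r≤R : (suc r₁) ≤ R) (arrows : Arrows (K R) ((suc k₁)) ((suc r₁)))
  (2P≤Z : 2 * P ≤ Z)
  (PE≤Z : 16 * P * ((suc r₁) * R ^ (suc k₁)) ≤ Z ^ suc ((suc k₁)))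
  (4RR≤Z : 4 * (R * R) ≤ Z)
  (N<2^Λ : suc (n * n) ≤ 2 ^ Λ)
  (Λ≤Z : 32 * Λ * tri ((suc k₁)) * P * (suc ((suc k₁)) * R) * (suc r₁) ≤ Z * Z) where

  private
    k′ r′ E y : ℕ
    k′ = suc k₁
    r′ = suc r₁
    E = 4 * (r′ * R ^ k′)
    -- log E is of order k log R; the cruder (k+1) R avoids the logarithm and costs less than one
    -- factor R.
    y = suc k′ * R

    1≤R : 1 ≤ R
    1≤R = ≤-trans (s≤s z≤n) r≤R

    4≤Z : 4 ≤ Z
    4≤Z = ≤-trans (*-monoʳ-≤ 4 (*-mono-≤ 1≤R 1≤R)) 4RR≤Z

    1≤Z : 1 ≤ Z
    1≤Z = ≤-trans (s≤s z≤n) 4≤Z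

    1≤k^4 : 1 ≤ k′ ^ 4
    1≤k^4 = 1≤^ {k′} (s≤s z≤n) 4

    1≤P : 1 ≤ P
    1≤P = ≤-trans (1≤^ 1≤k^4 (tri k′)) (≤-reflexive (sym P≡))

    power : ∀ {x} e → x ≡ Z ^ e → 1 ≤ x
    power e refl = 1≤^ 1≤Z e

    Z^-+ : ∀ a b → Z ^ a * Z ^ b ≡ Z ^ (a + b)
    Z^-+ a b = sym (^-distribˡ-+-* Z a b)

    1≤q₀ : 1 ≤ q₀
    1≤q₀ = power (8 * k′ + 13) q₀≡

    1≤p : 1 ≤ p
    1≤p = power (8 * k′ + 14) p≡

    Kℓ≤P : (k′ ^ 4) ^ tri k′ ≤ P
    Kℓ≤P = ≤-reflexive (sym P≡)

    1≤n : 1 ≤ n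
    1≤n = power (4 * (suc k′ * suc (suc k′))) n≡

    N≡ : n * n ≡ Z ^ (8 * (suc k′ * suc (suc k′)))
    N≡ = trans (cong₂ _*_ n≡ n≡) (trans (Z^-+ (4 * (suc k′ * suc (suc k′))) (4 * (suc k′ * suc (suc k′)))) (cong (Z ^_) (lem (suc k′ * suc (suc k′)))))
      where
      lem : ∀ a → 4 * a + 4 * a ≡ 8 * a
      lem = solve-∀

    q₀Z≡p : q₀ * Z ≡ p
    q₀Z≡p = trans (cong₂ _*_ q₀≡ (sym (^-identityʳ Z))) (trans (Z^-+ (8 * k′ + 13) 1) (trans (cong (Z ^_) (lem k′)) (sym p≡)))
      where
      lem : ∀ k′ → 8 * k′ + 13 + 1 ≡ 8 * k′ + 14
      lem = solve-∀

    2qP≤p : 2 * (q₀ * P) ≤ p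
    2qP≤p = begin
      2 * (q₀ * P)   ≡⟨ lem q₀ P ⟩
      q₀ * (2 * P)   ≤⟨ *-monoʳ-≤ q₀ 2P≤Z ⟩
      q₀ * Z         ≡⟨ q₀Z≡p ⟩
      p              ∎
      where
      open ≤-Reasoning
      lem : ∀ q P → 2 * (q * P) ≡ q * (2 * P)
      lem = solve-∀

    bq≡4N : b * q₀ ≡ 4 * (n * n)
    bq≡4N = begin
      b * q₀                              ≡⟨ cong₂ _*_ b≡ q₀≡ ⟩
      4 * Z ^ (8 * (k′ * k′) + 16 * k′ + 3) * Z ^ (8 * k′ + 13)
        ≡⟨ *-assoc 4 (Z ^ (8 * (k′ * k′) + 16 * k′ + 3)) (Z ^ (8 * k′ + 13)) ⟩
      4 * (Z ^ (8 * (k′ * k′) + 16 * k′ + 3) * Z ^ (8 * k′ + 13))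
        ≡⟨ cong (4 *_) (Z^-+ (8 * (k′ * k′) + 16 * k′ + 3) (8 * k′ + 13)) ⟩
      4 * Z ^ (8 * (k′ * k′) + 16 * k′ + 3 + (8 * k′ + 13)) ≡⟨ cong (λ s → 4 * Z ^ s) (lem k′) ⟩
      4 * Z ^ (8 * (suc k′ * suc (suc k′))) ≡⟨ cong (4 *_) N≡ ⟨
      4 * (n * n)                         ∎
      where
      open ≡-Reasoning
      lem : ∀ k′ → 8 * (k′ * k′) + 16 * k′ + 3 + (8 * k′ + 13) ≡ 8 * (suc k′ * suc (suc k′))
      lem = solve-∀

    -- The choice K = k^4: 16 tri(k) = 8k(k-1) ≤ 9k^2, and 9 ≤ k^2.
    16ℓ≤K : 16 * tri k′ ≤ k′ ^ 4
    16ℓ≤K = begin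
      16 * tri k′           ≡⟨ l1 (tri k′) ⟩
      8 * (2 * tri k′)      ≡⟨ cong (8 *_) (2*tri k₁) ⟩
      8 * (k′ * k₁)         ≤⟨ *-mono-≤ (n≤1+n 8) (*-monoʳ-≤ k′ (n≤1+n k₁)) ⟩
      9 * (k′ * k′)          ≤⟨ *-monoˡ-≤ (k′ * k′) (*-mono-≤ 3≤k 3≤k) ⟩
      k′ * k′ * (k′ * k′)      ≡⟨ l2 k′ ⟩
      k′ ^ 4                ∎
      where
      open ≤-Reasoning
      l1 : ∀ a → 16 * a ≡ 8 * (2 * a)
      l1 = solve-∀
      l2 : ∀ k′ → k′ * k′ * (k′ * k′) ≡ k′ * (k′ * (k′ * (k′ * 1)))
      l2 = solve-∀

    Nθ : n * n * (θ * Z ^ suc k′) ≡ n ^ k′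
    Nθ = begin
      n * n * (θ * Z ^ suc k′)       ≡⟨ cong₂ (λ a c → a * (c * Z ^ suc k′)) N≡ θ≡ ⟩
      Z ^ (8 * (suc k′ * suc (suc k′))) * (Z ^ e * Z ^ suc k′) ≡⟨ *-assoc (Z ^ (8 * (suc k′ * suc (suc k′)))) (Z ^ e) _ ⟨
      Z ^ (8 * (suc k′ * suc (suc k′))) * Z ^ e * Z ^ suc k′ ≡⟨ cong (_* Z ^ suc k′) (Z^-+ (8 * (suc k′ * suc (suc k′))) e) ⟩
      Z ^ (8 * (suc k′ * suc (suc k′)) + e) * Z ^ suc k′ ≡⟨ Z^-+ (8 * (suc k′ * suc (suc k′)) + e) (suc k′) ⟩
      Z ^ (8 * (suc k′ * suc (suc k′)) + e + suc k′) ≡⟨ cong (Z ^_) e≡ ⟩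
      Z ^ (4 * (suc k′ * suc (suc k′)) * k′) ≡⟨ ^-*-assoc Z (4 * (suc k′ * suc (suc k′))) k′ ⟨
      (Z ^ (4 * (suc k′ * suc (suc k′)))) ^ k′ ≡⟨ cong (_^ k′) n≡ ⟨
      n ^ k′                         ∎
      where open ≡-Reasoning

    θ-small : 4 * (n * n * (P * θ)) * E ≤ length (cliques n k′)
    θ-small = begin
      4 * (n * n * (P * θ)) * E               ≡⟨ lem (n * n) P θ (r′ * R ^ k′) ⟩
      n * n * (θ * (16 * P * (r′ * R ^ k′)))    ≤⟨ *-monoʳ-≤ (n * n) (*-monoʳ-≤ θ PE≤Z) ⟩
      n * n * (θ * Z ^ suc k′)                 ≡⟨ Nθ ⟩
      n ^ k′                                   ≡⟨ length-cliques n k′ ⟨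
      length (cliques n k′)                    ∎
      where
      open ≤-Reasoning
      lem : ∀ N P θ X → 4 * (N * (P * θ)) * (4 * X) ≡ N * (θ * (16 * P * X))
      lem = solve-∀

    -- Everything depends on the number w of vertices covered by `J`: |J| ≤ tri w, and the codegree
    -- is at most n^(k-w). With θ = n^(k-2) / Z^(k+1) this leaves p^(tri w - 1) Z^(k+1) ≤ n^(w-2).
    codegree : ∀ J s → 2 ≤ size J → p ^ pred (size J) * deg (cliques n k′) J s ≤ θ
    codegree J s 2≤J = go (size (cover k′ J)) refl (3≤tri⇒3≤ _ (≤-trans 2≤J (size-cover k′ J)))
      where
      open ≤-Reasoning
      go : ∀ w → w ≡ size (cover k′ J) → 3 ≤ w → p ^ pred (size J) * deg (cliques n k′) J s ≤ θ
      go (suc (suc u)) w≡ (s≤s (s≤s 1≤u)) = *-cancelʳ-≤ _ _ (n ^ suc (suc u)) {{>-nonZero (1≤^ 1≤n (suc (suc u)))}} (begin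
        p ^ pred (size J) * deg (cliques n k′) J s * n ^ suc (suc u)
          ≡⟨ *-assoc (p ^ pred (size J)) (deg (cliques n k′) J s) (n ^ suc (suc u)) ⟩
        p ^ pred (size J) * (deg (cliques n k′) J s * n ^ suc (suc u))
          ≤⟨ *-mono-≤ (^-exponent-≤ 1≤p (pred-mono-≤ (≤-trans (size-cover k′ J) (≤-reflexive (cong tri (sym w≡))))))
               (≤-trans (≤-reflexive (cong (λ s′ → deg (cliques n k′) J s * n ^ s′) w≡)) (codegree-cliques {n} k′ J s)) ⟩
        p ^ pred (tri (suc (suc u))) * n ^ k′
          ≡⟨ cong (p ^ pred (tri (suc (suc u))) *_) Nθ ⟨
        p ^ pred (tri (suc (suc u))) * (n * n * (θ * Z ^ suc k′))
          ≡⟨ l1 (p ^ pred (tri (suc (suc u)))) (n * n) θ (Z ^ suc k′) ⟩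
        θ * (n * n * (p ^ pred (tri (suc (suc u))) * Z ^ suc k′))
          ≤⟨ *-monoʳ-≤ θ (*-monoʳ-≤ (n * n) pZ≤) ⟩
        θ * (n * n * n ^ u)
          ≡⟨ cong (θ *_) (*-assoc n n (n ^ u)) ⟩
        θ * n ^ suc (suc u) ∎)
        where
        l1 : ∀ a N θ z → a * (N * (θ * z)) ≡ θ * (N * (a * z))
        l1 = solve-∀
        τ = pred (tri (suc (suc u)))
        pZ≤ : p ^ τ * Z ^ suc k′ ≤ n ^ u
        pZ≤ = begin
          p ^ τ * Z ^ suc k′                          ≡⟨ cong (λ s → s ^ τ * Z ^ suc k′) p≡ ⟩
          (Z ^ (8 * k′ + 14)) ^ τ * Z ^ suc k′         ≡⟨ cong (_* Z ^ suc k′) (^-*-assoc Z (8 * k′ + 14) τ) ⟩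
          Z ^ ((8 * k′ + 14) * τ) * Z ^ suc k′         ≡⟨ Z^-+ ((8 * k′ + 14) * τ) (suc k′) ⟩
          Z ^ ((8 * k′ + 14) * τ + suc k′)
            ≤⟨ ^-exponent-≤ 1≤Z (codegree-exponents k′ u 1≤u (≤-trans (≤-reflexive w≡) (size≤ (cover k′ J)))) ⟩
          Z ^ (4 * (suc k′ * suc (suc k′)) * u)        ≡⟨ ^-*-assoc Z (4 * (suc k′ * suc (suc k′))) u ⟨
          (Z ^ (4 * (suc k′ * suc (suc k′)))) ^ u      ≡⟨ cong (_^ u) n≡ ⟨
          n ^ u                                      ∎

    E≤2^y : E ≤ 2 ^ y
    E≤2^y = begin
      4 * (r′ * R ^ k′)          ≤⟨ *-mono-≤ (^-monoʳ-≤ 2 (s≤s (s≤s (z≤n {k₁})))) (*-monoˡ-≤ (R ^ k′) r≤R) ⟩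
      2 ^ suc k′ * R ^ suc k′    ≡⟨ ^-distribʳ-* (suc k′) 2 R ⟨
      (2 * R) ^ suc k′          ≤⟨ ^-monoˡ-≤ (suc k′) (2*n≤2^n R 1≤R) ⟩
      (2 ^ R) ^ suc k′          ≡⟨ ^-*-assoc 2 R (suc k′) ⟩
      2 ^ (R * suc k′)          ≡⟨ cong (2 ^_) (*-comm R (suc k′)) ⟩
      2 ^ y                    ∎
      where open ≤-Reasoning

    v₀ : Fin (n * n)
    v₀ = Fin.fromℕ< (*-mono-≤ 1≤n 1≤n)

    open Restart v₀ q₀ (k′ ^ 4) p P b θ E y (cliques n k′) 1≤q₀ 1≤k^4 1≤p 1≤P 2qP≤p bq≡4N
      16ℓ≤K Kℓ≤P θ-small codegree E≤2^y

    open SmallContainers small-containers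

    cliques-few : 2 * n ^ suc k′ ≤ t * q ^ tri (suc k′)
    cliques-few = begin
      2 * n ^ suc k′                                     ≤⟨ *-monoˡ-≤ (n ^ suc k′) (≤-trans (m≤m+n 2 2) 4≤Z) ⟩
      Z * n ^ suc k′                                     ≡⟨ cong (λ s → Z * s ^ suc k′) n≡ ⟩
      Z * (Z ^ (4 * (suc k′ * suc (suc k′)))) ^ suc k′
        ≡⟨ cong (Z *_) (^-*-assoc Z (4 * (suc k′ * suc (suc k′))) (suc k′)) ⟩
      Z ^ suc (4 * (suc k′ * suc (suc k′)) * suc k′)       ≡⟨ cong (Z ^_) (l1 k′) ⟩
      Z ^ (7 * (k′ * k′) + 15 * k′ + 9 + (4 * k′ + 5) * (suc k′ * k′))
        ≡⟨ cong (λ s → Z ^ (7 * (k′ * k′) + 15 * k′ + 9 + (4 * k′ + 5) * s)) (2*tri k′) ⟨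
      Z ^ (7 * (k′ * k′) + 15 * k′ + 9 + (4 * k′ + 5) * (2 * tri (suc k′)))
        ≡⟨ cong (λ s → Z ^ (7 * (k′ * k′) + 15 * k′ + 9 + s)) (l2 k′ (tri (suc k′))) ⟩
      Z ^ (7 * (k′ * k′) + 15 * k′ + 9 + (8 * k′ + 10) * tri (suc k′))
        ≡⟨ Z^-+ (7 * (k′ * k′) + 15 * k′ + 9) ((8 * k′ + 10) * tri (suc k′)) ⟨
      Z ^ (7 * (k′ * k′) + 15 * k′ + 9) * Z ^ ((8 * k′ + 10) * tri (suc k′))
        ≡⟨ cong₂ _*_ t≡ (trans (cong (_^ tri (suc k′)) q≡) (^-*-assoc Z (8 * k′ + 10) (tri (suc k′)))) ⟨
      t * q ^ tri (suc k′)                               ∎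
      where
      open ≤-Reasoning
      l1 : ∀ k′ → suc (4 * (suc k′ * suc (suc k′)) * suc k′) ≡ 7 * (k′ * k′) + 15 * k′ + 9 + (4 * k′ + 5) * (suc k′ * k′)
      l1 = solve-∀
      l2 : ∀ k′ τ → (4 * k′ + 5) * (2 * τ) ≡ (8 * k′ + 10) * τ
      l2 = solve-∀

    -- Here q has to exceed n^(2/(k+2)) = Z^(8k+8): the (k+1)-cliques are then outnumbered by the
    -- edges that the union bound provides. In exponents, 5 ≤ k^2 + k.
    Zt≤h : Z * t ≤ h
    Zt≤h = begin
      Z * t                                        ≡⟨ cong (Z *_) t≡ ⟩
      Z ^ suc (7 * (k′ * k′) + 15 * k′ + 9)           ≤⟨ ^-exponent-≤ 1≤Z exponents ⟩
      Z ^ (8 * (k′ * k′) + 16 * k′ + 5)               ≡⟨ h≡ ⟨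
      h                                            ∎
      where
      open ≤-Reasoning
      l1 : ∀ k′ → suc (7 * (k′ * k′) + 15 * k′ + 9) ≡ 7 * (k′ * k′) + 15 * k′ + 5 + (2 + 3)
      l1 = solve-∀
      l2 : ∀ k′ → 7 * (k′ * k′) + 15 * k′ + 5 + (k′ * k′ + k′) ≡ 8 * (k′ * k′) + 16 * k′ + 5
      l2 = solve-∀
      exponents : suc (7 * (k′ * k′) + 15 * k′ + 9) ≤ 8 * (k′ * k′) + 16 * k′ + 5
      exponents = begin
        suc (7 * (k′ * k′) + 15 * k′ + 9)              ≡⟨ l1 k′ ⟩
        7 * (k′ * k′) + 15 * k′ + 5 + (2 + 3)
          ≤⟨ +-monoʳ-≤ (7 * (k′ * k′) + 15 * k′ + 5) (+-mono-≤ (≤-trans (m≤m+n 2 7) (*-mono-≤ 3≤k 3≤k)) 3≤k) ⟩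
        7 * (k′ * k′) + 15 * k′ + 5 + (k′ * k′ + k′)      ≡⟨ l2 k′ ⟩
        8 * (k′ * k′) + 16 * k′ + 5                    ∎

    rounds s : ℕ
    rounds = 4 * P * y
    -- 2^s bounds the number of r-tuples of containers: Λ bits for each pick, and tri(k) b picks for
    -- each round.
    s = Λ * (tri k′ * b * rounds) * r′

    2s≤h : 2 * s ≤ h
    2s≤h = begin
      2 * (Λ * (tri k′ * b * (4 * P * y)) * r′)              ≡⟨ cong (λ z → 2 * (Λ * (tri k′ * z * (4 * P * y)) * r′)) b≡ ⟩
      2 * (Λ * (tri k′ * (4 * X) * (4 * P * y)) * r′)        ≡⟨ l1 Λ (tri k′) X P y r′ ⟩
      32 * Λ * tri k′ * P * y * r′ * X                       ≤⟨ *-monoˡ-≤ X Λ≤Z ⟩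
      Z * Z * X                                            ≡⟨ *-assoc Z Z X ⟩
      Z ^ suc (suc (8 * (k′ * k′) + 16 * k′ + 3))             ≡⟨ cong (Z ^_) (l2 k′) ⟩
      Z ^ (8 * (k′ * k′) + 16 * k′ + 5)                       ≡⟨ h≡ ⟨
      h                                                    ∎
      where
      open ≤-Reasoning
      X = Z ^ (8 * (k′ * k′) + 16 * k′ + 3)
      l1 : ∀ L l X P y r′ → 2 * (L * (l * (4 * X) * (4 * P * y)) * r′) ≡ 32 * L * l * P * y * r′ * X
      l1 = solve-∀
      l2 : ∀ k′ → suc (suc (8 * (k′ * k′) + 16 * k′ + 3)) ≡ 8 * (k′ * k′) + 16 * k′ + 5
      l2 = solve-∀

    2+t+s≤h : 2 + t + s ≤ h
    2+t+s≤h = *-cancelˡ-≤ 2 (begin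
      2 * (2 + t + s)            ≡⟨ l1 t s ⟩
      4 * 1 + 2 * t + 2 * s      ≤⟨ +-mono-≤ (+-monoˡ-≤ (2 * t) 4≤2t) 2s≤h ⟩
      2 * t + 2 * t + h          ≡⟨ cong (_+ h) (l2 t) ⟩
      4 * t + h                  ≤⟨ +-monoˡ-≤ h (≤-trans (*-monoˡ-≤ t 4≤Z) Zt≤h) ⟩
      h + h                      ≡⟨ cong (h +_) (+-identityʳ h) ⟨
      2 * h                      ∎)
      where
      open ≤-Reasoning
      l1 : ∀ t s → 2 * (2 + t + s) ≡ 4 * 1 + 2 * t + 2 * s
      l1 = solve-∀
      l2 : ∀ t → 2 * t + 2 * t ≡ 4 * t
      l2 = solve-∀
      4≤2t : 4 * 1 ≤ 2 * t
      4≤2t = ≤-trans (≤-trans 4≤Z (≤-trans (≤-reflexive (sym (^-identityʳ Z))) (≤-trans (^-exponent-≤ 1≤Z {1} {7 * (k′ * k′) + 15 * k′ + 9} (≤-trans (s≤s z≤n) (m≤n+m 9 (7 * (k′ * k′) + 15 * k′)))) (≤-reflexive (sym t≡))))) (m≤n*m t 2)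

    sets-few : 4 * (2 ^ t * length sets ^ r′) ≤ 2 ^ h
    sets-few = begin
      4 * (2 ^ t * length sets ^ r′)                  ≤⟨ *-monoʳ-≤ 4 (*-monoʳ-≤ (2 ^ t) (^-monoˡ-≤ r′ length≤)) ⟩
      4 * (2 ^ t * (2 ^ (Λ * (tri k′ * b * rounds))) ^ r′)
        ≡⟨ cong (λ z → 4 * (2 ^ t * z)) (^-*-assoc 2 (Λ * (tri k′ * b * rounds)) r′) ⟩
      2 ^ 2 * (2 ^ t * 2 ^ s)                        ≡⟨ cong (2 ^ 2 *_) (^-distribˡ-+-* 2 t s) ⟨
      2 ^ 2 * 2 ^ (t + s)                            ≡⟨ ^-distribˡ-+-* 2 2 (t + s) ⟨
      2 ^ (2 + t + s)                                ≤⟨ ^-monoʳ-≤ 2 2+t+s≤h ⟩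
      2 ^ h                                          ∎
      where
      open ≤-Reasoning
      length≤ : length sets ≤ 2 ^ (Λ * (tri k′ * b * rounds))
      length≤ = begin
        length sets                               ≤⟨ few ⟩
        (suc (n * n) ^ (tri k′ * b)) ^ rounds           ≤⟨ ^-monoˡ-≤ rounds (^-monoˡ-≤ (tri k′ * b) N<2^Λ) ⟩
        ((2 ^ Λ) ^ (tri k′ * b)) ^ rounds               ≡⟨ ^-*-assoc (2 ^ Λ) (tri k′ * b) rounds ⟩
        (2 ^ Λ) ^ (tri k′ * b * rounds)                 ≡⟨ ^-*-assoc 2 Λ (tri k′ * b * rounds) ⟩
        2 ^ (Λ * (tri k′ * b * rounds))                 ∎

    h-small : 2 * (R * R) * (2 * q * h) ≤ n * n
    h-small = begin
      2 * (R * R) * (2 * q * h)        ≡⟨ l1 (R * R) q h ⟩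
      4 * (R * R) * (q * h)            ≤⟨ *-monoˡ-≤ (q * h) 4RR≤Z ⟩
      Z * (q * h)
        ≡⟨ cong (Z *_) (trans (cong₂ _*_ q≡ h≡) (Z^-+ (8 * k′ + 10) (8 * (k′ * k′) + 16 * k′ + 5))) ⟩
      Z ^ suc (8 * k′ + 10 + (8 * (k′ * k′) + 16 * k′ + 5)) ≡⟨ cong (Z ^_) (l2 k′) ⟩
      Z ^ (8 * (suc k′ * suc (suc k′)))  ≡⟨ N≡ ⟨
      n * n                            ∎
      where
      open ≤-Reasoning
      l1 : ∀ a q h → 2 * a * (2 * q * h) ≡ 4 * a * (q * h)
      l1 = solve-∀
      l2 : ∀ k′ → suc (8 * k′ + 10 + (8 * (k′ * k′) + 16 * k′ + 5)) ≡ 8 * (suc k′ * suc (suc k′))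
      l2 = solve-∀

    Z≤n : Z ≤ n
    Z≤n = ≤-trans (≤-reflexive (sym (^-identityʳ Z))) (≤-trans (^-exponent-≤ 1≤Z {1} {4 * (suc k′ * suc (suc k′))} (s≤s z≤n)) (≤-reflexive (sym n≡)))

  folkman : Σ (Graph n) λ G → IsFolkman G (suc k₁) (suc r₁)
  folkman = folkman-graph {h = h} {t = t} sets (power (8 * k′ + 10) q≡) (power (7 * (k′ * k′) + 15 * k′ + 9) t≡) 1≤R (≤-trans 4RR≤Z Z≤n) arrows small
    (λ I iI → covers I (λ _ _ → refl) iI) cliques-few sets-few h-small

module Parameters (k R : ℕ) (3≤k : 3 ≤ k) (1≤R : 1 ≤ R) where

  Z P Λ : ℕ
  -- Of the exponent 40k^2, P takes 4k^2, and 36k^2 remain for factors polynomial in k. R^4 covers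
  -- the three factors R that come from Λ, from y and from the number of colours.
  Z = k ^ (40 * k ^ 2) * R ^ 4
  P = (k ^ 4) ^ tri k
  -- An upper bound for log(n^2 + 1), in which k ≤ 2^k and R ≤ 2^R replace logarithms.
  Λ = 1 + (40 * k ^ 2 * k + 4 * R) * (8 * (suc k * suc (suc k)))

  private
    1≤k : 1 ≤ k
    1≤k = ≤-trans (s≤s z≤n) 3≤k

    k^-+ : ∀ a b → k ^ a * k ^ b ≡ k ^ (a + b)
    k^-+ a b = sym (^-distribˡ-+-* k a b)

    k^-mono : ∀ {a b} → a ≤ b → k ^ a ≤ k ^ b
    k^-mono = ^-exponent-≤ 1≤k

    R^-mono : ∀ {a b} → a ≤ b → R ^ a ≤ R ^ b
    R^-mono = ^-exponent-≤ 1≤R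

    3^≤k^ : ∀ e → 3 ^ e ≤ k ^ e
    3^≤k^ e = ^-monoˡ-≤ e 3≤k

    1≤k² : 1 ≤ k ^ 2
    1≤k² = 1≤^ 1≤k 2

    tri≤k² : tri k ≤ k ^ 2
    tri≤k² = go k
      where
      go : ∀ k → tri k ≤ k ^ 2
      go zero = z≤n
      go (suc k) = ≤-trans (+-monoʳ-≤ k (go k)) (≤-trans (m≤m+n (k + k ^ 2) (suc k)) (≤-reflexive (lem k)))
        where
        lem : ∀ k → k + k * (k * 1) + suc k ≡ suc k * (suc k * 1)
        lem = solve-∀

    P≤ : P ≤ k ^ (4 * k ^ 2)
    P≤ = ≤-trans (^-exponent-≤ (1≤^ 1≤k 4) tri≤k²) (≤-reflexive (^-*-assoc k 4 (k ^ 2)))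

    absorb : ∀ a → a ≤ 36 → k ^ a * k ^ (4 * k ^ 2) ≤ k ^ (40 * k ^ 2)
    absorb a a≤36 = ≤-trans (≤-reflexive (k^-+ a (4 * k ^ 2))) (k^-mono (begin
      a + 4 * k ^ 2            ≤⟨ +-monoˡ-≤ (4 * k ^ 2) a≤36 ⟩
      36 * 1 + 4 * k ^ 2       ≤⟨ +-monoˡ-≤ (4 * k ^ 2) (*-monoʳ-≤ 36 1≤k²) ⟩
      36 * k ^ 2 + 4 * k ^ 2   ≡⟨ *-distribʳ-+ (k ^ 2) 36 4 ⟨
      40 * k ^ 2               ∎))
      where open ≤-Reasoning

    1≤R^4 : 1 ≤ R ^ 4
    1≤R^4 = 1≤^ 1≤R 4

    kP≤ : ∀ a → a ≤ 36 → k ^ a * P ≤ k ^ (40 * k ^ 2)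
    kP≤ a h = ≤-trans (*-monoʳ-≤ (k ^ a) P≤) (absorb a h)

  2P≤Z : 2 * P ≤ Z
  2P≤Z = begin
    2 * P                          ≤⟨ *-monoˡ-≤ P (≤-trans (n≤1+n 2) (3^≤k^ 1)) ⟩
    k ^ 1 * P                      ≤⟨ kP≤ 1 (s≤s z≤n) ⟩
    k ^ (40 * k ^ 2)               ≡⟨ *-identityʳ _ ⟨
    k ^ (40 * k ^ 2) * 1           ≤⟨ *-monoʳ-≤ (k ^ (40 * k ^ 2)) 1≤R^4 ⟩
    Z                              ∎
    where open ≤-Reasoning

  PE≤Z : ∀ r → r ≤ R → 16 * P * (r * R ^ k) ≤ Z ^ suc k
  PE≤Z r r≤R = begin
    16 * P * (r * R ^ k)            ≤⟨ *-mono-≤ (*-monoˡ-≤ P (≤-trans (m≤m+n 16 11) (3^≤k^ 3))) (*-monoˡ-≤ (R ^ k) r≤R) ⟩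
    k ^ 3 * P * R ^ suc k
      ≤⟨ *-mono-≤ (kP≤ 3 (s≤s (s≤s (s≤s z≤n)))) (^-monoˡ-≤ (suc k) (≤-trans (≤-reflexive (sym (^-identityʳ R))) (R^-mono {1} {4} (s≤s z≤n)))) ⟩
    k ^ (40 * k ^ 2) * (R ^ 4) ^ suc k
      ≤⟨ *-monoˡ-≤ ((R ^ 4) ^ suc k) (≤-trans (≤-reflexive (sym (^-identityʳ (k ^ (40 * k ^ 2))))) (^-exponent-≤ (1≤^ 1≤k (40 * k ^ 2)) {1} {suc k} (s≤s z≤n))) ⟩
    (k ^ (40 * k ^ 2)) ^ suc k * (R ^ 4) ^ suc k ≡⟨ ^-distribʳ-* (suc k) (k ^ (40 * k ^ 2)) (R ^ 4) ⟨
    Z ^ suc k                       ∎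
    where open ≤-Reasoning

  4RR≤Z : 4 * (R * R) ≤ Z
  4RR≤Z = *-mono-≤ {4} {k ^ (40 * k ^ 2)}
    (≤-trans (m≤m+n 4 5) (≤-trans (3^≤k^ 2) (≤-trans (≤-reflexive (sym (*-identityʳ _)))
      (≤-trans (*-monoʳ-≤ (k ^ 2) (1≤^ 1≤k (4 * k ^ 2))) (absorb 2 (s≤s (s≤s z≤n)))))))
    (≤-trans (≤-reflexive (cong (R *_) (sym (*-identityʳ R)))) (R^-mono {2} {4} (s≤s (s≤s z≤n))))

  Z≤2^ : Z ≤ 2 ^ (40 * k ^ 2 * k + 4 * R)
  Z≤2^ = begin
    k ^ (40 * k ^ 2) * R ^ 4                 ≤⟨ *-mono-≤ (^-monoˡ-≤ (40 * k ^ 2) (n≤2^n k)) (^-monoˡ-≤ 4 (n≤2^n R)) ⟩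
    (2 ^ k) ^ (40 * k ^ 2) * (2 ^ R) ^ 4
      ≡⟨ cong₂ _*_ (trans (^-*-assoc 2 k (40 * k ^ 2)) (cong (2 ^_) (*-comm k (40 * k ^ 2)))) (trans (^-*-assoc 2 R 4) (cong (2 ^_) (*-comm R 4))) ⟩
    2 ^ (40 * k ^ 2 * k) * 2 ^ (4 * R)       ≡⟨ ^-distribˡ-+-* 2 (40 * k ^ 2 * k) (4 * R) ⟨
    2 ^ (40 * k ^ 2 * k + 4 * R)             ∎
    where open ≤-Reasoning

  N<2^Λ : suc (Z ^ (8 * (suc k * suc (suc k)))) ≤ 2 ^ Λ
  N<2^Λ = begin
    suc (Z ^ (8 * (suc k * suc (suc k))))
      ≤⟨ s≤s (≤-trans (^-monoˡ-≤ (8 * (suc k * suc (suc k))) Z≤2^) (≤-reflexive (^-*-assoc 2 (40 * k ^ 2 * k + 4 * R) (8 * (suc k * suc (suc k)))))) ⟩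
    1 + 2 ^ M                                 ≤⟨ +-monoˡ-≤ (2 ^ M) (m^n>0 2 M) ⟩
    2 ^ M + 2 ^ M                             ≡⟨ cong (2 ^ M +_) (+-identityʳ _) ⟨
    2 ^ Λ                                     ∎
    where
    open ≤-Reasoning
    M = (40 * k ^ 2 * k + 4 * R) * (8 * (suc k * suc (suc k)))

  private
    sk≤2k : suc k ≤ 2 * k
    sk≤2k = ≤-trans (+-monoˡ-≤ k 1≤k) (≤-reflexive (cong (k +_) (sym (+-identityʳ k))))

    ssk≤2k : suc (suc k) ≤ 2 * k
    ssk≤2k = ≤-trans (+-monoˡ-≤ k (≤-trans (n≤1+n 2) 3≤k)) (≤-reflexive (cong (k +_) (sym (+-identityʳ k))))

    Λ≤ : Λ ≤ k ^ 14 * R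
    Λ≤ = begin
      1 + (40 * k ^ 2 * k + 4 * R) * (8 * (suc k * suc (suc k)))
        ≤⟨ +-mono-≤ (*-mono-≤ (1≤^ 1≤k 13) 1≤R) (*-mono-≤ λ≤ eight≤) ⟩
      k ^ 13 * R + k ^ 7 * R * k ^ 6
        ≡⟨ cong (k ^ 13 * R +_) (trans (l1 (k ^ 7) R (k ^ 6)) (cong (_* R) (k^-+ 7 6))) ⟩
      k ^ 13 * R + k ^ 13 * R
        ≡⟨ cong (k ^ 13 * R +_) (+-identityʳ _) ⟨
      2 * (k ^ 13 * R)                  ≤⟨ *-monoˡ-≤ (k ^ 13 * R) (≤-trans (n≤1+n 2) 3≤k) ⟩
      k * (k ^ 13 * R)                  ≡⟨ *-assoc k (k ^ 13) R ⟨
      k ^ 14 * R                        ∎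
      where
      open ≤-Reasoning
      l1 : ∀ a b c → a * b * c ≡ a * c * b
      l1 = solve-∀
      l2 : ∀ k R → 40 * k * R + 4 * k * R ≡ 44 * (k * R)
      l2 = solve-∀
      l3 : ∀ k → k * (k * 1) * k ≡ k * (k * (k * 1))
      l3 = solve-∀
      l4 : ∀ k → 8 * (2 * k * (2 * k)) ≡ 32 * (k * (k * 1))
      l4 = solve-∀
      λ≤ : 40 * k ^ 2 * k + 4 * R ≤ k ^ 7 * R
      λ≤ = begin
        40 * k ^ 2 * k + 4 * R             ≡⟨ cong (_+ 4 * R) (trans (*-assoc 40 (k ^ 2) k) (cong (40 *_) (l3 k))) ⟩
        40 * k ^ 3 + 4 * R
          ≤⟨ +-mono-≤ (≤-trans (≤-reflexive (sym (*-identityʳ (40 * k ^ 3)))) (*-monoʳ-≤ (40 * k ^ 3) 1≤R))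
                                                 (*-monoˡ-≤ R (≤-trans (≤-reflexive (sym (*-identityʳ 4))) (*-monoʳ-≤ 4 (1≤^ 1≤k 3)))) ⟩
        40 * k ^ 3 * R + 4 * k ^ 3 * R     ≡⟨ l2 (k ^ 3) R ⟩
        44 * (k ^ 3 * R)                   ≤⟨ *-monoˡ-≤ (k ^ 3 * R) (≤-trans (m≤m+n 44 37) (3^≤k^ 4)) ⟩
        k ^ 4 * (k ^ 3 * R)                ≡⟨ *-assoc (k ^ 4) (k ^ 3) R ⟨
        k ^ 4 * k ^ 3 * R                  ≡⟨ cong (_* R) (k^-+ 4 3) ⟩
        k ^ 7 * R                          ∎
      eight≤ : 8 * (suc k * suc (suc k)) ≤ k ^ 6
      eight≤ = begin
        8 * (suc k * suc (suc k))          ≤⟨ *-monoʳ-≤ 8 (*-mono-≤ sk≤2k ssk≤2k) ⟩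
        8 * (2 * k * (2 * k))              ≡⟨ l4 k ⟩
        32 * k ^ 2                         ≤⟨ *-monoˡ-≤ (k ^ 2) (≤-trans (m≤m+n 32 49) (3^≤k^ 4)) ⟩
        k ^ 4 * k ^ 2                      ≡⟨ k^-+ 4 2 ⟩
        k ^ 6                              ∎

  Λ≤Z : ∀ r → r ≤ R → 32 * Λ * tri k * P * (suc k * R) * r ≤ Z * Z
  Λ≤Z r r≤R = begin
    32 * Λ * tri k * P * (suc k * R) * r
      ≤⟨ *-mono-≤ (*-mono-≤ (*-monoˡ-≤ P (*-mono-≤ (*-mono-≤ (≤-trans (m≤m+n 32 49) (3^≤k^ 4)) Λ≤) tri≤k²)) (*-monoˡ-≤ R sk≤k²)) r≤R ⟩
    k ^ 4 * (k ^ 14 * R) * k ^ 2 * P * (k ^ 2 * R) * R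
      ≡⟨ l1 (k ^ 4) (k ^ 14) R (k ^ 2) P ⟩
    k ^ 4 * k ^ 14 * k ^ 2 * k ^ 2 * P * (R * (R * (R * 1)))
      ≡⟨ cong (λ z → z * P * R ^ 3) (trans (cong (λ z → z * k ^ 2 * k ^ 2) (k^-+ 4 14)) (trans (cong (_* k ^ 2) (k^-+ 18 2)) (k^-+ 20 2))) ⟩
    k ^ 22 * P * R ^ 3
      ≤⟨ *-mono-≤ (kP≤ 22 (m≤m+n 22 14)) (R^-mono {3} {4} (s≤s (s≤s (s≤s z≤n)))) ⟩
    Z                                    ≡⟨ *-identityʳ Z ⟨
    Z * 1                                ≤⟨ *-monoʳ-≤ Z (≤-trans (*-mono-≤ {1} {4} (s≤s z≤n) (*-mono-≤ 1≤R 1≤R)) 4RR≤Z) ⟩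
    Z * Z                                ∎
    where
    open ≤-Reasoning
    l1 : ∀ a b R c P → a * (b * R) * c * P * (c * R) * R ≡ a * b * c * c * P * (R * (R * (R * 1)))
    l1 = solve-∀
    sk≤k² : suc k ≤ k ^ 2
    sk≤k² = ≤-trans sk≤2k (≤-trans (*-monoˡ-≤ k (≤-trans (n≤1+n 2) 3≤k)) (≤-reflexive (cong (k *_) (sym (*-identityʳ k)))))

  -- For k ≥ 3, 4(k+1)(k+2) ≤ 10k^2; multiplied by the exponents 40k^2 and 4 in Z, this gives the
  -- 400k^4 and 40k^2 of the theorem.
  n≤bound : Z ^ (4 * (suc k * suc (suc k))) ≤ k ^ (400 * k ^ 4) * R ^ (40 * k ^ 2)
  n≤bound = begin
    Z ^ (4 * (suc k * suc (suc k)))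
      ≤⟨ ^-exponent-≤ (≤-trans (*-mono-≤ {1} {4} (s≤s z≤n) (*-mono-≤ 1≤R 1≤R)) 4RR≤Z) exponent ⟩
    Z ^ (10 * k ^ 2)                                               ≡⟨ ^-distribʳ-* (10 * k ^ 2) (k ^ (40 * k ^ 2)) (R ^ 4) ⟩
    (k ^ (40 * k ^ 2)) ^ (10 * k ^ 2) * (R ^ 4) ^ (10 * k ^ 2)
      ≡⟨ cong₂ _*_ (^-*-assoc k (40 * k ^ 2) (10 * k ^ 2)) (^-*-assoc R 4 (10 * k ^ 2)) ⟩
    k ^ (40 * k ^ 2 * (10 * k ^ 2)) * R ^ (4 * (10 * k ^ 2))       ≡⟨ cong₂ (λ a b → k ^ a * R ^ b) (l1 k) (l2 (k ^ 2)) ⟩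
    k ^ (400 * k ^ 4) * R ^ (40 * k ^ 2)                           ∎
    where
    open ≤-Reasoning
    l1 : ∀ k → 40 * (k * (k * 1)) * (10 * (k * (k * 1))) ≡ 400 * (k * (k * (k * (k * 1))))
    l1 = solve-∀
    l2 : ∀ a → 4 * (10 * a) ≡ 40 * a
    l2 = solve-∀
    l3 : ∀ k → 4 * (suc k * suc (suc k)) ≡ 4 * (k * (k * 1)) + (12 * k + 8)
    l3 = solve-∀
    l4 : ∀ k → 4 * (k * k) + 2 * (k * k) ≡ 6 * (k * (k * 1))
    l4 = solve-∀
    l5 : ∀ a → 4 * a + 6 * a ≡ 10 * a
    l5 = solve-∀
    l6 : ∀ k → 12 * k ≡ 4 * (3 * k)
    l6 = solve-∀
    exponent : 4 * (suc k * suc (suc k)) ≤ 10 * k ^ 2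
    exponent = begin
      4 * (suc k * suc (suc k))             ≡⟨ l3 k ⟩
      4 * k ^ 2 + (12 * k + 8)
        ≤⟨ +-monoʳ-≤ (4 * k ^ 2) (+-mono-≤ (≤-trans (≤-reflexive (l6 k)) (*-monoʳ-≤ 4 (*-monoˡ-≤ k 3≤k))) (≤-trans (m≤m+n 8 10) (*-monoʳ-≤ 2 (*-mono-≤ 3≤k 3≤k)))) ⟩
      4 * k ^ 2 + (4 * (k * k) + 2 * (k * k)) ≡⟨ cong (4 * k ^ 2 +_) (l4 k) ⟩
      4 * k ^ 2 + 6 * k ^ 2                 ≡⟨ l5 (k ^ 2) ⟩
      10 * k ^ 2                            ∎

-- The two inequalities of the theorem

folkman-bound : ∀ r k R → 2 ≤ r → 3 ≤ k → IsRamseyNumber k r R → FolkmanAtMost k r (k ^ (400 * k ^ 4) * R ^ (40 * k ^ 2))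
folkman-bound (suc r₁) 1 R 2≤r (s≤s ()) _
folkman-bound (suc r₁) 2 R 2≤r (s≤s (s≤s ())) _
folkman-bound (suc r₁) (suc (suc (suc j))) R 2≤r 3≤k (arrows , _) = order , proj₁ graph , proj₂ graph , n≤bound
  where
  r<R : suc r₁ < R
  r<R = arrows⇒r<R 3≤k arrows
  1≤R : 1 ≤ R
  1≤R = ≤-trans (s≤s z≤n) r<R
  open Parameters (suc (suc (suc j))) R 3≤k 1≤R
  k₁ order : ℕ
  k₁ = suc (suc j)
  order = Z ^ (4 * (suc (suc k₁) * suc (suc (suc k₁))))
  order² : order * order ≡ Z ^ (8 * (suc (suc k₁) * suc (suc (suc k₁))))
  order² = trans (sym (^-distribˡ-+-* Z (4 * a) (4 * a))) (cong (Z ^_) (lem a))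
    where
    a = suc (suc k₁) * suc (suc (suc k₁))
    lem : ∀ a → 4 * a + 4 * a ≡ 8 * a
    lem = solve-∀
  e : ℕ
  -- The exponent of n^(k-2) / Z^(k+1) is (k+1)(4k^2 - 17), here with k = 3 + j.
  e = (4 + j) * (4 * (j * j) + 24 * j + 19)
  e≡ : ∀ j → 8 * ((4 + j) * (5 + j)) + (4 + j) * (4 * (j * j) + 24 * j + 19) + (4 + j) ≡ 4 * ((4 + j) * (5 + j)) * (3 + j)
  e≡ = solve-∀
  graph : Σ (Graph order) λ G → IsFolkman G (suc k₁) (suc r₁)
  graph = Assembly.folkman k₁ r₁ R Z P Λ e order _ _ _ _ _ _ _ refl refl refl refl refl refl refl refl (e≡ j) refl
    3≤k (<⇒≤ r<R) arrows 2P≤Z (PE≤Z (suc r₁) (<⇒≤ r<R)) 4RR≤Z (subst (λ a → suc a ≤ 2 ^ Λ) (sym order²) N<2^Λ) (Λ≤Z (suc r₁) (<⇒≤ r<R))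

-- R ≤ r^(rk) is inserted. As x^m = 2^(m log x), the right-hand side is 2^(400 (k^4 log k + k^3 r
-- log r)); powers of k and r express it without logarithms.
exponential-bound : ∀ r k R → 2 ≤ r → 3 ≤ k → IsRamseyNumber k r R →
  k ^ (400 * k ^ 4) * R ^ (40 * k ^ 2) ≤ k ^ (400 * k ^ 4) * r ^ (400 * k ^ 3 * r)
exponential-bound r k R 2≤r 3≤k isR = *-monoʳ-≤ (k ^ (400 * k ^ 4)) (begin
  R ^ (40 * k ^ 2)                 ≤⟨ ^-monoˡ-≤ (40 * k ^ 2) (ramsey-number≤ r k 2≤r isR) ⟩
  (r ^ (r * k)) ^ (40 * k ^ 2)     ≡⟨ ^-*-assoc r (r * k) (40 * k ^ 2) ⟩
  r ^ (r * k * (40 * k ^ 2))       ≤⟨ ^-exponent-≤ (≤-trans (n≤1+n 1) 2≤r) exponent ⟩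
  r ^ (400 * k ^ 3 * r)            ∎)
  where
  open ≤-Reasoning
  lem : ∀ r k → r * k * (40 * (k * (k * 1))) ≡ 40 * (k * (k * (k * 1)) * r)
  lem = solve-∀
  exponent : r * k * (40 * k ^ 2) ≤ 400 * k ^ 3 * r
  exponent = begin
    r * k * (40 * k ^ 2)    ≡⟨ lem r k ⟩
    40 * (k ^ 3 * r)        ≤⟨ *-monoˡ-≤ (k ^ 3 * r) (m≤m+n 40 360) ⟩
    400 * (k ^ 3 * r)       ≡⟨ *-assoc 400 (k ^ 3) r ⟨
    400 * k ^ 3 * r         ∎

theorem1p1 : Σ ℕ λ c → 1 ≤ c ×
    (∀ (r k : ℕ) → 2 ≤ r → 3 ≤ k → ∀ (R : ℕ) → IsRamseyNumber k r R →
    FolkmanAtMost k r (k ^ (400 * k ^ 4) * R ^ (40 * k ^ 2)) ×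
    (k ^ (400 * k ^ 4) * R ^ (40 * k ^ 2) ≤ k ^ (c * k ^ 4) * r ^ (c * k ^ 3 * r)))
theorem1p1 = 400 , s≤s z≤n , λ r k 2≤r 3≤k R isR →
  folkman-bound r k R 2≤r 3≤k isR , exponential-bound r k R 2≤r 3≤k isR
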